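{- For every integer $n\ge 1$ and every $c\in\mathbb{Q}$, one has $\partial_n^{(c)}(\mathfrak{H}^0)\subset\mathfrak{H}^0$ and $\partial_n^{(c)}(\mathfrak{H}^0)\subset\ker Z$; that is, $Z(\partial_n^{(c)}(w))=0$ for all $w\in\mathfrak{H}^0$.
   Context: Let $\mathfrak{H}=\mathbb{Q}\langle x,y\rangle$ be the noncommutative polynomial algebra over $\mathbb{Q}$ in two indeterminates $x,y$, and $z=x+y$. Let $\mathfrak{H}^1=\mathbb{Q}+\mathfrak{H}y$ and $\mathfrak{H}^0=\mathbb{Q}+x\mathfrak{H}y$. Let $Z:\mathfrak{H}^0\to\mathbb{R}$ be the $\mathbb{Q}$-linear map with $Z(1)=0$ and $Z(x^{k_1-1}yx^{k_2-1}y\cdots x^{k_n-1}y)=\zeta(k_1,\ldots,k_n)=\sum_{m_1>\cdots>m_n>0}m_1^{ -k_1}\cdots m_n^{ -k_n}$ (for $k_1\ge2$, $k_i\ge1$). Products of operators denote composition, $[A,B]=AB-BA$, $\mathrm{ad}(A)(B)=[A,B]$. $H:\mathfrak{H}\to\mathfrak{H}$ is the $\mathbb{Q}$-linear map with $H(w)=\deg(w)\,w$ for every word $w$. $\partial_1$ is the derivation of $\mathfrak{H}$ with $\partial_1(x)=xy$, $\partial_1(y)=-xy$. For $c\in\mathbb{Q}$, $\theta^{(c)}$ is the unique $\mathbb{Q}$-linear map $\mathfrak{H}\to\mathfrak{H}$ with $\theta^{(c)}(x)=\frac12(xz+zx)$, $\theta^{(c)}(y)=\frac12(yz+zy)$ and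 $\theta^{(c)}(ww')=\theta^{(c)}(w)w'+w\,\theta^{(c)}(w')+c\,\partial_1(w)H(w')$ for all $w,w'\in\mathfrak{H}$. For $n\ge1$, $\partial_n^{(c)}=\frac{1}{(n-1)!}\mathrm{ad}(\theta^{(c)})^{n-1}(\partial_1)$. -}

module Defs where

open import Data.Bool.Base using (if_then_else_)
open import Data.Empty using (⊥)
open import Data.Integer.Base as ℤ using (+_; +[1+_])
import Data.Integer.Properties as ℤₚ
open import Data.List.Base using (List; []; _∷_; _++_; [_]; length; replicate)
open import Data.List.Properties using (≡-dec; ++-assoc; ++-identityʳ; length-++)
open import Data.List.Relation.Unary.All using (All; []; _∷_)
open import Data.Nat.Base as ℕ using (ℕ; zero; suc; _!; z≤n; s≤s)
import Data.Nat.Properties as ℕₚ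
open import Data.Product.Base using (_×_; _,_; ∃-syntax; proj₁; proj₂)
open import Data.Rational.Base
  using (ℚ; mkℚ; 0ℚ; 1ℚ; ½; _+_; _*_; _-_; -_; 1/_; _/_; ∣_∣; _≤_; _<_; toℚᵘ; Positive; nonNegative; positive)
import Data.Rational.Properties as ℚₚ
import Data.Rational.Unnormalised.Base as ℚᵘ
import Data.Rational.Unnormalised.Properties as ℚᵘₚ
open import Data.Sum.Base using (inj₁; inj₂)
open import Data.Rational.Solver using (module +-*-Solver)
open import Relation.Binary.Definitions using (DecidableEquality)
open import Relation.Binary.PropositionalEquality
  using (_≡_; refl; sym; trans; cong; cong₂; subst; module ≡-Reasoning)
open import Relation.Nullary.Decidable.Core using (yes; no; does)
open import Relation.Nullary.Negation.Core using (contradiction)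

open +-*-Solver using (solve; _:=_; _:+_; _:*_; _:-_; :-_; con)

infixl 6 _⊕_ _⊖_
infixl 7 _⊙_
infixr 8 _•_
infix  4 _≈_

data Letter : Set where
  X Y : Letter

_≟ᴸ_ : DecidableEquality Letter
X ≟ᴸ X = yes refl
X ≟ᴸ Y = no λ ()
Y ≟ᴸ X = no λ ()
Y ≟ᴸ Y = yes refl

Word : Set
Word = List Letter

_≟ᵂ_ : DecidableEquality Word
_≟ᵂ_ = ≡-dec _≟ᴸ_

-- Formal sums Σ qᵢ wᵢ; two of them are the same element of ℚ⟨x,y⟩ when they
-- agree for _≈_, i.e. when every word has the same total coefficient in both.
𝓗 : Set
𝓗 = List (ℚ × Word)

-- The ℚ-linear extension of f : Word → ℚ.
eval : (Word → ℚ) → 𝓗 → ℚ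
eval f []            = 0ℚ
eval f ((q , w) ∷ u) = q * f w + eval f u

δ : Word → Word → ℚ
δ v w = if does (v ≟ᵂ w) then 1ℚ else 0ℚ

coeff : 𝓗 → Word → ℚ
coeff u w = eval (λ v → δ v w) u

record _≈_ (u v : 𝓗) : Set where
  constructor mk≈
  field
    coeff≡ : ∀ w → coeff u w ≡ coeff v w
open _≈_ public

0ᴴ : 𝓗
0ᴴ = []

_⊕_ : 𝓗 → 𝓗 → 𝓗
_⊕_ = _++_

_•_ : ℚ → 𝓗 → 𝓗
q • []            = []
q • ((p , w) ∷ u) = (q * p , w) ∷ q • u

_⊖_ : 𝓗 → 𝓗 → 𝓗
u ⊖ v = u ⊕ (- 1ℚ) • v

mono : Word → 𝓗
mono w = [ 1ℚ , w ]

-- The ℚ-linear extension of F : Word → 𝓗.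
lin : (Word → 𝓗) → 𝓗 → 𝓗
lin F []            = 0ᴴ
lin F ((q , w) ∷ u) = q • F w ⊕ lin F u

_⊙_ : 𝓗 → 𝓗 → 𝓗
u ⊙ v = lin (λ a → lin (λ b → mono (a ++ b)) v) u

1ᴴ x y z : 𝓗
1ᴴ = mono []
x  = mono [ X ]
y  = mono [ Y ]
z  = x ⊕ y

deg : Word → ℚ
deg w = + length w / 1

H : 𝓗 → 𝓗
H = lin (λ w → deg w • mono w)

∂₁ᴸ : Letter → 𝓗
∂₁ᴸ X = x ⊙ y
∂₁ᴸ Y = (- 1ℚ) • (x ⊙ y)

∂₁ᵂ : Word → 𝓗
∂₁ᵂ []      = 0ᴴ
∂₁ᵂ (a ∷ w) = ∂₁ᴸ a ⊙ mono w ⊕ mono [ a ] ⊙ ∂₁ᵂ w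

-- ∂₁-is∂₁ and ∂₁-unique below: the derivation with x ↦ xy, y ↦ -xy.
∂₁ : 𝓗 → 𝓗
∂₁ = lin ∂₁ᵂ

θᴸ : Letter → 𝓗
θᴸ X = ½ • (x ⊙ z ⊕ z ⊙ x)
θᴸ Y = ½ • (y ⊙ z ⊕ z ⊙ y)

-- The product rule of θ^(c) applied to a word split after its first letter.
θᵂ : ℚ → Word → 𝓗
θᵂ c []      = 0ᴴ
θᵂ c (a ∷ w) = θᴸ a ⊙ mono w ⊕ mono [ a ] ⊙ θᵂ c w ⊕ c • (∂₁ᴸ a ⊙ H (mono w))

-- θ-isθ and θ-unique below: the unique map with the defining properties of θ^(c).
θ : ℚ → 𝓗 → 𝓗
θ c = lin (θᵂ c)

ad : (𝓗 → 𝓗) → (𝓗 → 𝓗) → (𝓗 → 𝓗)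
ad A B w = A (B w) ⊖ B (A w)

ad^ : ℕ → (𝓗 → 𝓗) → (𝓗 → 𝓗) → (𝓗 → 𝓗)
ad^ zero    A B = B
ad^ (suc n) A B = ad A (ad^ n A B)

-- Only meaningful for n ≥ 1.
∂ : ℕ → ℚ → 𝓗 → 𝓗
∂ n c w = (+ 1 / ((n ℕ.∸ 1) !)) {{(n ℕ.∸ 1) ℕₚ.!≢0}} • ad^ (n ℕ.∸ 1) (θ c) ∂₁ w

module _ where
  open ≡-Reasoning

  eval-⊕ : ∀ f u v → eval f (u ⊕ v) ≡ eval f u + eval f v
  eval-⊕ f []            v = sym (ℚₚ.+-identityˡ _)
  eval-⊕ f ((q , w) ∷ u) v = trans (cong (λ t → q * f w + t) (eval-⊕ f u v)) (sym (ℚₚ.+-assoc (q * f w) _ _))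

  eval-• : ∀ f q u → eval f (q • u) ≡ q * eval f u
  eval-• f q []            = sym (ℚₚ.*-zeroʳ q)
  eval-• f q ((p , w) ∷ u) = trans (cong (λ t → q * p * f w + t) (eval-• f q u))
    (solve 4 (λ q p a b → q :* p :* a :+ q :* b := q :* (p :* a :+ b)) refl q p (f w) (eval f u))

  eval-mono : ∀ f w → eval f (mono w) ≡ f w
  eval-mono f w = solve 1 (λ a → con 1ℚ :* a :+ con 0ℚ := a) refl (f w)

  eval-lin : ∀ f F u → eval f (lin F u) ≡ eval (λ w → eval f (F w)) u
  eval-lin f F []            = refl
  eval-lin f F ((q , w) ∷ u) = trans (eval-⊕ f (q • F w) _) (cong₂ _+_ (eval-• f q (F w)) (eval-lin f F u))

  eval-ext : ∀ {f g} → (∀ w → f w ≡ g w) → ∀ u → eval f u ≡ eval g u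
  eval-ext f≡g []            = refl
  eval-ext f≡g ((q , w) ∷ u) = cong₂ (λ a b → q * a + b) (f≡g w) (eval-ext f≡g u)

  eval-0 : ∀ u → eval (λ _ → 0ℚ) u ≡ 0ℚ
  eval-0 []            = refl
  eval-0 ((q , w) ∷ u) = trans (cong (λ t → q * 0ℚ + t) (eval-0 u)) (solve 1 (λ q → q :* con 0ℚ :+ con 0ℚ := con 0ℚ) refl q)

  eval-+ : ∀ f g u → eval (λ w → f w + g w) u ≡ eval f u + eval g u
  eval-+ f g []            = refl
  eval-+ f g ((q , w) ∷ u) = trans (cong (λ t → q * (f w + g w) + t) (eval-+ f g u))
    (solve 5 (λ q a b c d → q :* (a :+ b) :+ (c :+ d) := (q :* a :+ c) :+ (q :* b :+ d)) refl q (f w) (g w) _ _)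

  eval-* : ∀ c f u → eval (λ w → c * f w) u ≡ c * eval f u
  eval-* c f []            = sym (ℚₚ.*-zeroʳ c)
  eval-* c f ((q , w) ∷ u) = trans (cong (λ t → q * (c * f w) + t) (eval-* c f u))
    (solve 4 (λ q c a b → q :* (c :* a) :+ c :* b := c :* (q :* a :+ b)) refl q c (f w) _)

  eval-swap : ∀ (g : Word → Word → ℚ) u v →
              eval (λ a → eval (g a) v) u ≡ eval (λ b → eval (λ a → g a b) u) v
  eval-swap g []            v = sym (eval-0 v)
  eval-swap g ((q , w) ∷ u) v = begin
    q * eval (g w) v + eval (λ a → eval (g a) v) u
      ≡⟨ cong₂ _+_ (sym (eval-* q (g w) v)) (eval-swap g u v) ⟩
    eval (λ b → q * g w b) v + eval (λ b → eval (λ a → g a b) u) v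
      ≡⟨ sym (eval-+ _ _ v) ⟩
    eval (λ b → q * g w b + eval (λ a → g a b) u) v ∎

  private
    remove : Word → 𝓗 → 𝓗
    remove v []            = []
    remove v ((q , w) ∷ u) = if does (w ≟ᵂ v) then remove v u else (q , w) ∷ remove v u

    remove-length : ∀ v u → length (remove v u) ℕ.≤ length u
    remove-length v []            = z≤n
    remove-length v ((q , w) ∷ u) with w ≟ᵂ v
    ... | yes _ = ℕₚ.m≤n⇒m≤1+n (remove-length v u)
    ... | no  _ = s≤s (remove-length v u)

    eval-remove : ∀ f v u → eval f u ≡ coeff u v * f v + eval f (remove v u)
    eval-remove f v []            = solve 1 (λ a → con 0ℚ := con 0ℚ :* a :+ con 0ℚ) refl (f v)
    eval-remove f v ((q , w) ∷ u) with w ≟ᵂ v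
    ... | yes refl = trans (cong (λ t → q * f w + t) (eval-remove f v u))
      (solve 4 (λ q a k e → q :* a :+ (k :* a :+ e) := (q :* con 1ℚ :+ k) :* a :+ e) refl q (f w) _ _)
    ... | no  _    = trans (cong (λ t → q * f w + t) (eval-remove f v u))
      (solve 5 (λ q a k b e → q :* a :+ (k :* b :+ e) := (q :* con 0ℚ :+ k) :* b :+ (q :* a :+ e)) refl q (f w) _ (f v) _)

    head-removed : ∀ q w u → remove w ((q , w) ∷ u) ≡ remove w u
    head-removed q w u with w ≟ᵂ w
    ... | yes _   = refl
    ... | no  w≢w = contradiction refl w≢w

    eval-null : ∀ n u → length u ℕ.≤ n → (∀ w → coeff u w ≡ 0ℚ) → ∀ f → eval f u ≡ 0ℚ
    eval-null n       []              _         _    f = refl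
    eval-null (suc n) u₀@((q , w) ∷ u) (s≤s len) null f = begin
      eval f u₀                                ≡⟨ eval-remove f w u₀ ⟩
      coeff u₀ w * f w + eval f (remove w u₀)  ≡⟨ cong₂ (λ k r → k * f w + eval f r) (null w) (head-removed q w u) ⟩
      0ℚ * f w + eval f r                      ≡⟨ cong (λ t → 0ℚ * f w + t) (eval-null n r (ℕₚ.≤-trans (remove-length w u) len) null′ f) ⟩
      0ℚ * f w + 0ℚ                            ≡⟨ solve 1 (λ a → con 0ℚ :* a :+ con 0ℚ := con 0ℚ) refl (f w) ⟩
      0ℚ                                       ∎
      where
      r = remove w u
      null′ : ∀ v → coeff r v ≡ 0ℚ
      null′ v = begin
        coeff r v                          ≡⟨ solve 2 (λ d e → e := con 0ℚ :* d :+ e) refl (δ w v) (coeff r v) ⟩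
        0ℚ * δ w v + coeff r v             ≡⟨ cong₂ (λ k r′ → k * δ w v + coeff r′ v) (sym (null w)) (sym (head-removed q w u)) ⟩
        coeff u₀ w * δ w v + coeff (remove w u₀) v ≡⟨ sym (eval-remove (λ a → δ a v) w u₀) ⟩
        coeff u₀ v                         ≡⟨ null v ⟩
        0ℚ                                 ∎

  eval-⊖ : ∀ f u v → eval f (u ⊖ v) ≡ eval f u - eval f v
  eval-⊖ f u v = begin
    eval f (u ⊖ v)                     ≡⟨ eval-⊕ f u _ ⟩
    eval f u + eval f ((- 1ℚ) • v)     ≡⟨ cong (λ t → eval f u + t) (eval-• f (- 1ℚ) v) ⟩
    eval f u + (- 1ℚ) * eval f v       ≡⟨ solve 2 (λ a b → a :+ con (- 1ℚ) :* b := a :- b) refl (eval f u) (eval f v) ⟩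
    eval f u - eval f v                ∎

  eval-cong : ∀ f {u v} → u ≈ v → eval f u ≡ eval f v
  eval-cong f {u} {v} u≈v = begin
    eval f u                             ≡⟨ solve 2 (λ a b → a := (a :- b) :+ b) refl (eval f u) (eval f v) ⟩
    (eval f u - eval f v) + eval f v     ≡⟨ cong (_+ eval f v) (trans (sym (eval-⊖ f u v)) (eval-null _ (u ⊖ v) ℕₚ.≤-refl null f)) ⟩
    0ℚ + eval f v                        ≡⟨ ℚₚ.+-identityˡ _ ⟩
    eval f v                             ∎
    where
    null : ∀ w → coeff (u ⊖ v) w ≡ 0ℚ
    null w = trans (eval-⊖ _ u v) (trans (cong (_- coeff v w) (coeff≡ u≈v w)) (ℚₚ.+-inverseʳ (coeff v w)))

  eval⇒≈ : ∀ {u v} → (∀ f → eval f u ≡ eval f v) → u ≈ v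
  eval⇒≈ h = mk≈ λ w → h (λ v → δ v w)

  eval-⊙ : ∀ f u v → eval f (u ⊙ v) ≡ eval (λ a → eval (λ b → f (a ++ b)) v) u
  eval-⊙ f u v = trans (eval-lin f _ u)
    (eval-ext (λ a → trans (eval-lin f _ v) (eval-ext (λ b → eval-mono f (a ++ b)) v)) u)

  eval-mono⊙ : ∀ f w u → eval f (mono w ⊙ u) ≡ eval (λ b → f (w ++ b)) u
  eval-mono⊙ f w u = trans (eval-⊙ f (mono w) u) (eval-mono (λ a → eval (λ b → f (a ++ b)) u) w)

  eval-⊙mono : ∀ f u w → eval f (u ⊙ mono w) ≡ eval (λ a → f (a ++ w)) u
  eval-⊙mono f u w = trans (eval-⊙ f u (mono w)) (eval-ext (λ a → eval-mono (λ b → f (a ++ b)) w) u)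

record IsLinear (φ : 𝓗 → 𝓗) : Set where
  field
    φ-cong : ∀ {u v} → u ≈ v → φ u ≈ φ v
    φ-⊕    : ∀ u v → φ (u ⊕ v) ≈ φ u ⊕ φ v
    φ-•    : ∀ q u → φ (q • u) ≈ q • φ u

record IsDerivation (φ : 𝓗 → 𝓗) : Set where
  field
    isLinear : IsLinear φ
    leibniz  : ∀ u v → φ (u ⊙ v) ≈ φ u ⊙ v ⊕ u ⊙ φ v

record Is∂₁ (φ : 𝓗 → 𝓗) : Set where
  field
    isDerivation : IsDerivation φ
    φ-x          : φ x ≈ x ⊙ y
    φ-y          : φ y ≈ (- 1ℚ) • (x ⊙ y)

record Isθ (c : ℚ) (φ : 𝓗 → 𝓗) : Set where
  field
    isLinear : IsLinear φ
    φ-x      : φ x ≈ ½ • (x ⊙ z ⊕ z ⊙ x)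
    φ-y      : φ y ≈ ½ • (y ⊙ z ⊕ z ⊙ y)
    product  : ∀ u v → φ (u ⊙ v) ≈ φ u ⊙ v ⊕ u ⊙ φ v ⊕ c • (∂₁ u ⊙ H v)

module _ where
  open ≡-Reasoning

  lin-isLinear : ∀ F → IsLinear (lin F)
  lin-isLinear F = record
    { φ-cong = λ {u} {v} u≈v → eval⇒≈ λ f → begin
        eval f (lin F u)                ≡⟨ eval-lin f F u ⟩
        eval (λ w → eval f (F w)) u     ≡⟨ eval-cong _ u≈v ⟩
        eval (λ w → eval f (F w)) v     ≡⟨ sym (eval-lin f F v) ⟩
        eval f (lin F v)                ∎
    ; φ-⊕ = λ u v → eval⇒≈ λ f → begin
        eval f (lin F (u ⊕ v))                                      ≡⟨ eval-lin f F (u ⊕ v) ⟩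
        eval (λ w → eval f (F w)) (u ⊕ v)                           ≡⟨ eval-⊕ _ u v ⟩
        eval (λ w → eval f (F w)) u + eval (λ w → eval f (F w)) v   ≡⟨ sym (cong₂ _+_ (eval-lin f F u) (eval-lin f F v)) ⟩
        eval f (lin F u) + eval f (lin F v)                         ≡⟨ sym (eval-⊕ f (lin F u) (lin F v)) ⟩
        eval f (lin F u ⊕ lin F v)                                  ∎
    ; φ-• = λ q u → eval⇒≈ λ f → begin
        eval f (lin F (q • u))               ≡⟨ eval-lin f F (q • u) ⟩
        eval (λ w → eval f (F w)) (q • u)    ≡⟨ eval-• _ q u ⟩
        q * eval (λ w → eval f (F w)) u      ≡⟨ cong (q *_) (sym (eval-lin f F u)) ⟩
        q * eval f (lin F u)                 ≡⟨ sym (eval-• f q (lin F u)) ⟩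
        eval f (q • lin F u)                 ∎
    }

  private
    eval-rhs : ∀ f c (p q r : 𝓗) → eval f (p ⊕ q ⊕ c • r) ≡ eval f p + eval f q + c * eval f r
    eval-rhs f c p q r = trans (eval-⊕ f (p ⊕ q) (c • r)) (cong₂ _+_ (eval-⊕ f p q) (eval-• f c r))

    product-rule : ∀ (D A B : Word → 𝓗) c →
      (∀ v w f → eval f (D (v ++ w)) ≡
         eval (λ p → f (p ++ w)) (D v) + eval (λ p → f (v ++ p)) (D w) + c * eval f (A v ⊙ B w)) →
      ∀ u v → lin D (u ⊙ v) ≈ lin D u ⊙ v ⊕ u ⊙ lin D v ⊕ c • (lin A u ⊙ lin B v)
    product-rule D A B c rule u v = eval⇒≈ λ f → let
        T₁ = λ a b → eval (λ p → f (p ++ b)) (D a)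
        T₂ = λ a b → eval (λ p → f (a ++ p)) (D b)
        T₃ = λ a b → eval f (A a ⊙ B b)
      in begin
        eval f (lin D (u ⊙ v))
          ≡⟨ eval-lin f D (u ⊙ v) ⟩
        eval (λ w → eval f (D w)) (u ⊙ v)
          ≡⟨ eval-⊙ _ u v ⟩
        eval (λ a → eval (λ b → eval f (D (a ++ b))) v) u
          ≡⟨ eval-ext (λ a → begin
               eval (λ b → eval f (D (a ++ b))) v                   ≡⟨ eval-ext (λ b → rule a b f) v ⟩
               eval (λ b → T₁ a b + T₂ a b + c * T₃ a b) v          ≡⟨ eval-+ (λ b → T₁ a b + T₂ a b) (λ b → c * T₃ a b) v ⟩
               eval (λ b → T₁ a b + T₂ a b) v + eval (λ b → c * T₃ a b) v
                 ≡⟨ cong₂ _+_ (eval-+ (T₁ a) (T₂ a) v) (eval-* c (T₃ a) v) ⟩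
               eval (T₁ a) v + eval (T₂ a) v + c * eval (T₃ a) v    ∎) u ⟩
        eval (λ a → eval (T₁ a) v + eval (T₂ a) v + c * eval (T₃ a) v) u
          ≡⟨ eval-+ (λ a → eval (T₁ a) v + eval (T₂ a) v) (λ a → c * eval (T₃ a) v) u ⟩
        eval (λ a → eval (T₁ a) v + eval (T₂ a) v) u + eval (λ a → c * eval (T₃ a) v) u
          ≡⟨ cong₂ _+_ (eval-+ (λ a → eval (T₁ a) v) (λ a → eval (T₂ a) v) u) (eval-* c (λ a → eval (T₃ a) v) u) ⟩
        eval (λ a → eval (T₁ a) v) u + eval (λ a → eval (T₂ a) v) u + c * eval (λ a → eval (T₃ a) v) u
          ≡⟨ sym (cong₂ _+_ (cong₂ _+_ (first f) (second f)) (cong (c *_) (third f))) ⟩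
        eval f (lin D u ⊙ v) + eval f (u ⊙ lin D v) + c * eval f (lin A u ⊙ lin B v)
          ≡⟨ sym (eval-rhs f c (lin D u ⊙ v) (u ⊙ lin D v) (lin A u ⊙ lin B v)) ⟩
        eval f (lin D u ⊙ v ⊕ u ⊙ lin D v ⊕ c • (lin A u ⊙ lin B v)) ∎
      where
      first : ∀ f → eval f (lin D u ⊙ v) ≡ eval (λ a → eval (λ b → eval (λ p → f (p ++ b)) (D a)) v) u
      first f = begin
        eval f (lin D u ⊙ v)                                          ≡⟨ eval-⊙ f (lin D u) v ⟩
        eval (λ p → eval (λ b → f (p ++ b)) v) (lin D u)              ≡⟨ eval-lin _ D u ⟩
        eval (λ a → eval (λ p → eval (λ b → f (p ++ b)) v) (D a)) u   ≡⟨ eval-ext (λ a → eval-swap (λ p b → f (p ++ b)) (D a) v) u ⟩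
        eval (λ a → eval (λ b → eval (λ p → f (p ++ b)) (D a)) v) u   ∎

      second : ∀ f → eval f (u ⊙ lin D v) ≡ eval (λ a → eval (λ b → eval (λ p → f (a ++ p)) (D b)) v) u
      second f = trans (eval-⊙ f u (lin D v)) (eval-ext (λ a → eval-lin (λ p → f (a ++ p)) D v) u)

      third : ∀ f → eval f (lin A u ⊙ lin B v) ≡ eval (λ a → eval (λ b → eval f (A a ⊙ B b)) v) u
      third f = begin
        eval f (lin A u ⊙ lin B v)
          ≡⟨ eval-⊙ f (lin A u) (lin B v) ⟩
        eval (λ p → eval (λ q → f (p ++ q)) (lin B v)) (lin A u)
          ≡⟨ eval-lin _ A u ⟩
        eval (λ a → eval (λ p → eval (λ q → f (p ++ q)) (lin B v)) (A a)) u
          ≡⟨ eval-ext (λ a → begin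
               eval (λ p → eval (λ q → f (p ++ q)) (lin B v)) (A a)
                 ≡⟨ eval-ext (λ p → eval-lin (λ q → f (p ++ q)) B v) (A a) ⟩
               eval (λ p → eval (λ b → eval (λ q → f (p ++ q)) (B b)) v) (A a)
                 ≡⟨ eval-swap (λ p b → eval (λ q → f (p ++ q)) (B b)) (A a) v ⟩
               eval (λ b → eval (λ p → eval (λ q → f (p ++ q)) (B b)) (A a)) v
                 ≡⟨ eval-ext (λ b → sym (eval-⊙ f (A a) (B b))) v ⟩
               eval (λ b → eval f (A a ⊙ B b)) v ∎) u ⟩
        eval (λ a → eval (λ b → eval f (A a ⊙ B b)) v) u ∎

    deg-++ : ∀ v w → deg (v ++ w) ≡ deg v + deg w
    deg-++ v w = ℚₚ.toℚᵘ-injective (begin-≃)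
      where
      ℕ-+ : ∀ m n → toℚᵘ (+ (m ℕ.+ n) / 1) ℚᵘ.≃ toℚᵘ (+ m / 1 + + n / 1)
      ℕ-+ m n = R.begin
        toℚᵘ (+ (m ℕ.+ n) / 1)                  R.≈⟨ ℚₚ.toℚᵘ-fromℚᵘ (ℚᵘ.mkℚᵘ (+ (m ℕ.+ n)) 0) ⟩
        ℚᵘ.mkℚᵘ (+ (m ℕ.+ n)) 0                 R.≈⟨ ℚᵘ.*≡* (cong (ℤ._* + 1) (cong₂ ℤ._+_ (sym (ℤₚ.*-identityʳ (+ m))) (sym (ℤₚ.*-identityʳ (+ n))))) ⟩
        ℚᵘ.mkℚᵘ (+ m) 0 ℚᵘ.+ ℚᵘ.mkℚᵘ (+ n) 0    R.≈⟨ ℚᵘₚ.+-cong (ℚᵘₚ.≃-sym (ℚₚ.toℚᵘ-fromℚᵘ (ℚᵘ.mkℚᵘ (+ m) 0))) (ℚᵘₚ.≃-sym (ℚₚ.toℚᵘ-fromℚᵘ (ℚᵘ.mkℚᵘ (+ n) 0))) ⟩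
        toℚᵘ (+ m / 1) ℚᵘ.+ toℚᵘ (+ n / 1)      R.≈⟨ ℚᵘₚ.≃-sym (ℚₚ.toℚᵘ-homo-+ (+ m / 1) (+ n / 1)) ⟩
        toℚᵘ (+ m / 1 + + n / 1)                R.∎
        where import Relation.Binary.Reasoning.Setoid ℚᵘₚ.≃-setoid as R
      begin-≃ : toℚᵘ (deg (v ++ w)) ℚᵘ.≃ toℚᵘ (deg v + deg w)
      begin-≃ = subst (λ n → toℚᵘ (+ n / 1) ℚᵘ.≃ toℚᵘ (deg v + deg w)) (sym (length-++ v)) (ℕ-+ (length v) (length w))

    ∂₁ᵂ-cons : ∀ f a w → eval f (∂₁ᵂ (a ∷ w)) ≡
      eval (λ p → f (p ++ w)) (∂₁ᴸ a) + eval (λ p → f (a ∷ p)) (∂₁ᵂ w)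
    ∂₁ᵂ-cons f a w = trans (eval-⊕ f (∂₁ᴸ a ⊙ mono w) _)
      (cong₂ _+_ (eval-⊙mono f (∂₁ᴸ a) w) (eval-mono⊙ f [ a ] (∂₁ᵂ w)))

    assoc-ext : ∀ f v w u → eval (λ p → f (p ++ (v ++ w))) u ≡ eval (λ p → f ((p ++ v) ++ w)) u
    assoc-ext f v w = eval-ext (λ p → cong f (sym (++-assoc p v w)))

    ∂₁ᵂ-++ : ∀ v w f → eval f (∂₁ᵂ (v ++ w)) ≡
      eval (λ p → f (p ++ w)) (∂₁ᵂ v) + eval (λ p → f (v ++ p)) (∂₁ᵂ w)
    ∂₁ᵂ-++ []      w f = sym (ℚₚ.+-identityˡ _)
    ∂₁ᵂ-++ (a ∷ v) w f = begin
      eval f (∂₁ᵂ (a ∷ v ++ w))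
        ≡⟨ ∂₁ᵂ-cons f a (v ++ w) ⟩
      eval (λ p → f (p ++ (v ++ w))) (∂₁ᴸ a) + eval (λ p → f (a ∷ p)) (∂₁ᵂ (v ++ w))
        ≡⟨ cong₂ _+_ (assoc-ext f v w (∂₁ᴸ a)) (∂₁ᵂ-++ v w (λ p → f (a ∷ p))) ⟩
      e₁ + (e₂ + e₃)
        ≡⟨ sym (ℚₚ.+-assoc e₁ e₂ e₃) ⟩
      e₁ + e₂ + e₃
        ≡⟨ cong (_+ e₃) (sym (∂₁ᵂ-cons (λ p → f (p ++ w)) a v)) ⟩
      eval (λ p → f (p ++ w)) (∂₁ᵂ (a ∷ v)) + e₃ ∎
      where
      e₁ = eval (λ p → f ((p ++ v) ++ w)) (∂₁ᴸ a)
      e₂ = eval (λ p → f (a ∷ p ++ w)) (∂₁ᵂ v)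
      e₃ = eval (λ p → f (a ∷ v ++ p)) (∂₁ᵂ w)

    Hᵂ : Word → 𝓗
    Hᵂ w = deg w • mono w

    eval-⊙Hᵂ : ∀ f u w → eval f (u ⊙ Hᵂ w) ≡ deg w * eval (λ p → f (p ++ w)) u
    eval-⊙Hᵂ f u w = begin
      eval f (u ⊙ Hᵂ w)                                ≡⟨ eval-⊙ f u (Hᵂ w) ⟩
      eval (λ a → eval (λ b → f (a ++ b)) (Hᵂ w)) u    ≡⟨ eval-ext (λ a → trans (eval-• (λ b → f (a ++ b)) (deg w) (mono w)) (cong (deg w *_) (eval-mono (λ b → f (a ++ b)) w))) u ⟩
      eval (λ a → deg w * f (a ++ w)) u                ≡⟨ eval-* (deg w) (λ a → f (a ++ w)) u ⟩
      deg w * eval (λ p → f (p ++ w)) u                ∎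

    eval-⊙H : ∀ f u w → eval f (u ⊙ H (mono w)) ≡ deg w * eval (λ p → f (p ++ w)) u
    eval-⊙H f u w = begin
      eval f (u ⊙ H (mono w))                               ≡⟨ eval-⊙ f u (H (mono w)) ⟩
      eval (λ a → eval (λ b → f (a ++ b)) (H (mono w))) u   ≡⟨ eval-ext (λ a → trans (eval-lin (λ b → f (a ++ b)) Hᵂ (mono w)) (eval-mono (λ v → eval (λ b → f (a ++ b)) (Hᵂ v)) w)) u ⟩
      eval (λ a → eval (λ b → f (a ++ b)) (Hᵂ w)) u         ≡⟨ sym (eval-⊙ f u (Hᵂ w)) ⟩
      eval f (u ⊙ Hᵂ w)                                     ≡⟨ eval-⊙Hᵂ f u w ⟩
      deg w * eval (λ p → f (p ++ w)) u                     ∎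

    θᵂ-cons : ∀ c f a w → eval f (θᵂ c (a ∷ w)) ≡
      eval (λ p → f (p ++ w)) (θᴸ a) + eval (λ p → f (a ∷ p)) (θᵂ c w) + c * (deg w * eval (λ p → f (p ++ w)) (∂₁ᴸ a))
    θᵂ-cons c f a w = trans (eval-rhs f c (θᴸ a ⊙ mono w) (mono [ a ] ⊙ θᵂ c w) (∂₁ᴸ a ⊙ H (mono w)))
      (cong₂ _+_ (cong₂ _+_ (eval-⊙mono f (θᴸ a) w) (eval-mono⊙ f [ a ] (θᵂ c w))) (cong (c *_) (eval-⊙H f (∂₁ᴸ a) w)))

    θᵂ-++ : ∀ c v w f → eval f (θᵂ c (v ++ w)) ≡
      eval (λ p → f (p ++ w)) (θᵂ c v) + eval (λ p → f (v ++ p)) (θᵂ c w) + c * (deg w * eval (λ p → f (p ++ w)) (∂₁ᵂ v))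
    θᵂ-++ c []      w f = solve 3 (λ e c d → e := con 0ℚ :+ e :+ c :* (d :* con 0ℚ)) refl (eval f (θᵂ c w)) c (deg w)
    θᵂ-++ c (a ∷ v) w f = begin
      eval f (θᵂ c (a ∷ v ++ w))
        ≡⟨ θᵂ-cons c f a (v ++ w) ⟩
      eval (λ p → f (p ++ (v ++ w))) (θᴸ a) + eval (λ p → f (a ∷ p)) (θᵂ c (v ++ w))
        + c * (deg (v ++ w) * eval (λ p → f (p ++ (v ++ w))) (∂₁ᴸ a))
        ≡⟨ cong₂ _+_ (cong₂ _+_ (assoc-ext f v w (θᴸ a)) (θᵂ-++ c v w (λ p → f (a ∷ p))))
                     (cong (c *_) (cong₂ _*_ (deg-++ v w) (assoc-ext f v w (∂₁ᴸ a)))) ⟩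
      e₁ + (e₂ + e₃ + c * (deg w * e₄)) + c * ((deg v + deg w) * e₅)
        ≡⟨ solve 8 (λ c d d′ e₁ e₂ e₃ e₄ e₅ →
             e₁ :+ (e₂ :+ e₃ :+ c :* (d′ :* e₄)) :+ c :* ((d :+ d′) :* e₅)
             := (e₁ :+ e₂ :+ c :* (d :* e₅)) :+ e₃ :+ c :* (d′ :* (e₅ :+ e₄)))
             refl c (deg v) (deg w) e₁ e₂ e₃ e₄ e₅ ⟩
      (e₁ + e₂ + c * (deg v * e₅)) + e₃ + c * (deg w * (e₅ + e₄))
        ≡⟨ sym (cong₂ (λ s t → s + e₃ + c * (deg w * t)) (θᵂ-cons c (λ p → f (p ++ w)) a v) (∂₁ᵂ-cons (λ p → f (p ++ w)) a v)) ⟩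
      eval (λ p → f (p ++ w)) (θᵂ c (a ∷ v)) + e₃ + c * (deg w * eval (λ p → f (p ++ w)) (∂₁ᵂ (a ∷ v))) ∎
      where
      e₁ = eval (λ p → f ((p ++ v) ++ w)) (θᴸ a)
      e₂ = eval (λ p → f (a ∷ p ++ w)) (θᵂ c v)
      e₃ = eval (λ p → f (a ∷ v ++ p)) (θᵂ c w)
      e₄ = eval (λ p → f (a ∷ p ++ w)) (∂₁ᵂ v)
      e₅ = eval (λ p → f ((p ++ v) ++ w)) (∂₁ᴸ a)

    eval-letter : ∀ f u → eval (λ p → f (p ++ [])) u ≡ eval f u
    eval-letter f = eval-ext (λ p → cong f (++-identityʳ p))

    ∂₁-letter : ∀ a → ∂₁ (mono [ a ]) ≈ ∂₁ᴸ a
    ∂₁-letter a = eval⇒≈ λ f → begin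
      eval f (∂₁ (mono [ a ]))                          ≡⟨ eval-lin f ∂₁ᵂ (mono [ a ]) ⟩
      eval (λ w → eval f (∂₁ᵂ w)) (mono [ a ])          ≡⟨ eval-mono (λ w → eval f (∂₁ᵂ w)) [ a ] ⟩
      eval f (∂₁ᵂ [ a ])                                ≡⟨ ∂₁ᵂ-cons f a [] ⟩
      eval (λ p → f (p ++ [])) (∂₁ᴸ a) + 0ℚ             ≡⟨ ℚₚ.+-identityʳ _ ⟩
      eval (λ p → f (p ++ [])) (∂₁ᴸ a)                  ≡⟨ eval-letter f (∂₁ᴸ a) ⟩
      eval f (∂₁ᴸ a)                                    ∎

    θ-letter : ∀ c a → θ c (mono [ a ]) ≈ θᴸ a
    θ-letter c a = eval⇒≈ λ f → begin
      eval f (θ c (mono [ a ]))                         ≡⟨ eval-lin f (θᵂ c) (mono [ a ]) ⟩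
      eval (λ w → eval f (θᵂ c w)) (mono [ a ])         ≡⟨ eval-mono (λ w → eval f (θᵂ c w)) [ a ] ⟩
      eval f (θᵂ c [ a ])                               ≡⟨ θᵂ-cons c f a [] ⟩
      eval (λ p → f (p ++ [])) (θᴸ a) + 0ℚ + c * (0ℚ * eval (λ p → f (p ++ [])) (∂₁ᴸ a))
        ≡⟨ solve 3 (λ t c e → t :+ con 0ℚ :+ c :* (con 0ℚ :* e) := t) refl (eval (λ p → f (p ++ [])) (θᴸ a)) c (eval (λ p → f (p ++ [])) (∂₁ᴸ a)) ⟩
      eval (λ p → f (p ++ [])) (θᴸ a)                   ≡⟨ eval-letter f (θᴸ a) ⟩
      eval f (θᴸ a)                                     ∎

  ∂₁-is∂₁ : Is∂₁ ∂₁
  ∂₁-is∂₁ = record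
    { isDerivation = record
      { isLinear = lin-isLinear ∂₁ᵂ
      ; leibniz  = λ u v → eval⇒≈ λ f → begin
          eval f (∂₁ (u ⊙ v))
            ≡⟨ eval-cong f (product-rule ∂₁ᵂ mono mono 0ℚ (λ a b g → trans (∂₁ᵂ-++ a b g)
                 (solve 2 (λ s t → s := s :+ con 0ℚ :* t) refl _ (eval g (mono a ⊙ mono b)))) u v) ⟩
          eval f (∂₁ u ⊙ v ⊕ u ⊙ ∂₁ v ⊕ 0ℚ • (lin mono u ⊙ lin mono v))
            ≡⟨ trans (eval-⊕ f (∂₁ u ⊙ v ⊕ u ⊙ ∂₁ v) _) (cong (λ t → eval f (∂₁ u ⊙ v ⊕ u ⊙ ∂₁ v) + t) (eval-• f 0ℚ (lin mono u ⊙ lin mono v))) ⟩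
          eval f (∂₁ u ⊙ v ⊕ u ⊙ ∂₁ v) + 0ℚ * eval f (lin mono u ⊙ lin mono v)
            ≡⟨ solve 2 (λ s t → s :+ con 0ℚ :* t := s) refl _ (eval f (lin mono u ⊙ lin mono v)) ⟩
          eval f (∂₁ u ⊙ v ⊕ u ⊙ ∂₁ v) ∎
      }
    ; φ-x = ∂₁-letter X
    ; φ-y = ∂₁-letter Y
    }

  θ-isθ : ∀ c → Isθ c (θ c)
  θ-isθ c = record
    { isLinear = lin-isLinear (θᵂ c)
    ; φ-x      = θ-letter c X
    ; φ-y      = θ-letter c Y
    ; product  = product-rule (θᵂ c) ∂₁ᵂ Hᵂ c (λ v w f → trans (θᵂ-++ c v w f)
        (cong (λ t → eval (λ p → f (p ++ w)) (θᵂ c v) + eval (λ p → f (v ++ p)) (θᵂ c w) + c * t) (sym (eval-⊙Hᵂ f (∂₁ᵂ v) w))))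
    }

  private
    lin-ext : ∀ {φ F} → IsLinear φ → (∀ w → φ (mono w) ≈ F w) → ∀ u → φ u ≈ lin F u
    lin-ext {φ} {F} φ-lin onWords u = eval⇒≈ (go u)
      where
      open IsLinear φ-lin
      go : ∀ u f → eval f (φ u) ≡ eval f (lin F u)
      go []            f = begin
        eval f (φ [])          ≡⟨ eval-cong f (φ-• 0ℚ []) ⟩
        eval f (0ℚ • φ [])     ≡⟨ eval-• f 0ℚ (φ []) ⟩
        0ℚ * eval f (φ [])     ≡⟨ ℚₚ.*-zeroˡ (eval f (φ [])) ⟩
        0ℚ                     ∎
      go ((q , w) ∷ u) f = begin
        eval f (φ ((q , w) ∷ u))                   ≡⟨ eval-cong f (φ-cong split) ⟩
        eval f (φ (q • mono w ⊕ u))                ≡⟨ eval-cong f (φ-⊕ (q • mono w) u) ⟩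
        eval f (φ (q • mono w) ⊕ φ u)              ≡⟨ eval-⊕ f (φ (q • mono w)) (φ u) ⟩
        eval f (φ (q • mono w)) + eval f (φ u)     ≡⟨ cong₂ _+_ (trans (eval-cong f (φ-• q (mono w))) (eval-• f q (φ (mono w)))) (go u f) ⟩
        q * eval f (φ (mono w)) + eval f (lin F u) ≡⟨ cong (λ t → q * t + eval f (lin F u)) (eval-cong f (onWords w)) ⟩
        q * eval f (F w) + eval f (lin F u)        ≡⟨ cong (_+ eval f (lin F u)) (sym (eval-• f q (F w))) ⟩
        eval f (q • F w) + eval f (lin F u)        ≡⟨ sym (eval-⊕ f (q • F w) (lin F u)) ⟩
        eval f (q • F w ⊕ lin F u)                 ∎
        where
        split : (q , w) ∷ u ≈ q • mono w ⊕ u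
        split = eval⇒≈ λ g → cong (λ t → t * g w + eval g u) (sym (ℚₚ.*-identityʳ q))

    word-ext : ∀ {φ} c (L : Letter → 𝓗) (F : Word → 𝓗) → IsLinear φ →
      (∀ u v → φ (u ⊙ v) ≈ φ u ⊙ v ⊕ u ⊙ φ v ⊕ c • (∂₁ u ⊙ H v)) →
      (∀ a → φ (mono [ a ]) ≈ L a) → F [] ≡ 0ᴴ →
      (∀ f a w → eval f (F (a ∷ w)) ≡
         eval (λ p → f (p ++ w)) (L a) + eval (λ p → f (a ∷ p)) (F w) + c * (deg w * eval (λ p → f (p ++ w)) (∂₁ᴸ a))) →
      ∀ w → φ (mono w) ≈ F w
    word-ext {φ} c L F φ-lin product onLetters F[] F-cons w = eval⇒≈ (go w)
      where
      open IsLinear φ-lin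
      go : ∀ w f → eval f (φ (mono w)) ≡ eval f (F w)
      go [] f = trans (begin
        e                                  ≡⟨ solve 1 (λ e → e := (e :+ e) :- e) refl e ⟩
        (e + e) - e                        ≡⟨ cong (_- e) (sym e≡e+e) ⟩
        e - e                              ≡⟨ ℚₚ.+-inverseʳ e ⟩
        0ℚ                                 ∎) (cong (eval f) (sym F[]))
        where
        e = eval f (φ 1ᴴ)
        1⊙1 : 1ᴴ ≈ 1ᴴ ⊙ 1ᴴ
        1⊙1 = eval⇒≈ λ g → sym (trans (eval-mono⊙ g [] 1ᴴ) refl)
        e≡e+e : e ≡ e + e
        e≡e+e = begin
          e                                       ≡⟨ eval-cong f (φ-cong 1⊙1) ⟩
          eval f (φ (1ᴴ ⊙ 1ᴴ))                    ≡⟨ eval-cong f (product 1ᴴ 1ᴴ) ⟩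
          eval f (φ 1ᴴ ⊙ 1ᴴ ⊕ 1ᴴ ⊙ φ 1ᴴ ⊕ c • []) ≡⟨ eval-rhs f c (φ 1ᴴ ⊙ 1ᴴ) (1ᴴ ⊙ φ 1ᴴ) [] ⟩
          eval f (φ 1ᴴ ⊙ 1ᴴ) + eval f (1ᴴ ⊙ φ 1ᴴ) + c * 0ℚ
            ≡⟨ cong₂ (λ s t → s + t + c * 0ℚ) (trans (eval-⊙mono f (φ 1ᴴ) []) (eval-letter f (φ 1ᴴ))) (eval-mono⊙ f [] (φ 1ᴴ)) ⟩
          e + e + c * 0ℚ                          ≡⟨ solve 2 (λ e c → e :+ e :+ c :* con 0ℚ := e :+ e) refl e c ⟩
          e + e                                   ∎
      go (a ∷ w) f = begin
        eval f (φ (mono (a ∷ w)))                 ≡⟨ eval-cong f (φ-cong (eval⇒≈ λ g → sym (trans (eval-mono⊙ g [ a ] (mono w)) refl))) ⟩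
        eval f (φ (mono [ a ] ⊙ mono w))          ≡⟨ eval-cong f (product (mono [ a ]) (mono w)) ⟩
        eval f (φ (mono [ a ]) ⊙ mono w ⊕ mono [ a ] ⊙ φ (mono w) ⊕ c • (∂₁ (mono [ a ]) ⊙ H (mono w)))
          ≡⟨ eval-rhs f c (φ (mono [ a ]) ⊙ mono w) (mono [ a ] ⊙ φ (mono w)) (∂₁ (mono [ a ]) ⊙ H (mono w)) ⟩
        eval f (φ (mono [ a ]) ⊙ mono w) + eval f (mono [ a ] ⊙ φ (mono w)) + c * eval f (∂₁ (mono [ a ]) ⊙ H (mono w))
          ≡⟨ cong₂ _+_ (cong₂ _+_
               (trans (eval-⊙mono f (φ (mono [ a ])) w) (eval-cong (λ p → f (p ++ w)) (onLetters a)))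
               (trans (eval-mono⊙ f [ a ] (φ (mono w))) (go w (λ p → f (a ∷ p)))))
               (cong (c *_) (trans (eval-⊙H f (∂₁ (mono [ a ])) w) (cong (deg w *_) (eval-cong (λ p → f (p ++ w)) (∂₁-letter a))))) ⟩
        eval (λ p → f (p ++ w)) (L a) + eval (λ p → f (a ∷ p)) (F w) + c * (deg w * eval (λ p → f (p ++ w)) (∂₁ᴸ a))
          ≡⟨ sym (F-cons f a w) ⟩
        eval f (F (a ∷ w))                        ∎

  ∂₁-unique : ∀ {φ} → Is∂₁ φ → ∀ u → φ u ≈ ∂₁ u
  ∂₁-unique {φ} φ-is∂₁ = lin-ext isLinear (word-ext 0ℚ ∂₁ᴸ ∂₁ᵂ isLinear
      (λ u v → eval⇒≈ λ f → begin
        eval f (φ (u ⊙ v))                           ≡⟨ eval-cong f (leibniz u v) ⟩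
        eval f (φ u ⊙ v ⊕ u ⊙ φ v)                   ≡⟨ eval-⊕ f (φ u ⊙ v) (u ⊙ φ v) ⟩
        eval f (φ u ⊙ v) + eval f (u ⊙ φ v)          ≡⟨ drop₀ _ (eval f (∂₁ u ⊙ H v)) ⟩
        eval f (φ u ⊙ v) + eval f (u ⊙ φ v) + 0ℚ * eval f (∂₁ u ⊙ H v)
          ≡⟨ sym (eval-rhs f 0ℚ (φ u ⊙ v) (u ⊙ φ v) (∂₁ u ⊙ H v)) ⟩
        eval f (φ u ⊙ v ⊕ u ⊙ φ v ⊕ 0ℚ • (∂₁ u ⊙ H v)) ∎)
      (λ { X → φ-x ; Y → φ-y }) refl
      (λ f a w → trans (∂₁ᵂ-cons f a w) (drop₀ _ (deg w * eval (λ p → f (p ++ w)) (∂₁ᴸ a)))))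
    where
    open Is∂₁ φ-is∂₁
    open IsDerivation isDerivation
    drop₀ : ∀ s t → s ≡ s + 0ℚ * t
    drop₀ = solve 2 (λ s t → s := s :+ con 0ℚ :* t) refl

  θ-unique : ∀ c {φ} → Isθ c φ → ∀ u → φ u ≈ θ c u
  θ-unique c φ-isθ = lin-ext isLinear (word-ext c θᴸ (θᵂ c) isLinear product (λ { X → φ-x ; Y → φ-y }) refl (θᵂ-cons c))
    where open Isθ φ-isθ

record ℝ : Set where
  field
    seq    : ℕ → ℚ
    cauchy : ∀ ε → 0ℚ < ε → ∃[ N ] (∀ m n → N ℕ.≤ m → N ℕ.≤ n → ∣ seq m - seq n ∣ < ε)
open ℝ public

infix 4 _≃_

record _≃_ (r s : ℝ) : Set where
  constructor mk≃
  field
    close : ∀ ε → 0ℚ < ε → ∃[ N ] (∀ n → N ℕ.≤ n → ∣ seq r n - seq s n ∣ < ε)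
open _≃_ public

infixl 6 _+ℝ_
infixr 8 _•ℝ_

private
  ½*pos : ∀ {ε} → 0ℚ < ε → 0ℚ < ½ * ε
  ½*pos {ε} 0<ε = subst (_< ½ * ε) (ℚₚ.*-zeroʳ ½) (ℚₚ.*-monoʳ-<-pos ½ 0<ε)

  ½+½ : ∀ ε → ½ * ε + ½ * ε ≡ ε
  ½+½ = solve 1 (λ e → con ½ :* e :+ con ½ :* e := e) refl

  -- δ is chosen with (1 + |q|) δ = ε.
  scale : ∀ q ε → 0ℚ < ε → ∃[ δ′ ] (0ℚ < δ′ × (∀ d → ∣ d ∣ < δ′ → ∣ q * d ∣ < ε))
  scale q ε 0<ε = δ′ , 0<δ′ , bound
    where
    k = 1ℚ + ∣ q ∣
    0≤∣q∣ = ℚₚ.0≤∣p∣ q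
    0<k : 0ℚ < k
    0<k = ℚₚ.<-≤-trans (ℚₚ.positive⁻¹ 1ℚ) (subst (_≤ k) (ℚₚ.+-identityʳ 1ℚ) (ℚₚ.+-monoʳ-≤ 1ℚ 0≤∣q∣))
    instance
      k-pos : Positive k
      k-pos = positive 0<k
      k≢0 = ℚₚ.pos⇒nonZero k
      1/k-pos : Positive (1/ k)
      1/k-pos = ℚₚ.1/pos⇒pos k
    δ′ = (1/ k) * ε
    0<δ′ : 0ℚ < δ′
    0<δ′ = subst (_< δ′) (ℚₚ.*-zeroʳ (1/ k)) (ℚₚ.*-monoʳ-<-pos (1/ k) 0<ε)
    kδ′ : k * δ′ ≡ ε
    kδ′ = trans (sym (ℚₚ.*-assoc k (1/ k) ε)) (trans (cong (_* ε) (ℚₚ.*-inverseʳ k)) (ℚₚ.*-identityˡ ε))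
    bound : ∀ d → ∣ d ∣ < δ′ → ∣ q * d ∣ < ε
    bound d d<δ′ = begin-strict
      ∣ q * d ∣        ≡⟨ ℚₚ.∣p*q∣≡∣p∣*∣q∣ q d ⟩
      ∣ q ∣ * ∣ d ∣    ≤⟨ ℚₚ.*-monoʳ-≤-nonNeg ∣ d ∣ {{ℚₚ.∣-∣-nonNeg d}} ∣q∣≤k ⟩
      k * ∣ d ∣        <⟨ ℚₚ.*-monoʳ-<-pos k d<δ′ ⟩
      k * δ′           ≡⟨ kδ′ ⟩
      ε                ∎
      where
      open ℚₚ.≤-Reasoning
      ∣q∣≤k : ∣ q ∣ ≤ k
      ∣q∣≤k = subst (_≤ k) (ℚₚ.+-identityˡ ∣ q ∣) (ℚₚ.+-monoˡ-≤ ∣ q ∣ (ℚₚ.<⇒≤ (ℚₚ.positive⁻¹ 1ℚ)))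

0ℝ : ℝ
0ℝ = record { seq = λ _ → 0ℚ ; cauchy = λ ε 0<ε → 0 , λ _ _ _ _ → 0<ε }

_+ℝ_ : ℝ → ℝ → ℝ
r +ℝ s = record
  { seq    = λ n → seq r n + seq s n
  ; cauchy = λ ε 0<ε → let
        (M , hM) = cauchy r (½ * ε) (½*pos 0<ε)
        (N , hN) = cauchy s (½ * ε) (½*pos 0<ε)
      in M ℕ.⊔ N , λ m n m≥ n≥ → begin-strict
        ∣ (seq r m + seq s m) - (seq r n + seq s n) ∣
          ≡⟨ cong ∣_∣ (solve 4 (λ a b c d → (a :+ b) :- (c :+ d) := (a :- c) :+ (b :- d)) refl (seq r m) (seq s m) (seq r n) (seq s n)) ⟩
        ∣ (seq r m - seq r n) + (seq s m - seq s n) ∣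
          ≤⟨ ℚₚ.∣p+q∣≤∣p∣+∣q∣ (seq r m - seq r n) (seq s m - seq s n) ⟩
        ∣ seq r m - seq r n ∣ + ∣ seq s m - seq s n ∣
          <⟨ ℚₚ.+-mono-< (hM m n (ℕₚ.m⊔n≤o⇒m≤o M N m≥) (ℕₚ.m⊔n≤o⇒m≤o M N n≥)) (hN m n (ℕₚ.m⊔n≤o⇒n≤o M N m≥) (ℕₚ.m⊔n≤o⇒n≤o M N n≥)) ⟩
        ½ * ε + ½ * ε
          ≡⟨ ½+½ ε ⟩
        ε ∎
  }
  where open ℚₚ.≤-Reasoning

_•ℝ_ : ℚ → ℝ → ℝ
q •ℝ r = record
  { seq    = λ n → q * seq r n
  ; cauchy = λ ε 0<ε → let
        (δ′ , 0<δ′ , small) = scale q ε 0<ε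
        (N , hN)            = cauchy r δ′ 0<δ′
      in N , λ m n m≥ n≥ → subst (λ t → ∣ t ∣ < ε)
           (solve 3 (λ q a b → q :* (a :- b) := q :* a :- q :* b) refl q (seq r m) (seq r n))
           (small (seq r m - seq r n) (hN m n m≥ n≥))
  }

≃-pointwise : ∀ {r s} → (∀ n → seq r n ≡ seq s n) → r ≃ s
≃-pointwise {r} {s} eq = mk≃ λ ε 0<ε → 0 , λ n _ →
  subst (λ t → ∣ t ∣ < ε) (sym (trans (cong (_- seq s n) (eq n)) (ℚₚ.+-inverseʳ (seq s n)))) 0<ε

-- ζ≤ N (k₁ ∷ … ∷ kᵣ ∷ []) = Σ_{N ≥ m₁ > ⋯ > mᵣ > 0} m₁^{-k₁} ⋯ mᵣ^{-kᵣ},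
-- computed by splitting off the terms with m₁ = N.
ζ≤ : ℕ → List ℕ → ℚ
ζ≤ N       []       = 1ℚ
ζ≤ zero    (k ∷ ks) = 0ℚ
ζ≤ (suc m) (k ∷ ks) = ζ≤ m (k ∷ ks) + (+ 1 / (suc m ℕ.^ k)) {{ℕₚ.m^n≢0 (suc m) k}} * ζ≤ m ks

Admissible : List ℕ → Set
Admissible []       = ⊥
Admissible (k ∷ ks) = 2 ℕ.≤ k × All (1 ℕ.≤_) ks

module _ where
  open ℚₚ.≤-Reasoning

  private
    ℕ→ℚ : ℕ → ℚ
    ℕ→ℚ n = + n / 1

    rec : ℕ → ℚ
    rec m = + 1 / suc m

    pw : ℕ → ℕ → ℚ
    pw m k = (+ 1 / (suc m ℕ.^ k)) {{ℕₚ.m^n≢0 (suc m) k}}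

    0≤1/ : ∀ n .{{_ : ℕ.NonZero n}} → 0ℚ ≤ + 1 / n
    0≤1/ n = ℚₚ.nonNegative⁻¹ _ {{ℚₚ.normalize-nonNeg 1 n}}

    1/-* : ∀ m n .{{_ : ℕ.NonZero m}} .{{_ : ℕ.NonZero n}} .{{_ : ℕ.NonZero (m ℕ.* n)}} →
           + 1 / (m ℕ.* n) ≡ (+ 1 / m) * (+ 1 / n)
    1/-* m@(suc m-1) n@(suc n-1) = ℚₚ.toℚᵘ-injective (R.begin
      toℚᵘ (+ 1 / (m ℕ.* n))                     R.≈⟨ ℚₚ.toℚᵘ-fromℚᵘ (ℚᵘ.mkℚᵘ (+ 1) _) ⟩
      ℚᵘ.mkℚᵘ (+ 1) m-1 ℚᵘ.* ℚᵘ.mkℚᵘ (+ 1) n-1   R.≈⟨ ℚᵘₚ.*-cong (ℚᵘₚ.≃-sym (ℚₚ.toℚᵘ-fromℚᵘ (ℚᵘ.mkℚᵘ (+ 1) m-1))) (ℚᵘₚ.≃-sym (ℚₚ.toℚᵘ-fromℚᵘ (ℚᵘ.mkℚᵘ (+ 1) n-1))) ⟩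
      toℚᵘ (+ 1 / m) ℚᵘ.* toℚᵘ (+ 1 / n)         R.≈⟨ ℚᵘₚ.≃-sym (ℚₚ.toℚᵘ-homo-* (+ 1 / m) (+ 1 / n)) ⟩
      toℚᵘ ((+ 1 / m) * (+ 1 / n))               R.∎)
      where import Relation.Binary.Reasoning.Setoid ℚᵘₚ.≃-setoid as R

    ℕ→ℚ-suc : ∀ n → ℕ→ℚ (suc n) ≡ ℕ→ℚ n + 1ℚ
    ℕ→ℚ-suc n = ℚₚ.toℚᵘ-injective (R.begin
      toℚᵘ (+ suc n / 1)                R.≈⟨ ℚₚ.toℚᵘ-fromℚᵘ (ℚᵘ.mkℚᵘ (+ suc n) 0) ⟩
      ℚᵘ.mkℚᵘ (+ suc n) 0               R.≈⟨ ℚᵘ.*≡* (cong (λ t → + t ℤ.* + 1) (trans (ℕₚ.+-comm 1 n) (cong (ℕ._+ 1) (sym (ℕₚ.*-identityʳ n))))) ⟩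
      ℚᵘ.mkℚᵘ (+ (n ℕ.* 1 ℕ.+ 1)) 0     R.≈⟨ ℚᵘ.*≡* (cong (λ t → (t ℤ.+ + 1) ℤ.* + 1) (ℤₚ.pos-* n 1)) ⟩
      ℚᵘ.mkℚᵘ (+ n) 0 ℚᵘ.+ toℚᵘ 1ℚ      R.≈⟨ ℚᵘₚ.+-cong (ℚᵘₚ.≃-sym (ℚₚ.toℚᵘ-fromℚᵘ (ℚᵘ.mkℚᵘ (+ n) 0))) (ℚᵘₚ.≃-refl {toℚᵘ 1ℚ}) ⟩
      toℚᵘ (+ n / 1) ℚᵘ.+ toℚᵘ 1ℚ       R.≈⟨ ℚᵘₚ.≃-sym (ℚₚ.toℚᵘ-homo-+ (+ n / 1) 1ℚ) ⟩
      toℚᵘ (+ n / 1 + 1ℚ)               R.∎)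
      where import Relation.Binary.Reasoning.Setoid ℚᵘₚ.≃-setoid as R

    ℕ→ℚ*rec : ∀ m → ℕ→ℚ (suc m) * rec m ≡ 1ℚ
    ℕ→ℚ*rec m = ℚₚ.toℚᵘ-injective (R.begin
      toℚᵘ (+ suc m / 1 * rec m)                          R.≈⟨ ℚₚ.toℚᵘ-homo-* (+ suc m / 1) (rec m) ⟩
      toℚᵘ (+ suc m / 1) ℚᵘ.* toℚᵘ (rec m)                R.≈⟨ ℚᵘₚ.*-cong (ℚₚ.toℚᵘ-fromℚᵘ (ℚᵘ.mkℚᵘ (+ suc m) 0)) (ℚₚ.toℚᵘ-fromℚᵘ (ℚᵘ.mkℚᵘ (+ 1) m)) ⟩
      ℚᵘ.mkℚᵘ (+ suc m) 0 ℚᵘ.* ℚᵘ.mkℚᵘ (+ 1) m            R.≈⟨ ℚᵘ.*≡* (cong (λ t → + suc t) (trans (ℕₚ.*-identityʳ (m ℕ.* 1)) (trans (ℕₚ.*-identityʳ m) (sym (trans (ℕₚ.+-identityʳ _) (ℕₚ.+-identityʳ m)))))) ⟩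
      toℚᵘ 1ℚ                                             R.∎)
      where import Relation.Binary.Reasoning.Setoid ℚᵘₚ.≃-setoid as R

    ≤-by : ∀ {a b} c → 0ℚ ≤ c → b ≡ a + c → a ≤ b
    ≤-by {a} {b} c 0≤c eq = begin
      a        ≡⟨ sym (ℚₚ.+-identityʳ a) ⟩
      a + 0ℚ   ≤⟨ ℚₚ.+-monoʳ-≤ a 0≤c ⟩
      a + c    ≡⟨ sym eq ⟩
      b        ∎

    *-monoʳ : ∀ {a b} c → 0ℚ ≤ c → a ≤ b → c * a ≤ c * b
    *-monoʳ c 0≤c = ℚₚ.*-monoˡ-≤-nonNeg c {{nonNegative 0≤c}}

    *-monoˡ : ∀ {a b} c → 0ℚ ≤ c → a ≤ b → a * c ≤ b * c
    *-monoˡ c 0≤c = ℚₚ.*-monoʳ-≤-nonNeg c {{nonNegative 0≤c}}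

    0≤* : ∀ {a b} → 0ℚ ≤ a → 0ℚ ≤ b → 0ℚ ≤ a * b
    0≤* {a} {b} 0≤a 0≤b = subst (_≤ a * b) (ℚₚ.*-zeroʳ a) (*-monoʳ a 0≤a 0≤b)

    0≤+ : ∀ {a b} → 0ℚ ≤ a → 0ℚ ≤ b → 0ℚ ≤ a + b
    0≤+ = ℚₚ.+-mono-≤

    0≤½ : 0ℚ ≤ ½
    0≤½ = ℚₚ.nonNegative⁻¹ ½

    0≤1 : 0ℚ ≤ 1ℚ
    0≤1 = ℚₚ.nonNegative⁻¹ 1ℚ

    0≤ℕ→ℚ : ∀ n → 0ℚ ≤ ℕ→ℚ n
    0≤ℕ→ℚ n = ℚₚ.nonNegative⁻¹ (ℕ→ℚ n) {{ℚₚ.normalize-nonNeg n 1}}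

    0≤rec : ∀ m → 0ℚ ≤ rec m
    0≤rec m = 0≤1/ (suc m)

    rec-eq : ∀ m → ℕ→ℚ m * rec m + rec m ≡ 1ℚ
    rec-eq m = trans (solve 2 (λ a r → a :* r :+ r := (a :+ con 1ℚ) :* r) refl (ℕ→ℚ m) (rec m))
                     (trans (cong (_* rec m) (sym (ℕ→ℚ-suc m))) (ℕ→ℚ*rec m))

    rec≤1 : ∀ m → rec m ≤ 1ℚ
    rec≤1 m = ≤-by (ℕ→ℚ m * rec m) (0≤* (0≤ℕ→ℚ m) (0≤rec m)) (trans (sym (rec-eq m)) (ℚₚ.+-comm (ℕ→ℚ m * rec m) (rec m)))

    pw-suc : ∀ m k → pw m (suc k) ≡ rec m * pw m k
    pw-suc m k = 1/-* (suc m) (suc m ℕ.^ k) {{_}} {{ℕₚ.m^n≢0 (suc m) k}} {{ℕₚ.m^n≢0 (suc m) (suc k)}}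

    0≤pw : ∀ m k → 0ℚ ≤ pw m k
    0≤pw m k = 0≤1/ (suc m ℕ.^ k) {{ℕₚ.m^n≢0 (suc m) k}}

    pw≤1 : ∀ m k → pw m k ≤ 1ℚ
    pw≤1 m zero    = ℚₚ.≤-refl
    pw≤1 m (suc k) = begin
      pw m (suc k)     ≡⟨ pw-suc m k ⟩
      rec m * pw m k   ≤⟨ *-monoʳ (rec m) (0≤rec m) (pw≤1 m k) ⟩
      rec m * 1ℚ       ≡⟨ ℚₚ.*-identityʳ (rec m) ⟩
      rec m            ≤⟨ rec≤1 m ⟩
      1ℚ               ∎

    pw≤rec : ∀ m k → 1 ℕ.≤ k → pw m k ≤ rec m
    pw≤rec m (suc k) _ = begin
      pw m (suc k)     ≡⟨ pw-suc m k ⟩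
      rec m * pw m k   ≤⟨ *-monoʳ (rec m) (0≤rec m) (pw≤1 m k) ⟩
      rec m * 1ℚ       ≡⟨ ℚₚ.*-identityʳ (rec m) ⟩
      rec m            ∎

    pw≤rec² : ∀ m k → 2 ℕ.≤ k → pw m k ≤ rec m * rec m
    pw≤rec² m (suc k) (s≤s 1≤k) = begin
      pw m (suc k)     ≡⟨ pw-suc m k ⟩
      rec m * pw m k   ≤⟨ *-monoʳ (rec m) (0≤rec m) (pw≤rec m k 1≤k) ⟩
      rec m * rec m    ∎

    0≤ζ≤ : ∀ m ks → 0ℚ ≤ ζ≤ m ks
    0≤ζ≤ m       []       = 0≤1
    0≤ζ≤ zero    (k ∷ ks) = ℚₚ.≤-refl
    0≤ζ≤ (suc m) (k ∷ ks) = 0≤+ (0≤ζ≤ m (k ∷ ks)) (0≤* (0≤pw m k) (0≤ζ≤ m ks))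

    -- P m = Π_{1 ≤ j ≤ m} (1 + 1/(2j)) grows like √m; its expansion dominates
    -- 2^{-r} ζ≤ m (1,…,1), which bounds every truncated sum of depth r.
    P : ℕ → ℚ
    P zero    = 1ℚ
    P (suc m) = P m * (1ℚ + ½ * rec m)

    1≤P : ∀ m → 1ℚ ≤ P m
    0≤P : ∀ m → 0ℚ ≤ P m
    0≤P m = ℚₚ.≤-trans 0≤1 (1≤P m)
    1≤P zero    = ℚₚ.≤-refl
    1≤P (suc m) = ℚₚ.≤-trans (1≤P m) (≤-by (P m * (½ * rec m)) (0≤* (0≤P m) (0≤* 0≤½ (0≤rec m)))
      (solve 2 (λ p h → p :* (con 1ℚ :+ h) := p :+ p :* h) refl (P m) (½ * rec m)))

    pow2 : ℕ → ℚ
    pow2 zero    = 1ℚ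
    pow2 (suc r) = (1ℚ + 1ℚ) * pow2 r

    0≤pow2 : ∀ r → 0ℚ ≤ pow2 r
    0≤pow2 zero    = 0≤1
    0≤pow2 (suc r) = 0≤* (0≤+ 0≤1 0≤1) (0≤pow2 r)

    ζ≤-bound : ∀ m ks → All (1 ℕ.≤_) ks → ζ≤ m ks ≤ pow2 (length ks) * P m
    ζ≤-bound m       []       []           = subst (1ℚ ≤_) (sym (ℚₚ.*-identityˡ (P m))) (1≤P m)
    ζ≤-bound zero    (k ∷ ks) _            = 0≤* (0≤pow2 (suc (length ks))) (0≤P zero)
    ζ≤-bound (suc m) (k ∷ ks) (1≤k ∷ 1≤ks) = begin
      ζ≤ m (k ∷ ks) + pw m k * ζ≤ m ks
        ≤⟨ ℚₚ.+-mono-≤ (ζ≤-bound m (k ∷ ks) (1≤k ∷ 1≤ks))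
             (ℚₚ.≤-trans (*-monoˡ (ζ≤ m ks) (0≤ζ≤ m ks) (pw≤rec m k 1≤k))
                         (*-monoʳ (rec m) (0≤rec m) (ζ≤-bound m ks 1≤ks))) ⟩
      (1ℚ + 1ℚ) * C * P m + rec m * (C * P m)
        ≡⟨ solve 3 (λ c p r → (con 1ℚ :+ con 1ℚ) :* c :* p :+ r :* (c :* p) := (con 1ℚ :+ con 1ℚ) :* c :* (p :* (con 1ℚ :+ con ½ :* r))) refl C (P m) (rec m) ⟩
      (1ℚ + 1ℚ) * C * P (suc m) ∎
      where C = pow2 (length ks)

    Q : ℕ → ℚ
    Q j = P (suc j) * rec j

    0≤Q : ∀ j → 0ℚ ≤ Q j
    0≤Q j = 0≤* (0≤P (suc j)) (0≤rec j)

    rec-step : ∀ j → rec j ≡ rec (suc j) + rec j * rec (suc j)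
    rec-step j = ≡.begin
      t                    ≡.≡⟨ sym (ℚₚ.*-identityʳ t) ⟩
      t * 1ℚ               ≡.≡⟨ cong (t *_) (sym (rec-eq (suc j))) ⟩
      t * (a * s + s)      ≡.≡⟨ solve 3 (λ t a s → t :* (a :* s :+ s) := (a :* t) :* s :+ t :* s) refl t a s ⟩
      (a * t) * s + t * s  ≡.≡⟨ cong (λ e → e * s + t * s) (ℕ→ℚ*rec j) ⟩
      1ℚ * s + t * s       ≡.≡⟨ cong (_+ t * s) (ℚₚ.*-identityˡ s) ⟩
      s + t * s            ≡.∎
      where
      module ≡ = ≡-Reasoning
      t = rec j
      s = rec (suc j)
      a = ℕ→ℚ (suc j)

    module _ (k : ℕ) (ks : List ℕ) (2≤k : 2 ℕ.≤ k) (1≤ks : All (1 ℕ.≤_) ks) where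
      C D : ℚ
      C = pow2 (length ks)
      D = (1ℚ + 1ℚ) * C

      0≤D : 0ℚ ≤ D
      0≤D = 0≤pow2 (suc (length ks))

      -- ζ≤ (suc j) (k ∷ ks) + D * Q j is nonincreasing in j.
      G-step : ∀ j → ζ≤ (suc (suc j)) (k ∷ ks) + D * Q (suc j) ≤ ζ≤ (suc j) (k ∷ ks) + D * Q j
      G-step j = begin
        (ζ + pw (suc j) k * ζ≤ (suc j) ks) + D * Q (suc j)
          ≤⟨ ℚₚ.+-monoˡ-≤ (D * Q (suc j)) (ℚₚ.+-monoʳ-≤ ζ
               (ℚₚ.≤-trans (*-monoˡ (ζ≤ (suc j) ks) (0≤ζ≤ (suc j) ks) (pw≤rec² (suc j) k 2≤k))
                           (*-monoʳ (s * s) (0≤* (0≤rec (suc j)) (0≤rec (suc j))) (ζ≤-bound (suc j) ks 1≤ks)))) ⟩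
        (ζ + s * s * (C * p)) + D * (p * (1ℚ + ½ * s) * s)
          ≤⟨ ≤-by (D * p * (s * (t * s))) (0≤* (0≤* 0≤D (0≤P (suc j))) (0≤* (0≤rec (suc j)) (0≤* (0≤rec j) (0≤rec (suc j))))) key ⟩
        ζ + D * (p * t) ∎
        where
        ζ = ζ≤ (suc j) (k ∷ ks)
        s = rec (suc j)
        t = rec j
        p = P (suc j)
        module ≡ = ≡-Reasoning
        key : ζ + D * (p * t) ≡ (ζ + s * s * (C * p)) + D * (p * (1ℚ + ½ * s) * s) + D * p * (s * (t * s))
        key = ≡.begin
          ζ + D * (p * t)                           ≡.≡⟨ cong (λ e → ζ + D * (p * e)) (rec-step j) ⟩
          ζ + D * (p * (s + t * s))                 ≡.≡⟨ cong (λ e → ζ + D * (p * (s + e * s))) (rec-step j) ⟩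
          ζ + D * (p * (s + (s + t * s) * s))
            ≡.≡⟨ solve 5 (λ ζ c p s t → let d = (con 1ℚ :+ con 1ℚ) :* c in
                   ζ :+ d :* (p :* (s :+ (s :+ t :* s) :* s))
                   := (ζ :+ s :* s :* (c :* p)) :+ d :* (p :* (con 1ℚ :+ con ½ :* s) :* s) :+ d :* p :* (s :* (t :* s))) refl ζ C p s t ⟩
          (ζ + s * s * (C * p)) + D * (p * (1ℚ + ½ * s) * s) + D * p * (s * (t * s)) ≡.∎

      G-mono : ∀ d j → ζ≤ (suc (d ℕ.+ j)) (k ∷ ks) + D * Q (d ℕ.+ j) ≤ ζ≤ (suc j) (k ∷ ks) + D * Q j
      G-mono zero    j = ℚₚ.≤-refl
      G-mono (suc d) j = ℚₚ.≤-trans (G-step (d ℕ.+ j)) (G-mono d j)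

      ζ≤-mono : ∀ d j → ζ≤ (suc j) (k ∷ ks) ≤ ζ≤ (suc (d ℕ.+ j)) (k ∷ ks)
      ζ≤-mono zero    j = ℚₚ.≤-refl
      ζ≤-mono (suc d) j = ℚₚ.≤-trans (ζ≤-mono d j) (≤-by _ (0≤* (0≤pw (suc (d ℕ.+ j)) k) (0≤ζ≤ (suc (d ℕ.+ j)) ks)) refl)

      ζ≤-tail : ∀ d j → ζ≤ (suc (d ℕ.+ j)) (k ∷ ks) ≤ ζ≤ (suc j) (k ∷ ks) + D * Q j
      ζ≤-tail d j = ℚₚ.≤-trans (≤-by (D * Q (d ℕ.+ j)) (0≤* 0≤D (0≤Q (d ℕ.+ j))) refl) (G-mono d j)

    9/4 : ℚ
    9/4 = + 9 / 4

    P²≤ : ∀ j → P (suc j) * P (suc j) ≤ 9/4 * ℕ→ℚ (suc j)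
    P²≤ zero    = ℚₚ.≤-refl
    P²≤ (suc j) = begin
      (p * h) * (p * h)     ≡⟨ solve 2 (λ p h → (p :* h) :* (p :* h) := (p :* p) :* (h :* h)) refl p h ⟩
      (p * p) * (h * h)     ≤⟨ *-monoˡ (h * h) (0≤* 0≤h 0≤h) (P²≤ j) ⟩
      9/4 * a * (h * h)     ≤⟨ ≤-by (9/4 * (¾ * s + ¼ * (s * s)))
                                (0≤* (ℚₚ.nonNegative⁻¹ 9/4) (0≤+ (0≤* (ℚₚ.nonNegative⁻¹ ¾) 0≤s) (0≤* (ℚₚ.nonNegative⁻¹ ¼) (0≤* 0≤s 0≤s)))) key ⟩
      9/4 * ℕ→ℚ (suc (suc j)) ∎
      where
      p = P (suc j)
      s = rec (suc j)
      a = ℕ→ℚ (suc j)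
      h = 1ℚ + ½ * s
      ¾ = + 3 / 4
      ¼ = + 1 / 4
      0≤s = 0≤rec (suc j)
      0≤h : 0ℚ ≤ h
      0≤h = 0≤+ 0≤1 (0≤* 0≤½ 0≤s)
      module ≡ = ≡-Reasoning
      e = a * s + s
      key : 9/4 * ℕ→ℚ (suc (suc j)) ≡ 9/4 * a * (h * h) + 9/4 * (¾ * s + ¼ * (s * s))
      key = ≡.begin
        9/4 * ℕ→ℚ (suc (suc j))               ≡.≡⟨ cong (9/4 *_) (ℕ→ℚ-suc (suc j)) ⟩
        9/4 * (a + 1ℚ)                        ≡.≡⟨ solve 2 (λ a s → con 9/4 :* (a :+ con 1ℚ) := con 9/4 :* (a :+ con 1ℚ :+ con ¼ :* s :* con 1ℚ :- con ¼ :* s)) refl a s ⟩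
        9/4 * (a + 1ℚ + ¼ * s * 1ℚ - ¼ * s)   ≡.≡⟨ cong (λ o → 9/4 * (a + o + ¼ * s * o - ¼ * s)) (sym (rec-eq (suc j))) ⟩
        9/4 * (a + e + ¼ * s * e - ¼ * s)     ≡.≡⟨ solve 2 (λ a s → let e = a :* s :+ s ; h = con 1ℚ :+ con ½ :* s in
                                                     con 9/4 :* (a :+ e :+ con ¼ :* s :* e :- con ¼ :* s)
                                                     := con 9/4 :* a :* (h :* h) :+ con 9/4 :* (con ¾ :* s :+ con ¼ :* (s :* s))) refl a s ⟩
        9/4 * a * (h * h) + 9/4 * (¾ * s + ¼ * (s * s)) ≡.∎

    Q²≤ : ∀ j → Q j * Q j ≤ 9/4 * rec j
    Q²≤ j = begin
      (p * t) * (p * t)     ≡⟨ solve 2 (λ p t → (p :* t) :* (p :* t) := (p :* p) :* (t :* t)) refl p t ⟩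
      (p * p) * (t * t)     ≤⟨ *-monoˡ (t * t) (0≤* (0≤rec j) (0≤rec j)) (P²≤ j) ⟩
      9/4 * a * (t * t)     ≡⟨ solve 3 (λ k a t → k :* a :* (t :* t) := k :* ((a :* t) :* t)) refl 9/4 a t ⟩
      9/4 * ((a * t) * t)   ≡⟨ cong (λ o → 9/4 * (o * t)) (ℕ→ℚ*rec j) ⟩
      9/4 * (1ℚ * t)        ≡⟨ cong (9/4 *_) (ℚₚ.*-identityˡ t) ⟩
      9/4 * t               ∎
      where
      p = P (suc j)
      t = rec j
      a = ℕ→ℚ (suc j)

    archimedean : ∀ ε → 0ℚ < ε → ∃[ j ] (rec j < ε)
    archimedean ε 0<ε with positive 0<ε
    archimedean (mkℚ (+[1+ n ]) d _) _ | _ = suc d , ℚₚ.toℚᵘ-cancel-<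
      (ℚᵘₚ.<-respˡ-≃ (ℚᵘₚ.≃-sym (ℚₚ.toℚᵘ-fromℚᵘ (ℚᵘ.mkℚᵘ (+ 1) (suc d))))
        (ℚᵘ.*<* (ℤ.+<+ (s≤s (ℕₚ.≤-trans (ℕₚ.≤-reflexive (cong suc (ℕₚ.+-identityʳ d))) (ℕₚ.m≤m+n (suc d) _))))))

    Q-limit : ∀ ε → 0ℚ < ε → ∃[ j ] (Q j < ε)
    Q-limit ε 0<ε with archimedean ((+ 4 / 9) * (ε * ε)) 0<δ′
      where
      instance
        ε-pos : Positive ε
        ε-pos = positive 0<ε
      0<δ′ : 0ℚ < (+ 4 / 9) * (ε * ε)
      0<δ′ = ℚₚ.positive⁻¹ _ {{ℚₚ.pos*pos⇒pos (+ 4 / 9) (ε * ε) {{ℚₚ.pos*pos⇒pos ε ε}}}}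
    ... | j , small with Q j ℚₚ.<? ε
    ...   | yes Q<ε = j , Q<ε
    ...   | no  Q≮ε = contradiction (begin-strict
      ε * ε                            ≤⟨ *-monoˡ ε (ℚₚ.<⇒≤ 0<ε) ε≤Q ⟩
      Q j * ε                          ≤⟨ *-monoʳ (Q j) (0≤Q j) ε≤Q ⟩
      Q j * Q j                        ≤⟨ Q²≤ j ⟩
      9/4 * rec j                      <⟨ ℚₚ.*-monoʳ-<-pos 9/4 small ⟩
      9/4 * ((+ 4 / 9) * (ε * ε))      ≡⟨ solve 1 (λ e → con 9/4 :* (con (+ 4 / 9) :* (e :* e)) := e :* e) refl ε ⟩
      ε * ε                            ∎) (ℚₚ.<-irrefl refl)
      where ε≤Q = ℚₚ.≮⇒≥ Q≮ε

    ∣-∣-within : ∀ {lo E a b} → lo ≤ a → a ≤ lo + E → lo ≤ b → b ≤ lo + E → ∣ a - b ∣ ≤ E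
    ∣-∣-within {lo} {E} {a} {b} lo≤a a≤ lo≤b b≤ with ℚₚ.∣p∣≡p∨∣p∣≡-p (a - b)
    ... | inj₁ eq = subst (_≤ E) (sym eq) (begin
      a - b            ≤⟨ ℚₚ.+-mono-≤ a≤ (ℚₚ.neg-antimono-≤ lo≤b) ⟩
      (lo + E) - lo    ≡⟨ solve 2 (λ l e → (l :+ e) :- l := e) refl lo E ⟩
      E                ∎)
    ... | inj₂ eq = subst (_≤ E) (sym eq) (begin
      - (a - b)        ≡⟨ solve 2 (λ a b → :- (a :- b) := b :- a) refl a b ⟩
      b - a            ≤⟨ ℚₚ.+-mono-≤ b≤ (ℚₚ.neg-antimono-≤ lo≤a) ⟩
      (lo + E) - lo    ≡⟨ solve 2 (λ l e → (l :+ e) :- l := e) refl lo E ⟩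
      E                ∎)

    cauchy-from : ∀ k ks (2≤k : 2 ℕ.≤ k) (1≤ks : All (1 ℕ.≤_) ks) j {ε} → D k ks 2≤k 1≤ks * Q j < ε →
                  ∀ m n → suc j ℕ.≤ m → suc j ℕ.≤ n → ∣ ζ≤ m (k ∷ ks) - ζ≤ n (k ∷ ks) ∣ < ε
    cauchy-from k ks 2≤k 1≤ks j E<ε m n m≥ n≥ = ℚₚ.≤-<-trans
        (∣-∣-within {lo} {E} {ζ≤ m (k ∷ ks)} {ζ≤ n (k ∷ ks)} (lower m m≥) (upper m m≥) (lower n n≥) (upper n n≥)) E<ε
      where
      lo E : ℚ
      lo = ζ≤ (suc j) (k ∷ ks)
      E  = D k ks 2≤k 1≤ks * Q j
      lower : ∀ m → suc j ℕ.≤ m → lo ≤ ζ≤ m (k ∷ ks)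
      lower (suc m) (s≤s j≤m) = subst (λ i → lo ≤ ζ≤ (suc i) (k ∷ ks)) (ℕₚ.m∸n+n≡m j≤m) (ζ≤-mono k ks 2≤k 1≤ks (m ℕ.∸ j) j)
      upper : ∀ m → suc j ℕ.≤ m → ζ≤ m (k ∷ ks) ≤ lo + E
      upper (suc m) (s≤s j≤m) = subst (λ i → ζ≤ (suc i) (k ∷ ks) ≤ lo + E) (ℕₚ.m∸n+n≡m j≤m) (ζ≤-tail k ks 2≤k 1≤ks (m ℕ.∸ j) j)

    shrink-Q : ∀ d → 0ℚ ≤ d → ∀ ε → 0ℚ < ε → ∃[ j ] (d * Q j < ε)
    shrink-Q d 0≤d ε 0<ε =
      let (δ′ , 0<δ′ , shrink) = scale d ε 0<ε
          (j , Q<δ′)           = Q-limit δ′ 0<δ′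
      in j , combine j δ′ Q<δ′ shrink
      where
      combine : ∀ j δ′ → Q j < δ′ → (∀ e → ∣ e ∣ < δ′ → ∣ d * e ∣ < ε) → d * Q j < ε
      combine j δ′ Q<δ′ shrink = subst (_< ε) (ℚₚ.0≤p⇒∣p∣≡p (0≤* 0≤d (0≤Q j)))
        (shrink (Q j) (subst (_< δ′) (sym (ℚₚ.0≤p⇒∣p∣≡p (0≤Q j))) Q<δ′))

  ζ≤-cauchy : ∀ ks → Admissible ks → ∀ ε → 0ℚ < ε →
              ∃[ N ] (∀ m n → N ℕ.≤ m → N ℕ.≤ n → ∣ ζ≤ m ks - ζ≤ n ks ∣ < ε)
  ζ≤-cauchy (k ∷ ks) (2≤k , 1≤ks) ε 0<ε =
    let (j , E<ε) = shrink-Q (D k ks 2≤k 1≤ks) (0≤D k ks 2≤k 1≤ks) ε 0<ε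
    in suc j , cauchy-from k ks 2≤k 1≤ks j E<ε

ζ : (ks : List ℕ) → Admissible ks → ℝ
ζ ks adm = record { seq = λ N → ζ≤ N ks ; cauchy = ζ≤-cauchy ks adm }

infix 4 _∈𝓗⁰

record _∈𝓗⁰ (u : 𝓗) : Set where
  field
    const : ℚ
    inner : 𝓗
    decomposition : u ≈ const • 1ᴴ ⊕ x ⊙ inner ⊙ y

-- index (x^{k₁-1} y ⋯ x^{kᵣ-1} y) = (k₁ , … , kᵣ); the first argument of
-- indexFrom counts the letters x read since the last y.
indexFrom : ℕ → Word → List ℕ
indexFrom i []      = []
indexFrom i (X ∷ w) = indexFrom (suc i) w
indexFrom i (Y ∷ w) = suc i ∷ indexFrom 0 w

index : Word → List ℕ
index = indexFrom 0

indexFrom-pos : ∀ i w → All (1 ℕ.≤_) (indexFrom i w)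
indexFrom-pos i []      = []
indexFrom-pos i (X ∷ w) = indexFrom-pos (suc i) w
indexFrom-pos i (Y ∷ w) = s≤s z≤n ∷ indexFrom-pos 0 w

index-admissible : ∀ w → Admissible (index (X ∷ w ++ [ Y ]))
index-admissible = go 0
  where
  go : ∀ i w → Admissible (indexFrom (suc i) (w ++ [ Y ]))
  go i []      = s≤s (s≤s z≤n) , []
  go i (X ∷ w) = go (suc i) w
  go i (Y ∷ w) = s≤s (s≤s z≤n) , indexFrom-pos 0 (w ++ [ Y ])

-- Zˣʸ v = Z(x v y).
Zˣʸ : 𝓗 → ℝ
Zˣʸ []            = 0ℝ
Zˣʸ ((q , w) ∷ v) = q •ℝ ζ (index (X ∷ w ++ [ Y ])) (index-admissible w) +ℝ Zˣʸ v

-- Z(q + x v y) = q Z(1) + Z(x v y) with the convention Z(1) = 0.  The value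
-- does not depend on the chosen decomposition, see Z-cong.
Z : (u : 𝓗) → u ∈𝓗⁰ → ℝ
Z u u∈ = const •ℝ 0ℝ +ℝ Zˣʸ inner
  where open _∈𝓗⁰ u∈

module _ where
  open ≡-Reasoning

  -- The N-th approximation of Z on words, extended by junk outside 𝓗⁰.
  Zᵂ≤ : ℕ → Word → ℚ
  Zᵂ≤ N []        = 0ℚ
  Zᵂ≤ N w@(_ ∷ _) = ζ≤ N (index w)

  seq-Z : ∀ N u (u∈ : u ∈𝓗⁰) → seq (Z u u∈) N ≡ eval (Zᵂ≤ N) u
  seq-Z N u u∈ = sym (begin
    eval f u                                        ≡⟨ eval-cong f decomposition ⟩
    eval f (const • 1ᴴ ⊕ x ⊙ inner ⊙ y)             ≡⟨ eval-⊕ f (const • 1ᴴ) (x ⊙ inner ⊙ y) ⟩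
    eval f (const • 1ᴴ) + eval f (x ⊙ inner ⊙ y)    ≡⟨ cong₂ _+_ (trans (eval-• f const 1ᴴ) (cong (const *_) (eval-mono f []))) (trans xy (sym (seq-Zˣʸ inner))) ⟩
    const * 0ℚ + seq (Zˣʸ inner) N                  ∎)
    where
    open _∈𝓗⁰ u∈
    f = Zᵂ≤ N
    xy : eval f (x ⊙ inner ⊙ y) ≡ eval (λ w → f (X ∷ w ++ [ Y ])) inner
    xy = trans (eval-⊙mono f (x ⊙ inner) [ Y ]) (eval-mono⊙ (λ a → f (a ++ [ Y ])) [ X ] inner)
    seq-Zˣʸ : ∀ v → seq (Zˣʸ v) N ≡ eval (λ w → f (X ∷ w ++ [ Y ])) v
    seq-Zˣʸ []            = refl
    seq-Zˣʸ ((q , w) ∷ v) = cong (λ t → q * f (X ∷ w ++ [ Y ]) + t) (seq-Zˣʸ v)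

  Z-cong : ∀ {u v} (u∈ : u ∈𝓗⁰) (v∈ : v ∈𝓗⁰) → u ≈ v → Z u u∈ ≃ Z v v∈
  Z-cong {u} {v} u∈ v∈ u≈v = ≃-pointwise λ N →
    trans (seq-Z N u u∈) (trans (eval-cong (Zᵂ≤ N) u≈v) (sym (seq-Z N v v∈)))

  Z-⊕ : ∀ u v (u∈ : u ∈𝓗⁰) (v∈ : v ∈𝓗⁰) (u⊕v∈ : u ⊕ v ∈𝓗⁰) → Z (u ⊕ v) u⊕v∈ ≃ Z u u∈ +ℝ Z v v∈
  Z-⊕ u v u∈ v∈ u⊕v∈ = ≃-pointwise λ N →
    trans (seq-Z N (u ⊕ v) u⊕v∈) (trans (eval-⊕ (Zᵂ≤ N) u v) (sym (cong₂ _+_ (seq-Z N u u∈) (seq-Z N v v∈))))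

  Z-• : ∀ q u (u∈ : u ∈𝓗⁰) (q•u∈ : q • u ∈𝓗⁰) → Z (q • u) q•u∈ ≃ q •ℝ Z u u∈
  Z-• q u u∈ q•u∈ = ≃-pointwise λ N →
    trans (seq-Z N (q • u) q•u∈) (trans (eval-• (Zᵂ≤ N) q u) (cong (q *_) (sym (seq-Z N u u∈))))

  Z-1 : (1∈ : 1ᴴ ∈𝓗⁰) → Z 1ᴴ 1∈ ≃ 0ℝ
  Z-1 1∈ = ≃-pointwise λ N → trans (seq-Z N 1ᴴ 1∈) (eval-mono (Zᵂ≤ N) [])

  word : List ℕ → Word
  word []       = []
  word (k ∷ ks) = replicate (k ℕ.∸ 1) X ++ Y ∷ word ks

  private
    indexFrom-replicate : ∀ i k w → indexFrom i (replicate k X ++ Y ∷ w) ≡ suc (k ℕ.+ i) ∷ index w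
    indexFrom-replicate i zero    w = refl
    indexFrom-replicate i (suc k) w = trans (indexFrom-replicate (suc i) k w) (cong (λ n → suc n ∷ index w) (ℕₚ.+-suc k i))

  index-word : ∀ ks → All (1 ℕ.≤_) ks → index (word ks) ≡ ks
  index-word []           []           = refl
  index-word (suc k ∷ ks) (_ ∷ 1≤ks) = trans (indexFrom-replicate 0 k (word ks))
    (cong₂ (λ n ns → suc n ∷ ns) (ℕₚ.+-identityʳ k) (index-word ks 1≤ks))

  Z-word : ∀ ks (adm : Admissible ks) (w∈ : mono (word ks) ∈𝓗⁰) → Z (mono (word ks)) w∈ ≃ ζ ks adm
  Z-word (suc (suc k) ∷ ks) adm@(2≤k , 1≤ks) w∈ = ≃-pointwise λ N → begin
    seq (Z (mono w) w∈) N           ≡⟨ seq-Z N (mono w) w∈ ⟩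
    eval (Zᵂ≤ N) (mono w)           ≡⟨ eval-mono (Zᵂ≤ N) w ⟩
    ζ≤ N (index w)                  ≡⟨ cong (ζ≤ N) (index-word (suc (suc k) ∷ ks) (s≤s z≤n ∷ 1≤ks)) ⟩
    ζ≤ N (suc (suc k) ∷ ks)         ∎
    where w = word (suc (suc k) ∷ ks)
  Z-word (suc zero ∷ ks) (s≤s () , _)

{-# OPTIONS --safe #-}
module Submission where

-- Let φ be the automorphism x ↦ z, y ↦ -y and * the harmonic product.  Since
-- L_z commutes with every ad(θ^(c))^n(∂₁), replacing θ^(c) by θ^(c) - ½ L_z does
-- not change these operators, and conjugation by w ↦ x φ(w) turns the new θ^(c)
-- into a derivation Δ of * (up to a part commuting with multiplication), and ∂₁
-- into multiplication by -z₁.  Hence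
--   ad(θ^(c))^n(∂₁)(x φ(v)) = - x φ(Δ^n(z₁) * v),
-- and it remains to see that Z(x φ(u * v)) = 0 for nonempty u and v, which is the
-- linear part of Kawashima's relation.
--
-- By Landen's formula, Σ_{n≤N} of the series defining Z(x φ(w)) is, up to sign,
-- the derivative at 0 of the polynomial interpolating n ↦ ζ_{≤n}(w) at 0, …, N.
-- As ζ_{≤n}(u * v) = ζ_{≤n}(u) ζ_{≤n}(v) and both factors vanish at n = 0, that
-- derivative would be 0 if interpolation were multiplicative.  The defect is an
-- explicit double sum over mixed differences, and is O(log^p N / N).
--
-- An operator T on 𝓗 is represented by its transpose g ↦ (w ↦ g(T w)) on
-- functions on words.

open import Defs
open import Data.Integer.Base as ℤ using (+[1+_]) renaming (+_ to pos)
import Data.Integer.Properties as ℤₚ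
open import Data.List.Base using (List; []; _∷_; _++_; [_]; length)
open import Data.Nat.Base as ℕ using (ℕ; zero; suc; z≤n; s≤s; _!)
import Data.Nat.Properties as ℕₚ
open import Data.Product.Base using (_×_; _,_; ∃₂; ∃-syntax)
open import Data.Rational.Base
  using (ℚ; mkℚ; 0ℚ; 1ℚ; ½; _+_; _*_; _-_; -_; _/_; 1/_; toℚᵘ; _≤_; _<_; ∣_∣; Positive; nonNegative; positive)
import Data.Rational.Properties as ℚₚ
open import Data.Rational.Solver using (module +-*-Solver)
import Data.Rational.Unnormalised.Base as ℚᵘ
import Data.Rational.Unnormalised.Properties as ℚᵘₚ
open import Relation.Binary.PropositionalEquality
  using (_≡_; refl; sym; trans; cong; cong₂; subst; module ≡-Reasoning)
open import Relation.Nullary.Decidable.Core using (yes; no)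
open import Relation.Nullary.Negation.Core using (contradiction)

open +-*-Solver using (solve; _:=_; _:+_; _:*_; _:-_; :-_; con)

-- Finite linear functionals

-- The two claims share one argument. An element lies in 𝓗⁰ when every functional vanishing on 1 and
-- x𝓗y kills it, and Z vanishes when the rational partial sums tend to 0; `Ideal` abstracts the
-- class of sequences, identically zero or null, in which the functionals take their values. The
-- correction by ½ L_z is forced: θ^(c)(x) = ½(xz + zx) leaves x𝓗, while ½(xz + zx) - ½zx = ½xz
-- stays there. The price is that the conjugated operator appends an x at the right end, so the
-- induction on n cannot stay inside 𝓗y and carries a tail x^j. The terms created by the tail,
-- appending x and multiplying by z₁, cancel in the commutator. The parameter c enters through
-- degrees only, and the harmonic product is homogeneous for the weight, so these coefficients pass
-- through products as constants. The convergence argument stays within ℚ: harmonic numbers replace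
-- logarithms, the normalisation of differences absorbs the binomial coefficients, and the
-- comparison of powers of log N with N becomes the monotonicity of (Q + H_N)^Q / N.

record Ideal (J : (ℕ → ℚ) → Set) : Set where
  field
    J-ext : ∀ {a b} → (∀ n → a n ≡ b n) → J a → J b
    J-0   : J (λ _ → 0ℚ)
    J-+   : ∀ {a b} → J a → J b → J (λ n → a n + b n)
    J-*   : ∀ q {a} → J a → J (λ n → q * a n)

-- Syntax trees rather than coefficient lists, so that sums and multiples of functionals are
-- interpreted by computation alone.
data Comb (A : Set) : Set where
  zeroᶜ : Comb A
  valᶜ  : A → Comb A
  _+ᶜ_  : Comb A → Comb A → Comb A
  _*ᶜ_  : ℚ → Comb A → Comb A

⟦_⟧ : ∀ {A} → Comb A → (A → ℚ) → ℚ
⟦ zeroᶜ ⟧  g = 0ℚ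
⟦ valᶜ a ⟧ g = g a
⟦ s +ᶜ t ⟧ g = ⟦ s ⟧ g + ⟦ t ⟧ g
⟦ q *ᶜ t ⟧ g = q * ⟦ t ⟧ g

bindᶜ : ∀ {A B} → Comb B → (B → Comb A) → Comb A
bindᶜ zeroᶜ    k = zeroᶜ
bindᶜ (valᶜ b) k = k b
bindᶜ (s +ᶜ t) k = bindᶜ s k +ᶜ bindᶜ t k
bindᶜ (q *ᶜ t) k = q *ᶜ bindᶜ t k

⟦⟧-ext : ∀ {A} (t : Comb A) {g h} → (∀ a → g a ≡ h a) → ⟦ t ⟧ g ≡ ⟦ t ⟧ h
⟦⟧-ext zeroᶜ    g≗h = refl
⟦⟧-ext (valᶜ a) g≗h = g≗h a
⟦⟧-ext (s +ᶜ t) g≗h = cong₂ _+_ (⟦⟧-ext s g≗h) (⟦⟧-ext t g≗h)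
⟦⟧-ext (q *ᶜ t) g≗h = cong (q *_) (⟦⟧-ext t g≗h)

⟦⟧-bind : ∀ {A B} (t : Comb B) (k : B → Comb A) g → ⟦ bindᶜ t k ⟧ g ≡ ⟦ t ⟧ (λ b → ⟦ k b ⟧ g)
⟦⟧-bind zeroᶜ    k g = refl
⟦⟧-bind (valᶜ b) k g = refl
⟦⟧-bind (s +ᶜ t) k g = cong₂ _+_ (⟦⟧-bind s k g) (⟦⟧-bind t k g)
⟦⟧-bind (q *ᶜ t) k g = cong (q *_) (⟦⟧-bind t k g)

⟦⟧-0 : ∀ {A} (t : Comb A) → ⟦ t ⟧ (λ _ → 0ℚ) ≡ 0ℚ
⟦⟧-0 zeroᶜ    = refl
⟦⟧-0 (valᶜ a) = refl
⟦⟧-0 (s +ᶜ t) = cong₂ _+_ (⟦⟧-0 s) (⟦⟧-0 t)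
⟦⟧-0 (q *ᶜ t) = trans (cong (q *_) (⟦⟧-0 t)) (ℚₚ.*-zeroʳ q)

⟦⟧-+ : ∀ {A} (t : Comb A) g h → ⟦ t ⟧ (λ a → g a + h a) ≡ ⟦ t ⟧ g + ⟦ t ⟧ h
⟦⟧-+ zeroᶜ    g h = refl
⟦⟧-+ (valᶜ a) g h = refl
⟦⟧-+ (s +ᶜ t) g h = trans (cong₂ _+_ (⟦⟧-+ s g h) (⟦⟧-+ t g h))
  (solve 4 (λ a b c d → (a :+ b) :+ (c :+ d) := (a :+ c) :+ (b :+ d)) refl (⟦ s ⟧ g) (⟦ s ⟧ h) (⟦ t ⟧ g) (⟦ t ⟧ h))
⟦⟧-+ (q *ᶜ t) g h = trans (cong (q *_) (⟦⟧-+ t g h)) (ℚₚ.*-distribˡ-+ q (⟦ t ⟧ g) (⟦ t ⟧ h))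

⟦⟧-* : ∀ {A} (t : Comb A) q g → ⟦ t ⟧ (λ a → q * g a) ≡ q * ⟦ t ⟧ g
⟦⟧-* zeroᶜ    q g = sym (ℚₚ.*-zeroʳ q)
⟦⟧-* (valᶜ a) q g = refl
⟦⟧-* (s +ᶜ t) q g = trans (cong₂ _+_ (⟦⟧-* s q g) (⟦⟧-* t q g)) (sym (ℚₚ.*-distribˡ-+ q (⟦ s ⟧ g) (⟦ t ⟧ g)))
⟦⟧-* (p *ᶜ t) q g = trans (cong (p *_) (⟦⟧-* t q g))
  (solve 3 (λ p q a → p :* (q :* a) := q :* (p :* a)) refl p q (⟦ t ⟧ g))

⟦⟧-swap : ∀ {A B} (s : Comb A) (t : Comb B) (g : A → B → ℚ) →
          ⟦ s ⟧ (λ a → ⟦ t ⟧ (g a)) ≡ ⟦ t ⟧ (λ b → ⟦ s ⟧ (λ a → g a b))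
⟦⟧-swap zeroᶜ     t g = sym (⟦⟧-0 t)
⟦⟧-swap (valᶜ a)  t g = refl
⟦⟧-swap (s +ᶜ s′) t g = trans (cong₂ _+_ (⟦⟧-swap s t g) (⟦⟧-swap s′ t g)) (sym (⟦⟧-+ t _ _))
⟦⟧-swap (q *ᶜ s)  t g = trans (cong (q *_) (⟦⟧-swap s t g)) (sym (⟦⟧-* t q _))

⟦⟧-ideal : ∀ {A J} → Ideal J → (t : Comb A) {g : ℕ → A → ℚ} →
           (∀ a → J (λ n → g n a)) → J (λ n → ⟦ t ⟧ (g n))
⟦⟧-ideal J zeroᶜ    Jg = Ideal.J-0 J
⟦⟧-ideal J (valᶜ a) Jg = Jg a
⟦⟧-ideal J (s +ᶜ t) Jg = Ideal.J-+ J (⟦⟧-ideal J s Jg) (⟦⟧-ideal J t Jg)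
⟦⟧-ideal J (q *ᶜ t) Jg = Ideal.J-* J q (⟦⟧-ideal J t Jg)

-- F is the evaluation of functions at a fixed finite linear combination of points.
record Finite {A : Set} (F : (A → ℚ) → ℚ) : Set where
  field
    comb   : Comb A
    expand : ∀ g → F g ≡ ⟦ comb ⟧ g

open Finite

module _ {A : Set} where

  fin-0 : Finite {A} (λ _ → 0ℚ)
  fin-0 = record { comb = zeroᶜ ; expand = λ _ → refl }

  fin-at : ∀ a → Finite {A} (λ g → g a)
  fin-at a = record { comb = valᶜ a ; expand = λ _ → refl }

  fin-+ : ∀ {F G} → Finite {A} F → Finite G → Finite (λ g → F g + G g)
  fin-+ f g = record { comb = comb f +ᶜ comb g ; expand = λ h → cong₂ _+_ (expand f h) (expand g h) }

  fin-* : ∀ q {F} → Finite {A} F → Finite (λ g → q * F g)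
  fin-* q f = record { comb = q *ᶜ comb f ; expand = λ h → cong (q *_) (expand f h) }

  fin-≗ : ∀ {F G} → (∀ g → F g ≡ G g) → Finite {A} G → Finite F
  fin-≗ F≗G f = record { comb = comb f ; expand = λ h → trans (F≗G h) (expand f h) }

  fin-neg : ∀ {F} → Finite {A} F → Finite (λ g → - F g)
  fin-neg {F} f = fin-≗ (λ g → solve 1 (λ a → :- a := con (- 1ℚ) :* a) refl (F g)) (fin-* (- 1ℚ) f)

  fin-bind : ∀ {B F} {K : B → (A → ℚ) → ℚ} → Finite F → (∀ b → Finite (K b)) → Finite (λ g → F (λ b → K b g))
  fin-bind {K = K} f k = record
    { comb   = bindᶜ (comb f) (λ b → comb (k b))
    ; expand = λ g → trans (expand f (λ b → K b g))
        (trans (⟦⟧-ext (comb f) (λ b → expand (k b) g)) (sym (⟦⟧-bind (comb f) (λ b → comb (k b)) g)))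
    }

  module _ {F} (f : Finite {A} F) where

    -- Stands in for function extensionality: rewriting under a binder goes through it, which is why
    -- every transposed operator comes with a `Finite` witness.
    linear-ext : ∀ {g h} → (∀ a → g a ≡ h a) → F g ≡ F h
    linear-ext g≗h = trans (expand f _) (trans (⟦⟧-ext (comb f) g≗h) (sym (expand f _)))

    linear-+ : ∀ g h → F (λ a → g a + h a) ≡ F g + F h
    linear-+ g h = trans (expand f _) (trans (⟦⟧-+ (comb f) g h) (sym (cong₂ _+_ (expand f g) (expand f h))))

    linear-* : ∀ q g → F (λ a → q * g a) ≡ q * F g
    linear-* q g = trans (expand f _) (trans (⟦⟧-* (comb f) q g) (cong (q *_) (sym (expand f g))))

    linear-0 : F (λ _ → 0ℚ) ≡ 0ℚ
    linear-0 = trans (expand f _) (⟦⟧-0 (comb f))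

    linear-neg : ∀ g → F (λ a → - g a) ≡ - F g
    linear-neg g = trans (linear-ext (λ a → solve 1 (λ a → :- a := con (- 1ℚ) :* a) refl (g a)))
      (trans (linear-* (- 1ℚ) g) (solve 1 (λ a → con (- 1ℚ) :* a := :- a) refl (F g)))

    linear-sub : ∀ g h → F (λ a → g a - h a) ≡ F g - F h
    linear-sub g h = trans (linear-+ g (λ a → - h a)) (cong (F g +_) (linear-neg h))

    linear-ideal : ∀ {J} → Ideal J → {g : ℕ → A → ℚ} → (∀ a → J (λ n → g n a)) → J (λ n → F (g n))
    linear-ideal J Jg = Ideal.J-ext J (λ n → sym (expand f _)) (⟦⟧-ideal J (comb f) Jg)

  -- Exchange of two finite sums. This moves an operator on one factor of a harmonic product past an
  -- operator on the other.
  linear-swap : ∀ {B F G} → Finite {A} F → Finite {B} G → ∀ g → F (λ a → G (g a)) ≡ G (λ b → F (λ a → g a b))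
  linear-swap {F = F} {G} f g h = begin
    F (λ a → G (h a))                              ≡⟨ linear-ext f (λ a → expand g (h a)) ⟩
    F (λ a → ⟦ comb g ⟧ (h a))                     ≡⟨ expand f _ ⟩
    ⟦ comb f ⟧ (λ a → ⟦ comb g ⟧ (h a))            ≡⟨ ⟦⟧-swap (comb f) (comb g) h ⟩
    ⟦ comb g ⟧ (λ b → ⟦ comb f ⟧ (λ a → h a b))    ≡⟨ ⟦⟧-ext (comb g) (λ b → sym (expand f _)) ⟩
    ⟦ comb g ⟧ (λ b → F (λ a → h a b))             ≡⟨ sym (expand g _) ⟩
    G (λ b → F (λ a → h a b))                      ∎
    where open ≡-Reasoning

-- The harmonic product

abstract
  -- Opaque, so that type checking does not normalise the fractions and the ring solver meets atoms.
  ι : ℕ → ℚ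
  ι n = pos n / 1

  rec : ℕ → ℚ
  rec n = pos 1 / suc n

  ι-def : ∀ n → ι n ≡ pos n / 1
  ι-def n = refl

  rec-def : ∀ n → rec n ≡ pos 1 / suc n
  rec-def n = refl

  ι-0 : ι 0 ≡ 0ℚ
  ι-0 = refl

  ι-suc : ∀ n → ι (suc n) ≡ 1ℚ + ι n
  ι-suc n = ℚₚ.toℚᵘ-injective (begin
    toℚᵘ (pos (suc n) / 1)              ≈⟨ ℚₚ.toℚᵘ-fromℚᵘ (ℚᵘ.mkℚᵘ (pos (suc n)) 0) ⟩
    ℚᵘ.mkℚᵘ (pos (suc n)) 0             ≈⟨ ℚᵘ.*≡* (cong (ℤ._* pos 1) (cong (λ t → pos 1 ℤ.+ t) (sym (ℤₚ.*-identityʳ (pos n))))) ⟩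
    toℚᵘ 1ℚ ℚᵘ.+ ℚᵘ.mkℚᵘ (pos n) 0    ≈⟨ ℚᵘₚ.+-congʳ (toℚᵘ 1ℚ) (ℚᵘₚ.≃-sym (ℚₚ.toℚᵘ-fromℚᵘ (ℚᵘ.mkℚᵘ (pos n) 0))) ⟩
    toℚᵘ 1ℚ ℚᵘ.+ toℚᵘ (pos n / 1)     ≈⟨ ℚᵘₚ.≃-sym (ℚₚ.toℚᵘ-homo-+ 1ℚ (pos n / 1)) ⟩
    toℚᵘ (1ℚ + pos n / 1)             ∎)
    where open import Relation.Binary.Reasoning.Setoid ℚᵘₚ.≃-setoid

  ι*rec : ∀ n → ι (suc n) * rec n ≡ 1ℚ
  ι*rec n = ℚₚ.toℚᵘ-injective (begin
    toℚᵘ (pos (suc n) / 1 * (pos 1 / suc n))           ≈⟨ ℚₚ.toℚᵘ-homo-* (pos (suc n) / 1) (pos 1 / suc n) ⟩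
    toℚᵘ (pos (suc n) / 1) ℚᵘ.* toℚᵘ (pos 1 / suc n)   ≈⟨ ℚᵘₚ.*-cong (ℚₚ.toℚᵘ-fromℚᵘ (ℚᵘ.mkℚᵘ (pos (suc n)) 0)) (ℚₚ.toℚᵘ-fromℚᵘ (ℚᵘ.mkℚᵘ (pos 1) n)) ⟩
    ℚᵘ.mkℚᵘ (pos (suc n)) 0 ℚᵘ.* ℚᵘ.mkℚᵘ (pos 1) n     ≈⟨ ℚᵘ.*≡* (cong (λ t → pos (suc t)) (trans (ℕₚ.*-identityʳ (n ℕ.* 1)) (trans (ℕₚ.*-identityʳ n) (sym (trans (ℕₚ.+-identityʳ _) (ℕₚ.+-identityʳ n)))))) ⟩
    toℚᵘ 1ℚ                                      ∎)
    where open import Relation.Binary.Reasoning.Setoid ℚᵘₚ.≃-setoid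

ι-+ : ∀ m n → ι (m ℕ.+ n) ≡ ι m + ι n
ι-+ zero    n = trans (sym (ℚₚ.+-identityˡ (ι n))) (cong (_+ ι n) (sym ι-0))
ι-+ (suc m) n = begin
  ι (suc (m ℕ.+ n))     ≡⟨ ι-suc (m ℕ.+ n) ⟩
  1ℚ + ι (m ℕ.+ n)      ≡⟨ cong (1ℚ +_) (ι-+ m n) ⟩
  1ℚ + (ι m + ι n)      ≡⟨ sym (ℚₚ.+-assoc 1ℚ (ι m) (ι n)) ⟩
  1ℚ + ι m + ι n        ≡⟨ cong (_+ ι n) (sym (ι-suc m)) ⟩
  ι (suc m) + ι n       ∎
  where open ≡-Reasoning

Index : Set
Index = List ℕ

-- The entry k of an index stands for the letter z_{k+1} = x^k y, of weight k + 1.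
wt : Index → ℚ
wt []      = 0ℚ
wt (k ∷ v) = ι (suc k) + wt v

_∘∷_ : ∀ {A : Set} → (List A → ℚ) → A → List A → ℚ
(g ∘∷ a) w = g (a ∷ w)

infixl 20 _∘∷_

-- stuffle g u v is the value of g on the harmonic product u * v.
stuffle : (Index → ℚ) → Index → Index → ℚ
stuffle g []         v          = g v
stuffle g u@(_ ∷ _)  []         = g u
stuffle g u₀@(k ∷ u) v₀@(l ∷ v) =
  stuffle (g ∘∷ k) u v₀ + stuffle (g ∘∷ l) u₀ v + stuffle (g ∘∷ suc (k ℕ.+ l)) u v

fin-stuffle : ∀ u v → Finite (λ g → stuffle g u v)
fin-stuffle []        v       = fin-at v
fin-stuffle u@(_ ∷ _) []      = fin-at u
fin-stuffle (k ∷ u)   (l ∷ v) = fin-+ (fin-+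
  (fin-bind (fin-stuffle u (l ∷ v)) (λ w → fin-at (k ∷ w)))
  (fin-bind (fin-stuffle (k ∷ u) v) (λ w → fin-at (l ∷ w))))
  (fin-bind (fin-stuffle u v) (λ w → fin-at (suc (k ℕ.+ l) ∷ w)))

stuffle-[]ʳ : ∀ g u → stuffle g u [] ≡ g u
stuffle-[]ʳ g []      = refl
stuffle-[]ʳ g (k ∷ u) = refl

-- Merging the letters k and l gives the entry k + l + 1, of weight (k + 1) + (l + 1), so every word
-- of u * v has weight `wt u + wt v`.
stuffle-wt : ∀ g u v → stuffle (λ w → wt w * g w) u v ≡ (wt u + wt v) * stuffle g u v
stuffle-wt g []        v       = cong (_* g v) (sym (ℚₚ.+-identityˡ (wt v)))
stuffle-wt g u@(_ ∷ _) []      = cong (_* g u) (sym (ℚₚ.+-identityʳ (wt u)))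
stuffle-wt g u₀@(k ∷ u) v₀@(l ∷ v) = begin
  stuffle (λ w → wt (k ∷ w) * g (k ∷ w)) u v₀ + stuffle (λ w → wt (l ∷ w) * g (l ∷ w)) u₀ v
    + stuffle (λ w → wt (m ∷ w) * g (m ∷ w)) u v
    ≡⟨ cong₂ _+_ (cong₂ _+_ (head k u v₀) (head l u₀ v)) (head m u v) ⟩
  (ι (suc k) + (wt u + wt v₀)) * a + (ι (suc l) + (wt u₀ + wt v)) * b + (ι (suc m) + (wt u + wt v)) * d
    ≡⟨ cong (λ t → (ι (suc k) + (wt u + wt v₀)) * a + (ι (suc l) + (wt u₀ + wt v)) * b + (t + (wt u + wt v)) * d) wt-m ⟩
  (ι (suc k) + (wt u + wt v₀)) * a + (ι (suc l) + (wt u₀ + wt v)) * b + ((ι (suc k) + ι (suc l)) + (wt u + wt v)) * d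
    ≡⟨ solve 7 (λ k l u v a b d →
         (k :+ (u :+ (l :+ v))) :* a :+ (l :+ ((k :+ u) :+ v)) :* b :+ ((k :+ l) :+ (u :+ v)) :* d
         := ((k :+ u) :+ (l :+ v)) :* (a :+ b :+ d)) refl (ι (suc k)) (ι (suc l)) (wt u) (wt v) a b d ⟩
  (wt u₀ + wt v₀) * (a + b + d) ∎
  where
  open ≡-Reasoning
  m = suc (k ℕ.+ l)
  a = stuffle (g ∘∷ k) u v₀
  b = stuffle (g ∘∷ l) u₀ v
  d = stuffle (g ∘∷ m) u v
  wt-m : ι (suc m) ≡ ι (suc k) + ι (suc l)
  wt-m = trans (cong (λ t → ι (suc t)) (sym (ℕₚ.+-suc k l))) (ι-+ (suc k) (suc l))
  head : ∀ k u v → stuffle (λ w → wt (k ∷ w) * g (k ∷ w)) u v ≡ (ι (suc k) + (wt u + wt v)) * stuffle (g ∘∷ k) u v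
  head k u v = begin
    stuffle (λ w → (ι (suc k) + wt w) * g (k ∷ w)) u v
      ≡⟨ linear-ext s (λ w → ℚₚ.*-distribʳ-+ (g (k ∷ w)) (ι (suc k)) (wt w)) ⟩
    stuffle (λ w → ι (suc k) * g (k ∷ w) + wt w * g (k ∷ w)) u v
      ≡⟨ linear-+ s _ _ ⟩
    stuffle (λ w → ι (suc k) * g (k ∷ w)) u v + stuffle (λ w → wt w * g (k ∷ w)) u v
      ≡⟨ cong₂ _+_ (linear-* s (ι (suc k)) (g ∘∷ k)) (stuffle-wt (g ∘∷ k) u v) ⟩
    ι (suc k) * stuffle (g ∘∷ k) u v + (wt u + wt v) * stuffle (g ∘∷ k) u v
      ≡⟨ sym (ℚₚ.*-distribʳ-+ (stuffle (g ∘∷ k) u v) (ι (suc k)) (wt u + wt v)) ⟩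
    (ι (suc k) + (wt u + wt v)) * stuffle (g ∘∷ k) u v ∎
    where s = fin-stuffle u v

stuffle-z₁ : ∀ g u → stuffle g u [ 0 ] ≡ stuffle g [ 0 ] u
stuffle-z₁ g []      = refl
stuffle-z₁ g (k ∷ u) = begin
  stuffle (g ∘∷ k) u [ 0 ] + g (0 ∷ k ∷ u) + stuffle (g ∘∷ suc (k ℕ.+ 0)) u []
    ≡⟨ cong₂ (λ s t → s + g (0 ∷ k ∷ u) + t) (stuffle-z₁ (g ∘∷ k) u)
         (trans (stuffle-[]ʳ _ u) (cong (λ m → g (suc m ∷ u)) (ℕₚ.+-identityʳ k))) ⟩
  stuffle (g ∘∷ k) [ 0 ] u + g (0 ∷ k ∷ u) + g (suc k ∷ u)
    ≡⟨ cong (_+ g (suc k ∷ u)) (ℚₚ.+-comm (stuffle (g ∘∷ k) [ 0 ] u) (g (0 ∷ k ∷ u))) ⟩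
  g (0 ∷ k ∷ u) + stuffle (g ∘∷ k) [ 0 ] u + g (suc k ∷ u) ∎
  where open ≡-Reasoning

-- Multiplication by z₁ commutes with multiplication by u. This removes the z₁ term of the
-- conjugated θ^(c) from the commutator.
z₁-stuffle : ∀ g u v → stuffle (λ w → stuffle g [ 0 ] w) u v ≡ stuffle (λ w → stuffle g u w) [ 0 ] v
z₁-stuffle g []          v           = refl
z₁-stuffle g u@(_ ∷ _)   []          = sym (stuffle-z₁ g u)
z₁-stuffle g u₀@(k ∷ u) v₀@(l ∷ v) = begin
  stuffle (λ w → g (0 ∷ k ∷ w) + stuffle (g ∘∷ k) [ 0 ] w + g (suc k ∷ w)) u v₀
    + stuffle (λ w → g (0 ∷ l ∷ w) + stuffle (g ∘∷ l) [ 0 ] w + g (suc l ∷ w)) u₀ v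
    + stuffle (λ w → g (0 ∷ m ∷ w) + stuffle (g ∘∷ m) [ 0 ] w + g (suc m ∷ w)) u v
    ≡⟨ cong₂ _+_ (cong₂ _+_ (head k u v₀) (head l u₀ v)) (head m u v) ⟩
  (a₀ + stuffle (stuffle (g ∘∷ k) [ 0 ]) u v₀ + a) + (b₀ + stuffle (stuffle (g ∘∷ l) [ 0 ]) u₀ v + b)
    + (d₀ + stuffle (stuffle (g ∘∷ m) [ 0 ]) u v + d)
    ≡⟨ cong₂ _+_ (cong₂ (λ s t → (a₀ + s + a) + (b₀ + t + b)) (z₁-stuffle (g ∘∷ k) u v₀) (z₁-stuffle (g ∘∷ l) u₀ v))
                 (cong (λ t → d₀ + t + d) (z₁-stuffle (g ∘∷ m) u v)) ⟩
  (a₀ + (p₁ + p₂ + p₃) + a) + (b₀ + q + b) + (d₀ + r + d)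
    ≡⟨ solve 11 (λ a₀ b₀ d₀ p₁ p₂ p₃ q r a b d →
         (a₀ :+ (p₁ :+ p₂ :+ p₃) :+ a) :+ (b₀ :+ q :+ b) :+ (d₀ :+ r :+ d)
         := (p₁ :+ (a₀ :+ b₀ :+ d₀) :+ a) :+ (p₂ :+ q :+ r) :+ (p₃ :+ b :+ d))
         refl a₀ b₀ d₀ p₁ p₂ p₃ q r a b d ⟩
  (p₁ + (a₀ + b₀ + d₀) + a) + (p₂ + q + r) + (p₃ + b + d)
    ≡⟨ cong₂ _+_ (cong₂ _+_
         (cong (λ t → p₁ + (a₀ + b₀ + d₀) + stuffle (g ∘∷ suc t) u v₀) (sym (ℕₚ.+-identityʳ k)))
         (sym (trans (linear-+ ζ₀ _ _) (cong (_+ r) (linear-+ ζ₀ _ _)))))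
         (cong (λ t → p₃ + b + stuffle (g ∘∷ suc t) u v) (sym (ℕₚ.+-suc k l))) ⟩
  stuffle g u₀ (0 ∷ v₀) + stuffle (λ w → stuffle g u₀ (l ∷ w)) [ 0 ] v + stuffle g u₀ (suc l ∷ v) ∎
  where
  open ≡-Reasoning
  m  = suc (k ℕ.+ l)
  ζ₀ = fin-stuffle [ 0 ] v
  a₀ = stuffle (g ∘∷ 0 ∘∷ k) u v₀
  b₀ = stuffle (g ∘∷ 0 ∘∷ l) u₀ v
  d₀ = stuffle (g ∘∷ 0 ∘∷ m) u v
  a  = stuffle (g ∘∷ suc k) u v₀
  b  = stuffle (g ∘∷ suc l) u₀ v
  d  = stuffle (g ∘∷ suc m) u v
  p₁ = stuffle (g ∘∷ k) u (0 ∷ v₀)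
  p₂ = stuffle (λ w → stuffle (g ∘∷ k) u (l ∷ w)) [ 0 ] v
  p₃ = stuffle (g ∘∷ k) u (suc l ∷ v)
  q  = stuffle (λ w → stuffle (g ∘∷ l) u₀ w) [ 0 ] v
  r  = stuffle (λ w → stuffle (g ∘∷ m) u w) [ 0 ] v
  head : ∀ k u v → stuffle (λ w → g (0 ∷ k ∷ w) + stuffle (g ∘∷ k) [ 0 ] w + g (suc k ∷ w)) u v ≡
         stuffle (g ∘∷ 0 ∘∷ k) u v + stuffle (stuffle (g ∘∷ k) [ 0 ]) u v + stuffle (g ∘∷ suc k) u v
  head k u v = trans (linear-+ s _ _) (cong (_+ stuffle (g ∘∷ suc k) u v) (linear-+ s _ _))
    where s = fin-stuffle u v

-- Δ c g v is the value of g on Δ(v), where Δ is what θ^(c) becomes on indices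
-- after conjugation by φ.
Δ : ℚ → (Index → ℚ) → Index → ℚ
Δ c g []      = 0ℚ
Δ c g (k ∷ v) = Δ c (g ∘∷ k) v + (ι (suc k) - c * wt v) * g (suc k ∷ v) + (- (c * wt (k ∷ v))) * g (0 ∷ k ∷ v)

fin-Δ : ∀ c v → Finite (λ g → Δ c g v)
fin-Δ c []      = fin-0
fin-Δ c (k ∷ v) = fin-+ (fin-+
  (fin-bind (fin-Δ c v) (λ w → fin-at (k ∷ w)))
  (fin-* (ι (suc k) - c * wt v) (fin-at (suc k ∷ v))))
  (fin-* (- (c * wt (k ∷ v))) (fin-at (0 ∷ k ∷ v)))

-- The weights in the coefficients of `Δ` depend on the word, but by homogeneity they are constant
-- on u * v and can be taken out of the functional.
stuffle-Δ-head : ∀ c g k u v → stuffle (λ w → Δ c g (k ∷ w)) u v ≡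
  stuffle (Δ c (g ∘∷ k)) u v + (ι (suc k) - c * (wt u + wt v)) * stuffle (g ∘∷ suc k) u v
    + (- (c * (ι (suc k) + (wt u + wt v)))) * stuffle (g ∘∷ 0 ∘∷ k) u v
stuffle-Δ-head c g k u v = begin
  stuffle (λ w → Δ c g (k ∷ w)) u v
    ≡⟨ linear-ext s (λ w → solve 6 (λ D k c w a b →
         D :+ (k :- c :* w) :* a :+ (:- (c :* (k :+ w))) :* b
         := D :+ (k :* a :+ (:- (c :* k)) :* b) :+ (:- c) :* (w :* (a :+ b)))
         refl (Δ c (g ∘∷ k) w) (ι (suc k)) c (wt w) (g (suc k ∷ w)) (g (0 ∷ k ∷ w))) ⟩
  stuffle (λ w → Δ c (g ∘∷ k) w + (ι (suc k) * g (suc k ∷ w) + (- (c * ι (suc k))) * g (0 ∷ k ∷ w))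
                   + (- c) * (wt w * (g (suc k ∷ w) + g (0 ∷ k ∷ w)))) u v
    ≡⟨ trans (linear-+ s _ _) (cong₂ _+_ (trans (linear-+ s _ _) (cong (stuffle (Δ c (g ∘∷ k)) u v +_)
         (trans (linear-+ s _ _) (cong₂ _+_ (linear-* s (ι (suc k)) (g ∘∷ suc k)) (linear-* s (- (c * ι (suc k))) (g ∘∷ 0 ∘∷ k))))))
         (trans (linear-* s (- c) (λ w → wt w * (g (suc k ∷ w) + g (0 ∷ k ∷ w))))
           (cong ((- c) *_) (trans (stuffle-wt _ u v) (cong ((wt u + wt v) *_) (linear-+ s (g ∘∷ suc k) (g ∘∷ 0 ∘∷ k))))))) ⟩
  stuffle (Δ c (g ∘∷ k)) u v + (ι (suc k) * a + (- (c * ι (suc k))) * b) + (- c) * ((wt u + wt v) * (a + b))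
    ≡⟨ solve 6 (λ D k c w a b →
         D :+ (k :* a :+ (:- (c :* k)) :* b) :+ (:- c) :* (w :* (a :+ b))
         := D :+ (k :- c :* w) :* a :+ (:- (c :* (k :+ w))) :* b)
         refl (stuffle (Δ c (g ∘∷ k)) u v) (ι (suc k)) c (wt u + wt v) a b ⟩
  stuffle (Δ c (g ∘∷ k)) u v + (ι (suc k) - c * (wt u + wt v)) * a + (- (c * (ι (suc k) + (wt u + wt v)))) * b ∎
  where
  open ≡-Reasoning
  s = fin-stuffle u v
  a = stuffle (g ∘∷ suc k) u v
  b = stuffle (g ∘∷ 0 ∘∷ k) u v

private
  Δ-stuffle-arith : ∀ c k l u v D₁ D₂ E₁ E₂ F₁ F₂ a b d a₀ b₀ d₀ p₁ p₂ q₁ q₂ →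
    (D₁ + (D₂ + (l - c * v) * p₁ + (- (c * (l + v))) * p₂) + (k - c * (u + (l + v))) * a + (- (c * (k + (u + (l + v))))) * a₀)
    + ((E₁ + (k - c * u) * q₁ + (- (c * (k + u))) * q₂) + E₂ + (l - c * ((k + u) + v)) * b + (- (c * (l + ((k + u) + v)))) * b₀)
    + (F₁ + F₂ + ((k + l) - c * (u + v)) * d + (- (c * ((k + l) + (u + v)))) * d₀)
    ≡ ((D₁ + E₁ + F₁) + (k - c * u) * (a + q₁ + d) + (- (c * (k + u))) * ((a₀ + b₀ + d₀) + q₂ + b))
    + ((D₂ + E₂ + F₂) + (l - c * v) * (p₁ + b + d) + (- (c * (l + v))) * (p₂ + (a₀ + b₀ + d₀) + a))
  Δ-stuffle-arith = solve 21 (λ c k l u v D₁ D₂ E₁ E₂ F₁ F₂ a b d a₀ b₀ d₀ p₁ p₂ q₁ q₂ →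
    (D₁ :+ (D₂ :+ (l :- c :* v) :* p₁ :+ (:- (c :* (l :+ v))) :* p₂) :+ (k :- c :* (u :+ (l :+ v))) :* a :+ (:- (c :* (k :+ (u :+ (l :+ v))))) :* a₀)
    :+ ((E₁ :+ (k :- c :* u) :* q₁ :+ (:- (c :* (k :+ u))) :* q₂) :+ E₂ :+ (l :- c :* ((k :+ u) :+ v)) :* b :+ (:- (c :* (l :+ ((k :+ u) :+ v)))) :* b₀)
    :+ (F₁ :+ F₂ :+ ((k :+ l) :- c :* (u :+ v)) :* d :+ (:- (c :* ((k :+ l) :+ (u :+ v)))) :* d₀)
    := ((D₁ :+ E₁ :+ F₁) :+ (k :- c :* u) :* (a :+ q₁ :+ d) :+ (:- (c :* (k :+ u))) :* ((a₀ :+ b₀ :+ d₀) :+ q₂ :+ b))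
    :+ ((D₂ :+ E₂ :+ F₂) :+ (l :- c :* v) :* (p₁ :+ b :+ d) :+ (:- (c :* (l :+ v))) :* (p₂ :+ (a₀ :+ b₀ :+ d₀) :+ a))) refl

-- The raising coefficient of a merged letter is the sum of those of its two parts. The term -c * wt
-- v₀ that the weight of v₀ adds to the raising of k is matched on the other side: `Δ` puts z₁ in
-- front of v₀ with this same coefficient, and that z₁ can merge with k.
Δ-stuffle : ∀ c g u v → stuffle (Δ c g) u v ≡ Δ c (λ w → stuffle g w v) u + Δ c (λ w → stuffle g u w) v
Δ-stuffle c g []        v       = sym (ℚₚ.+-identityˡ (Δ c g v))
Δ-stuffle c g u@(_ ∷ _) []      = trans (linear-ext (fin-Δ c u) (λ w → sym (stuffle-[]ʳ g w))) (sym (ℚₚ.+-identityʳ _))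
Δ-stuffle c g u₀@(k ∷ u) v₀@(l ∷ v) = begin
  stuffle (λ w → Δ c g (k ∷ w)) u v₀ + stuffle (λ w → Δ c g (l ∷ w)) u₀ v + stuffle (λ w → Δ c g (m ∷ w)) u v
    ≡⟨ cong₂ _+_ (cong₂ _+_ (stuffle-Δ-head c g k u v₀) (stuffle-Δ-head c g l u₀ v)) (stuffle-Δ-head c g m u v) ⟩
  (stuffle (Δ c (g ∘∷ k)) u v₀ + (k′ - c * (wt u + wt v₀)) * a + (- (c * (k′ + (wt u + wt v₀)))) * a₀)
  + (stuffle (Δ c (g ∘∷ l)) u₀ v + (l′ - c * (wt u₀ + wt v)) * b + (- (c * (l′ + (wt u₀ + wt v)))) * b₀)
  + (stuffle (Δ c (g ∘∷ m)) u v + (ι (suc m) - c * (wt u + wt v)) * d + (- (c * (ι (suc m) + (wt u + wt v)))) * d₀)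
    ≡⟨ cong₂ _+_ (cong₂ _+_
         (cong (λ t → t + (k′ - c * (wt u + wt v₀)) * a + (- (c * (k′ + (wt u + wt v₀)))) * a₀) (Δ-stuffle c (g ∘∷ k) u v₀))
         (cong (λ t → t + (l′ - c * (wt u₀ + wt v)) * b + (- (c * (l′ + (wt u₀ + wt v)))) * b₀) (Δ-stuffle c (g ∘∷ l) u₀ v)))
         (cong₂ (λ s t → s + (t - c * (wt u + wt v)) * d + (- (c * (t + (wt u + wt v)))) * d₀) (Δ-stuffle c (g ∘∷ m) u v) wt-m) ⟩
  (D₁ + (D₂ + (l′ - c * wt v) * p₁ + (- (c * wt v₀)) * p₂) + (k′ - c * (wt u + wt v₀)) * a + (- (c * (k′ + (wt u + wt v₀)))) * a₀)
  + ((E₁ + (k′ - c * wt u) * q₁ + (- (c * wt u₀)) * q₂) + E₂ + (l′ - c * (wt u₀ + wt v)) * b + (- (c * (l′ + (wt u₀ + wt v)))) * b₀)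
  + (F₁ + F₂ + ((k′ + l′) - c * (wt u + wt v)) * d + (- (c * ((k′ + l′) + (wt u + wt v)))) * d₀)
    ≡⟨ Δ-stuffle-arith c k′ l′ (wt u) (wt v) D₁ D₂ E₁ E₂ F₁ F₂ a b d a₀ b₀ d₀ p₁ p₂ q₁ q₂ ⟩
  ((D₁ + E₁ + F₁) + (k′ - c * wt u) * (a + q₁ + d) + (- (c * wt u₀)) * ((a₀ + b₀ + d₀) + q₂ + b))
  + ((D₂ + E₂ + F₂) + (l′ - c * wt v) * (p₁ + b + d) + (- (c * wt v₀)) * (p₂ + (a₀ + b₀ + d₀) + a))
    ≡⟨ cong₂ _+_
         (cong (λ t → t + (k′ - c * wt u) * (a + q₁ + d) + (- (c * wt u₀)) * ((a₀ + b₀ + d₀) + q₂ + b))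
           (sym (trans (linear-+ δu _ _) (cong (_+ F₁) (linear-+ δu _ _)))))
         (cong₂ _+_ (cong₂ _+_ (sym (trans (linear-+ δv _ _) (cong (_+ F₂) (linear-+ δv _ _))))
           (cong (λ t → (l′ - c * wt v) * (p₁ + b + stuffle (g ∘∷ suc t) u v)) (sym (ℕₚ.+-suc k l))))
           (cong (λ t → (- (c * wt v₀)) * (p₂ + (a₀ + b₀ + d₀) + stuffle (g ∘∷ suc t) u v₀)) (sym (ℕₚ.+-identityʳ k)))) ⟩
  Δ c (λ w → stuffle g w v₀) u₀ + Δ c (λ w → stuffle g u₀ w) v₀ ∎
  where
  open ≡-Reasoning
  m  = suc (k ℕ.+ l)
  k′ = ι (suc k)
  l′ = ι (suc l)
  δu = fin-Δ c u
  δv = fin-Δ c v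
  a  = stuffle (g ∘∷ suc k) u v₀
  b  = stuffle (g ∘∷ suc l) u₀ v
  d  = stuffle (g ∘∷ suc m) u v
  a₀ = stuffle (g ∘∷ 0 ∘∷ k) u v₀
  b₀ = stuffle (g ∘∷ 0 ∘∷ l) u₀ v
  d₀ = stuffle (g ∘∷ 0 ∘∷ m) u v
  p₁ = stuffle (g ∘∷ k) u (suc l ∷ v)
  p₂ = stuffle (g ∘∷ k) u (0 ∷ v₀)
  q₁ = stuffle (g ∘∷ l) (suc k ∷ u) v
  q₂ = stuffle (g ∘∷ l) (0 ∷ u₀) v
  D₁ = Δ c (λ w → stuffle (g ∘∷ k) w v₀) u
  D₂ = Δ c (λ w → stuffle (g ∘∷ k) u (l ∷ w)) v
  E₁ = Δ c (λ w → stuffle (g ∘∷ l) (k ∷ w) v) u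
  E₂ = Δ c (λ w → stuffle (g ∘∷ l) u₀ w) v
  F₁ = Δ c (λ w → stuffle (g ∘∷ m) w v) u
  F₂ = Δ c (λ w → stuffle (g ∘∷ m) u w) v
  wt-m : ι (suc m) ≡ k′ + l′
  wt-m = trans (cong (λ t → ι (suc t)) (sym (ℕₚ.+-suc k l))) (ι-+ (suc k) (suc l))

-- Operators on words, transposed

len : Word → ℚ
len w = ι (length w)

fin-eval : ∀ u → Finite (λ g → eval g u)
fin-eval []            = fin-0
fin-eval ((q , w) ∷ u) = fin-+ (fin-* q (fin-at w)) (fin-eval u)

∂ᵗ : (Word → ℚ) → Word → ℚ
∂ᵗ g w = eval g (∂₁ᵂ w)

θᵗ : ℚ → (Word → ℚ) → Word → ℚ
θᵗ c g w = eval g (θᵂ c w)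

fin-∂ᵗ : ∀ w → Finite (λ g → ∂ᵗ g w)
fin-∂ᵗ w = fin-eval (∂₁ᵂ w)

fin-θᵗ : ∀ c w → Finite (λ g → θᵗ c g w)
fin-θᵗ c w = fin-eval (θᵂ c w)

∂ᵗ-cons : ∀ g a w → ∂ᵗ g (a ∷ w) ≡ eval (λ p → g (p ++ w)) (∂₁ᴸ a) + ∂ᵗ (g ∘∷ a) w
∂ᵗ-cons g a w = trans (eval-⊕ g (∂₁ᴸ a ⊙ mono w) _)
  (cong₂ _+_ (eval-⊙mono g (∂₁ᴸ a) w) (eval-mono⊙ g [ a ] (∂₁ᵂ w)))

∂ᵗ-X : ∀ g w → ∂ᵗ g (X ∷ w) ≡ g (X ∷ Y ∷ w) + ∂ᵗ (g ∘∷ X) w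
∂ᵗ-X g w = trans (∂ᵗ-cons g X w) (cong (_+ ∂ᵗ (g ∘∷ X) w)
  (solve 1 (λ a → con 1ℚ :* a :+ con 0ℚ := a) refl (g (X ∷ Y ∷ w))))

∂ᵗ-Y : ∀ g w → ∂ᵗ g (Y ∷ w) ≡ - g (X ∷ Y ∷ w) + ∂ᵗ (g ∘∷ Y) w
∂ᵗ-Y g w = trans (∂ᵗ-cons g Y w) (cong (_+ ∂ᵗ (g ∘∷ Y) w)
  (solve 1 (λ a → con (- 1ℚ) :* a :+ con 0ℚ := :- a) refl (g (X ∷ Y ∷ w))))

θᵗ-cons : ∀ c g a w → θᵗ c g (a ∷ w) ≡
  eval (λ p → g (p ++ w)) (θᴸ a) + θᵗ c (g ∘∷ a) w + c * (len w * eval (λ p → g (p ++ w)) (∂₁ᴸ a))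
θᵗ-cons c g a w = begin
  eval g (θᴸ a ⊙ mono w ⊕ mono [ a ] ⊙ θᵂ c w ⊕ c • (∂₁ᴸ a ⊙ H (mono w)))
    ≡⟨ trans (eval-⊕ g (θᴸ a ⊙ mono w ⊕ mono [ a ] ⊙ θᵂ c w) _) (cong₂ _+_
         (trans (eval-⊕ g (θᴸ a ⊙ mono w) _) (cong₂ _+_ (eval-⊙mono g (θᴸ a) w) (eval-mono⊙ g [ a ] (θᵂ c w))))
         (eval-• g c (∂₁ᴸ a ⊙ H (mono w)))) ⟩
  eval (λ p → g (p ++ w)) (θᴸ a) + θᵗ c (g ∘∷ a) w + c * eval g (∂₁ᴸ a ⊙ H (mono w))
    ≡⟨ cong (λ t → eval (λ p → g (p ++ w)) (θᴸ a) + θᵗ c (g ∘∷ a) w + c * t) (trans (eval-⊙ g (∂₁ᴸ a) (H (mono w)))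
         (trans (eval-ext (λ p → onH (g (p ++ w))) (∂₁ᴸ a)) (eval-* (len w) (λ p → g (p ++ w)) (∂₁ᴸ a)))) ⟩
  eval (λ p → g (p ++ w)) (θᴸ a) + θᵗ c (g ∘∷ a) w + c * (len w * eval (λ p → g (p ++ w)) (∂₁ᴸ a)) ∎
  where
  open ≡-Reasoning
  onH : ∀ t → 1ℚ * (deg w * 1ℚ) * t + 0ℚ ≡ len w * t
  onH t = trans (solve 2 (λ d t → con 1ℚ :* (d :* con 1ℚ) :* t :+ con 0ℚ := d :* t) refl (deg w) t)
                (cong (_* t) (sym (ι-def (length w))))

θᵗ-X : ∀ c g w → θᵗ c g (X ∷ w) ≡
  ½ * (g (X ∷ X ∷ w) + g (X ∷ Y ∷ w) + (g (X ∷ X ∷ w) + g (Y ∷ X ∷ w))) + θᵗ c (g ∘∷ X) w + c * (len w * g (X ∷ Y ∷ w))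
θᵗ-X c g w = trans (θᵗ-cons c g X w) (cong₂ (λ s t → s + θᵗ c (g ∘∷ X) w + c * (len w * t))
  (solve 3 (λ p q r → con ½ :* p :+ (con ½ :* q :+ (con ½ :* p :+ (con ½ :* r :+ con 0ℚ))) := con ½ :* (p :+ q :+ (p :+ r)))
    refl (g (X ∷ X ∷ w)) (g (X ∷ Y ∷ w)) (g (Y ∷ X ∷ w)))
  (solve 1 (λ a → con 1ℚ :* a :+ con 0ℚ := a) refl (g (X ∷ Y ∷ w))))

θᵗ-Y : ∀ c g w → θᵗ c g (Y ∷ w) ≡
  ½ * (g (Y ∷ X ∷ w) + g (Y ∷ Y ∷ w) + (g (X ∷ Y ∷ w) + g (Y ∷ Y ∷ w))) + θᵗ c (g ∘∷ Y) w + c * (len w * - g (X ∷ Y ∷ w))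
θᵗ-Y c g w = trans (θᵗ-cons c g Y w) (cong₂ (λ s t → s + θᵗ c (g ∘∷ Y) w + c * (len w * t))
  (solve 3 (λ p q r → con ½ :* p :+ (con ½ :* q :+ (con ½ :* r :+ (con ½ :* q :+ con 0ℚ))) := con ½ :* (p :+ q :+ (r :+ q)))
    refl (g (Y ∷ X ∷ w)) (g (Y ∷ Y ∷ w)) (g (X ∷ Y ∷ w)))
  (solve 1 (λ a → con (- 1ℚ) :* a :+ con 0ℚ := :- a) refl (g (X ∷ Y ∷ w))))

_∘z : (Word → ℚ) → Word → ℚ
(g ∘z) w = g (X ∷ w) + g (Y ∷ w)

infixl 20 _∘z

-- As ∂₁(z) = 0, the derivation commutes with left multiplication by z.
∂ᵗ-z : ∀ g w → (∂ᵗ g ∘z) w ≡ ∂ᵗ (g ∘z) w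
∂ᵗ-z g w = begin
  ∂ᵗ g (X ∷ w) + ∂ᵗ g (Y ∷ w)
    ≡⟨ cong₂ _+_ (∂ᵗ-X g w) (∂ᵗ-Y g w) ⟩
  (g (X ∷ Y ∷ w) + ∂ᵗ (g ∘∷ X) w) + (- g (X ∷ Y ∷ w) + ∂ᵗ (g ∘∷ Y) w)
    ≡⟨ solve 3 (λ p a b → (p :+ a) :+ (:- p :+ b) := a :+ b) refl (g (X ∷ Y ∷ w)) _ _ ⟩
  ∂ᵗ (g ∘∷ X) w + ∂ᵗ (g ∘∷ Y) w
    ≡⟨ sym (linear-+ (fin-∂ᵗ w) (g ∘∷ X) (g ∘∷ Y)) ⟩
  ∂ᵗ (g ∘z) w ∎
  where open ≡-Reasoning

-- As θ^(c)(z) = z² and ∂₁(z) = 0, the commutator of θ^(c) with L_z is L_z², whatever c is.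
θᵗ-z : ∀ c g w → (θᵗ c g ∘z) w ≡ θᵗ c (g ∘z) w + (g ∘z ∘z) w
θᵗ-z c g w = begin
  θᵗ c g (X ∷ w) + θᵗ c g (Y ∷ w)
    ≡⟨ cong₂ _+_ (θᵗ-X c g w) (θᵗ-Y c g w) ⟩
  _ ≡⟨ solve 8 (λ c l xx xy yx yy a b →
         (con ½ :* (xx :+ xy :+ (xx :+ yx)) :+ a :+ c :* (l :* xy)) :+ (con ½ :* (yx :+ yy :+ (xy :+ yy)) :+ b :+ c :* (l :* :- xy))
         := (a :+ b) :+ ((xx :+ yx) :+ (xy :+ yy)))
         refl c (len w) (g (X ∷ X ∷ w)) (g (X ∷ Y ∷ w)) (g (Y ∷ X ∷ w)) (g (Y ∷ Y ∷ w)) (θᵗ c (g ∘∷ X) w) (θᵗ c (g ∘∷ Y) w) ⟩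
  (θᵗ c (g ∘∷ X) w + θᵗ c (g ∘∷ Y) w) + (g ∘z ∘z) w
    ≡⟨ cong (_+ (g ∘z ∘z) w) (sym (linear-+ (fin-θᵗ c w) (g ∘∷ X) (g ∘∷ Y))) ⟩
  θᵗ c (g ∘z) w + (g ∘z ∘z) w ∎
  where open ≡-Reasoning

-- The transpose of ad(θ^(c))^n(∂₁).
adᵗ : ℚ → ℕ → (Word → ℚ) → Word → ℚ
adᵗ c zero    g w = ∂ᵗ g w
adᵗ c (suc n) g w = adᵗ c n (θᵗ c g) w - θᵗ c (adᵗ c n g) w

fin-adᵗ : ∀ c n w → Finite (λ g → adᵗ c n g w)
fin-adᵗ c zero    w = fin-∂ᵗ w
fin-adᵗ c (suc n) w = fin-+ (fin-bind (fin-adᵗ c n w) (fin-θᵗ c))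
  (fin-neg (fin-bind (fin-θᵗ c w) (fin-adᵗ c n)))

eval-adᵗ : ∀ c n g u → eval g (ad^ n (θ c) ∂₁ u) ≡ eval (adᵗ c n g) u
eval-adᵗ c zero    g u = eval-lin g ∂₁ᵂ u
eval-adᵗ c (suc n) g u = begin
  eval g (θ c (A u) ⊖ A (θ c u))                         ≡⟨ eval-⊖ g (θ c (A u)) (A (θ c u)) ⟩
  eval g (θ c (A u)) - eval g (A (θ c u))
    ≡⟨ cong₂ _-_ (trans (eval-lin g (θᵂ c) (A u)) (eval-adᵗ c n (θᵗ c g) u))
                 (trans (eval-adᵗ c n g (θ c u)) (eval-lin (adᵗ c n g) (θᵂ c) u)) ⟩
  eval (adᵗ c n (θᵗ c g)) u - eval (θᵗ c (adᵗ c n g)) u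
    ≡⟨ sym (linear-sub (fin-eval u) (adᵗ c n (θᵗ c g)) (θᵗ c (adᵗ c n g))) ⟩
  eval (adᵗ c (suc n) g) u                               ∎
  where
  open ≡-Reasoning
  A = ad^ n (θ c) ∂₁

adᵗ-[] : ∀ c n g → adᵗ c n g [] ≡ 0ℚ
adᵗ-[] c zero    g = refl
adᵗ-[] c (suc n) g = trans (cong (_- 0ℚ) (adᵗ-[] c n (θᵗ c g))) refl

-- The Jacobi identity in coordinates: if A commutes with L_z, then it commutes with L_z², and the
-- two corrections L_z² A and A L_z² in the commutator of θ^(c) and A cancel.
adᵗ-z : ∀ c n g w → (adᵗ c n g ∘z) w ≡ adᵗ c n (g ∘z) w
adᵗ-z c zero    g w = ∂ᵗ-z g w
adᵗ-z c (suc n) g w = begin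
  (A (θᵗ c g) (X ∷ w) - θᵗ c (A g) (X ∷ w)) + (A (θᵗ c g) (Y ∷ w) - θᵗ c (A g) (Y ∷ w))
    ≡⟨ solve 4 (λ a b c d → (a :- b) :+ (c :- d) := (a :+ c) :- (b :+ d)) refl
         (A (θᵗ c g) (X ∷ w)) (θᵗ c (A g) (X ∷ w)) (A (θᵗ c g) (Y ∷ w)) (θᵗ c (A g) (Y ∷ w)) ⟩
  (A (θᵗ c g) ∘z) w - (θᵗ c (A g) ∘z) w
    ≡⟨ cong₂ _-_ (adᵗ-z c n (θᵗ c g) w) (θᵗ-z c (A g) w) ⟩
  A (θᵗ c g ∘z) w - (θᵗ c (A g ∘z) w + (A g ∘z ∘z) w)
    ≡⟨ cong₂ _-_ (trans (linear-ext (fin-adᵗ c n w) (θᵗ-z c g)) (linear-+ (fin-adᵗ c n w) (θᵗ c (g ∘z)) (g ∘z ∘z)))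
         (cong₂ _+_ (linear-ext (fin-θᵗ c w) (adᵗ-z c n g))
           (trans (cong₂ _+_ (adᵗ-z c n g (X ∷ w)) (adᵗ-z c n g (Y ∷ w))) (adᵗ-z c n (g ∘z) w))) ⟩
  (A (θᵗ c (g ∘z)) w + A (g ∘z ∘z) w) - (θᵗ c (A (g ∘z)) w + A (g ∘z ∘z) w)
    ≡⟨ solve 3 (λ a b d → (a :+ d) :- (b :+ d) := a :- b) refl (A (θᵗ c (g ∘z)) w) (θᵗ c (A (g ∘z)) w) (A (g ∘z ∘z) w) ⟩
  A (θᵗ c (g ∘z)) w - θᵗ c (A (g ∘z)) w ∎
  where
  open ≡-Reasoning
  A = adᵗ c n

-- Subtracting ½ L_z from θ does not change its commutators with the ∂ₙ, and
-- the difference maps x𝓗 to itself.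
θ̃ᵗ : ℚ → (Word → ℚ) → Word → ℚ
θ̃ᵗ c g w = θᵗ c g w - ½ * (g ∘z) w

adᵗ-θ̃ : ∀ c n g w → adᵗ c (suc n) g w ≡ adᵗ c n (θ̃ᵗ c g) w - θ̃ᵗ c (adᵗ c n g) w
adᵗ-θ̃ c n g w = begin
  A (θᵗ c g) w - θᵗ c (A g) w
    ≡⟨ solve 3 (λ a b d → a :- b := (a :- d) :- (b :- d)) refl (A (θᵗ c g) w) (θᵗ c (A g) w) (½ * (A g ∘z) w) ⟩
  (A (θᵗ c g) w - ½ * (A g ∘z) w) - θ̃ᵗ c (A g) w
    ≡⟨ cong (λ t → (A (θᵗ c g) w - ½ * t) - θ̃ᵗ c (A g) w) (adᵗ-z c n g w) ⟩
  (A (θᵗ c g) w - ½ * A (g ∘z) w) - θ̃ᵗ c (A g) w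
    ≡⟨ cong (_- θ̃ᵗ c (A g) w) (sym (trans (linear-sub F (θᵗ c g) (λ v → ½ * (g ∘z) v)) (cong (λ t → A (θᵗ c g) w - t) (linear-* F ½ (g ∘z))))) ⟩
  A (θ̃ᵗ c g) w - θ̃ᵗ c (A g) w ∎
  where
  open ≡-Reasoning
  A = adᵗ c n
  F = fin-adᵗ c n w

-- The transpose of the automorphism φ : x ↦ x + y, y ↦ -y.
φᵗ : (Word → ℚ) → Word → ℚ
φᵗ g []      = g []
φᵗ g (X ∷ w) = φᵗ (g ∘∷ X) w + φᵗ (g ∘∷ Y) w
φᵗ g (Y ∷ w) = - φᵗ (g ∘∷ Y) w

fin-φᵗ : ∀ w → Finite (λ g → φᵗ g w)
fin-φᵗ []      = fin-at []
fin-φᵗ (X ∷ w) = fin-+ (fin-bind (fin-φᵗ w) (λ v → fin-at (X ∷ v))) (fin-bind (fin-φᵗ w) (λ v → fin-at (Y ∷ v)))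
fin-φᵗ (Y ∷ w) = fin-neg (fin-bind (fin-φᵗ w) (λ v → fin-at (Y ∷ v)))

-- φ(z) = (x + y) - y = x, so φ is its own inverse and every word is φ of something.
φᵗ-involutive : ∀ g w → φᵗ (φᵗ g) w ≡ g w
φᵗ-involutive g []      = refl
φᵗ-involutive g (X ∷ w) = begin
  φᵗ (λ v → φᵗ (g ∘∷ X) v + φᵗ (g ∘∷ Y) v) w + φᵗ (λ v → - φᵗ (g ∘∷ Y) v) w
    ≡⟨ cong₂ _+_ (linear-+ (fin-φᵗ w) (φᵗ (g ∘∷ X)) (φᵗ (g ∘∷ Y))) (linear-neg (fin-φᵗ w) (φᵗ (g ∘∷ Y))) ⟩
  (φᵗ (φᵗ (g ∘∷ X)) w + φᵗ (φᵗ (g ∘∷ Y)) w) + - φᵗ (φᵗ (g ∘∷ Y)) w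
    ≡⟨ solve 2 (λ a b → (a :+ b) :+ :- b := a) refl (φᵗ (φᵗ (g ∘∷ X)) w) (φᵗ (φᵗ (g ∘∷ Y)) w) ⟩
  φᵗ (φᵗ (g ∘∷ X)) w
    ≡⟨ φᵗ-involutive (g ∘∷ X) w ⟩
  g (X ∷ w) ∎
  where open ≡-Reasoning
φᵗ-involutive g (Y ∷ w) = begin
  - φᵗ (λ v → - φᵗ (g ∘∷ Y) v) w    ≡⟨ cong -_ (linear-neg (fin-φᵗ w) (φᵗ (g ∘∷ Y))) ⟩
  - - φᵗ (φᵗ (g ∘∷ Y)) w            ≡⟨ solve 1 (λ a → :- (:- a) := a) refl (φᵗ (φᵗ (g ∘∷ Y)) w) ⟩
  φᵗ (φᵗ (g ∘∷ Y)) w                ≡⟨ φᵗ-involutive (g ∘∷ Y) w ⟩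
  g (Y ∷ w)                         ∎
  where open ≡-Reasoning

φᵗ-z : ∀ g w → φᵗ (g ∘z) w ≡ φᵗ g (X ∷ w)
φᵗ-z g w = linear-+ (fin-φᵗ w) (g ∘∷ X) (g ∘∷ Y)

φᵗ-y : ∀ g w → φᵗ (g ∘∷ Y) w ≡ - φᵗ g (Y ∷ w)
φᵗ-y g w = solve 1 (λ a → a := :- (:- a)) refl (φᵗ (g ∘∷ Y) w)

-- φ is homogeneous of degree 0, so the factor `H` in the product rule of θ^(c) survives
-- conjugation.
φᵗ-len : ∀ g w → φᵗ (λ v → len v * g v) w ≡ len w * φᵗ g w
φᵗ-len-cons : ∀ g a w → φᵗ (λ v → len (a ∷ v) * g (a ∷ v)) w ≡ len (a ∷ w) * φᵗ (g ∘∷ a) w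

φᵗ-len g []      = refl
φᵗ-len g (X ∷ w) = trans (cong₂ _+_ (φᵗ-len-cons g X w) (φᵗ-len-cons g Y w))
  (sym (ℚₚ.*-distribˡ-+ (len (X ∷ w)) (φᵗ (g ∘∷ X) w) (φᵗ (g ∘∷ Y) w)))
φᵗ-len g (Y ∷ w) = trans (cong -_ (φᵗ-len-cons g Y w))
  (solve 2 (λ l t → :- (l :* t) := l :* :- t) refl (len (Y ∷ w)) (φᵗ (g ∘∷ Y) w))

φᵗ-len-cons g a w = begin
  φᵗ (λ v → len (a ∷ v) * g (a ∷ v)) w
    ≡⟨ linear-ext (fin-φᵗ w) (λ v → trans (cong (_* g (a ∷ v)) (ι-suc (length v)))
         (solve 2 (λ l t → (con 1ℚ :+ l) :* t := t :+ l :* t) refl (len v) (g (a ∷ v)))) ⟩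
  φᵗ (λ v → g (a ∷ v) + len v * g (a ∷ v)) w
    ≡⟨ trans (linear-+ (fin-φᵗ w) _ _) (cong (φᵗ (g ∘∷ a) w +_) (φᵗ-len (g ∘∷ a) w)) ⟩
  φᵗ (g ∘∷ a) w + len w * φᵗ (g ∘∷ a) w
    ≡⟨ trans (solve 2 (λ l t → t :+ l :* t := (con 1ℚ :+ l) :* t) refl (len w) (φᵗ (g ∘∷ a) w))
         (cong (_* φᵗ (g ∘∷ a) w) (sym (ι-suc (length w)))) ⟩
  len (a ∷ w) * φᵗ (g ∘∷ a) w ∎
  where open ≡-Reasoning

-- Conjugation by φ

-- The conjugates of ∂₁ and θ^(c) by φ, transposed: x ↦ 0, y ↦ -zy for ∂₁ and
-- x ↦ x², y ↦ ½(xy + yx) for θ^(c).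
∂′ᵗ : (Word → ℚ) → Word → ℚ
∂′ᵗ h []      = 0ℚ
∂′ᵗ h (X ∷ w) = ∂′ᵗ (h ∘∷ X) w
∂′ᵗ h (Y ∷ w) = - (h (X ∷ Y ∷ w) + h (Y ∷ Y ∷ w)) + ∂′ᵗ (h ∘∷ Y) w

fin-∂′ᵗ : ∀ w → Finite (λ h → ∂′ᵗ h w)
fin-∂′ᵗ []      = fin-0
fin-∂′ᵗ (X ∷ w) = fin-bind (fin-∂′ᵗ w) (λ v → fin-at (X ∷ v))
fin-∂′ᵗ (Y ∷ w) = fin-+ (fin-neg (fin-+ (fin-at (X ∷ Y ∷ w)) (fin-at (Y ∷ Y ∷ w))))
  (fin-bind (fin-∂′ᵗ w) (λ v → fin-at (Y ∷ v)))

θ′ᵗ : ℚ → (Word → ℚ) → Word → ℚ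
θ′ᵗ c h []      = 0ℚ
θ′ᵗ c h (X ∷ w) = h (X ∷ X ∷ w) + θ′ᵗ c (h ∘∷ X) w
θ′ᵗ c h (Y ∷ w) = ½ * (h (Y ∷ X ∷ w) + h (X ∷ Y ∷ w)) + θ′ᵗ c (h ∘∷ Y) w
                  + (- (c * len w)) * (h (X ∷ Y ∷ w) + h (Y ∷ Y ∷ w))

fin-θ′ᵗ : ∀ c w → Finite (λ h → θ′ᵗ c h w)
fin-θ′ᵗ c []      = fin-0
fin-θ′ᵗ c (X ∷ w) = fin-+ (fin-at (X ∷ X ∷ w)) (fin-bind (fin-θ′ᵗ c w) (λ v → fin-at (X ∷ v)))
fin-θ′ᵗ c (Y ∷ w) = fin-+ (fin-+
  (fin-* ½ (fin-+ (fin-at (Y ∷ X ∷ w)) (fin-at (X ∷ Y ∷ w))))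
  (fin-bind (fin-θ′ᵗ c w) (λ v → fin-at (Y ∷ v))))
  (fin-* (- (c * len w)) (fin-+ (fin-at (X ∷ Y ∷ w)) (fin-at (Y ∷ Y ∷ w))))

-- Because xy = φ(-zy).
φᵗ-xy : ∀ g w → φᵗ (λ v → g (X ∷ Y ∷ v)) w ≡ - (φᵗ g (X ∷ Y ∷ w) + φᵗ g (Y ∷ Y ∷ w))
φᵗ-xy g w = solve 2 (λ a b → a := :- ((:- a :+ :- b) :+ :- (:- b))) refl
  (φᵗ (λ v → g (X ∷ Y ∷ v)) w) (φᵗ (λ v → g (Y ∷ Y ∷ v)) w)

-- A leading x is turned into z by φ, and ∂₁ commutes with L_z; only a leading y produces new terms.
φᵗ-∂ᵗ : ∀ g w → φᵗ (∂ᵗ g) w ≡ ∂′ᵗ (φᵗ g) w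
φᵗ-∂ᵗ g []      = refl
φᵗ-∂ᵗ g (X ∷ w) = begin
  φᵗ (∂ᵗ g) (X ∷ w)            ≡⟨ sym (φᵗ-z (∂ᵗ g) w) ⟩
  φᵗ (∂ᵗ g ∘z) w               ≡⟨ linear-ext (fin-φᵗ w) (∂ᵗ-z g) ⟩
  φᵗ (∂ᵗ (g ∘z)) w             ≡⟨ φᵗ-∂ᵗ (g ∘z) w ⟩
  ∂′ᵗ (φᵗ (g ∘z)) w            ≡⟨ linear-ext (fin-∂′ᵗ w) (φᵗ-z g) ⟩
  ∂′ᵗ (φᵗ g ∘∷ X) w            ∎
  where open ≡-Reasoning
φᵗ-∂ᵗ g (Y ∷ w) = begin
  - φᵗ (∂ᵗ g ∘∷ Y) w
    ≡⟨ cong -_ (trans (linear-ext (fin-φᵗ w) (∂ᵗ-Y g)) (trans (linear-+ (fin-φᵗ w) _ _)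
         (cong₂ _+_ (trans (linear-neg (fin-φᵗ w) _) (cong -_ (φᵗ-xy g w))) (φᵗ-∂ᵗ (g ∘∷ Y) w)))) ⟩
  - (- - s + ∂′ᵗ (φᵗ (g ∘∷ Y)) w)
    ≡⟨ solve 2 (λ s t → :- (:- (:- s) :+ t) := :- s :+ :- t) refl s (∂′ᵗ (φᵗ (g ∘∷ Y)) w) ⟩
  - s + - ∂′ᵗ (φᵗ (g ∘∷ Y)) w
    ≡⟨ cong (- s +_) (sym (linear-neg (fin-∂′ᵗ w) (φᵗ (g ∘∷ Y)))) ⟩
  - s + ∂′ᵗ (φᵗ g ∘∷ Y) w ∎
  where
  open ≡-Reasoning
  s = φᵗ g (X ∷ Y ∷ w) + φᵗ g (Y ∷ Y ∷ w)

-- As φ(x) = z, the case of a leading x is the commutator of θ^(c) with L_z, whose term L_z² becomes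
-- the x² of `θ′ᵗ`.
φᵗ-θᵗ : ∀ c g w → φᵗ (θᵗ c g) w ≡ θ′ᵗ c (φᵗ g) w
φᵗ-θᵗ c g []      = refl
φᵗ-θᵗ c g (X ∷ w) = begin
  φᵗ (θᵗ c g) (X ∷ w)                         ≡⟨ sym (φᵗ-z (θᵗ c g) w) ⟩
  φᵗ (θᵗ c g ∘z) w                            ≡⟨ linear-ext (fin-φᵗ w) (θᵗ-z c g) ⟩
  φᵗ (λ v → θᵗ c (g ∘z) v + (g ∘z ∘z) v) w    ≡⟨ linear-+ (fin-φᵗ w) (θᵗ c (g ∘z)) (g ∘z ∘z) ⟩
  φᵗ (θᵗ c (g ∘z)) w + φᵗ (g ∘z ∘z) w         ≡⟨ cong₂ _+_ (φᵗ-θᵗ c (g ∘z) w) (trans (φᵗ-z (g ∘z) w) (φᵗ-z g (X ∷ w))) ⟩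
  θ′ᵗ c (φᵗ (g ∘z)) w + φᵗ g (X ∷ X ∷ w)      ≡⟨ cong (_+ φᵗ g (X ∷ X ∷ w)) (linear-ext (fin-θ′ᵗ c w) (φᵗ-z g)) ⟩
  θ′ᵗ c (φᵗ g ∘∷ X) w + φᵗ g (X ∷ X ∷ w)      ≡⟨ ℚₚ.+-comm (θ′ᵗ c (φᵗ g ∘∷ X) w) (φᵗ g (X ∷ X ∷ w)) ⟩
  φᵗ g (X ∷ X ∷ w) + θ′ᵗ c (φᵗ g ∘∷ X) w      ∎
  where open ≡-Reasoning
φᵗ-θᵗ c g (Y ∷ w) = begin
  - φᵗ (θᵗ c g ∘∷ Y) w
    ≡⟨ cong -_ (linear-ext F (λ v → trans (θᵗ-Y c g v)
         (solve 6 (λ c l yx yy xy d → con ½ :* (yx :+ yy :+ (xy :+ yy)) :+ d :+ c :* (l :* :- xy)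
           := con ½ :* ((yx :+ yy) :+ (xy :+ yy)) :+ d :+ (:- c) :* (l :* xy)) refl
           c (len v) (g (Y ∷ X ∷ v)) (g (Y ∷ Y ∷ v)) (g (X ∷ Y ∷ v)) (θᵗ c (g ∘∷ Y) v)))) ⟩
  - φᵗ (λ v → ½ * ((g ∘∷ Y ∘z) v + (g ∘z) (Y ∷ v)) + θᵗ c (g ∘∷ Y) v + (- c) * (len v * g (X ∷ Y ∷ v))) w
    ≡⟨ cong -_ (trans (linear-+ F _ _) (cong₂ _+_ (trans (linear-+ F _ _) (cong₂ _+_
         (trans (linear-* F ½ (λ v → (g ∘∷ Y ∘z) v + (g ∘z) (Y ∷ v))) (cong (½ *_) (trans (linear-+ F (g ∘∷ Y ∘z) (g ∘z ∘∷ Y)) (cong₂ _+_ yx xy))))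
         (φᵗ-θᵗ c (g ∘∷ Y) w)))
         (trans (linear-* F (- c) (λ v → len v * g (X ∷ Y ∷ v))) (cong ((- c) *_) (trans (φᵗ-len (λ v → g (X ∷ Y ∷ v)) w) (cong (len w *_) (φᵗ-xy g w))))))) ⟩
  - (½ * (- h (Y ∷ X ∷ w) + - h (X ∷ Y ∷ w)) + θ′ᵗ c (φᵗ (g ∘∷ Y)) w + (- c) * (len w * - (h (X ∷ Y ∷ w) + h (Y ∷ Y ∷ w))))
    ≡⟨ solve 6 (λ c l yx xy yy d → :- (con ½ :* (:- yx :+ :- xy) :+ d :+ (:- c) :* (l :* :- (xy :+ yy)))
         := con ½ :* (yx :+ xy) :+ :- d :+ (:- (c :* l)) :* (xy :+ yy)) refl
         c (len w) (h (Y ∷ X ∷ w)) (h (X ∷ Y ∷ w)) (h (Y ∷ Y ∷ w)) (θ′ᵗ c (φᵗ (g ∘∷ Y)) w) ⟩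
  ½ * (h (Y ∷ X ∷ w) + h (X ∷ Y ∷ w)) + - θ′ᵗ c (φᵗ (g ∘∷ Y)) w + (- (c * len w)) * (h (X ∷ Y ∷ w) + h (Y ∷ Y ∷ w))
    ≡⟨ cong (λ t → ½ * (h (Y ∷ X ∷ w) + h (X ∷ Y ∷ w)) + t + (- (c * len w)) * (h (X ∷ Y ∷ w) + h (Y ∷ Y ∷ w)))
         (sym (linear-neg (fin-θ′ᵗ c w) (φᵗ (g ∘∷ Y)))) ⟩
  θ′ᵗ c h (Y ∷ w) ∎
  where
  open ≡-Reasoning
  F = fin-φᵗ w
  h = φᵗ g
  yx : φᵗ (g ∘∷ Y ∘z) w ≡ - h (Y ∷ X ∷ w)
  yx = trans (φᵗ-z (g ∘∷ Y) w) (φᵗ-y g (X ∷ w))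
  xy : φᵗ (g ∘z ∘∷ Y) w ≡ - h (X ∷ Y ∷ w)
  xy = trans (φᵗ-y (g ∘z) w) (cong -_ (φᵗ-z g (Y ∷ w)))

-- The conjugate of θ^(c) - ½ L_z by w ↦ x φ(w). The first letter contributes ½xz and c xy H; with
-- the x removed, φ turns ½z into ½x and c y H into -c y H.
Θ′ᵗ : ℚ → (Word → ℚ) → Word → ℚ
Θ′ᵗ c h w = ½ * h (X ∷ w) + θ′ᵗ c h w + (- (c * len w)) * h (Y ∷ w)

φᵗ-θ̃ᵗ : ∀ c g w → φᵗ (θ̃ᵗ c g ∘∷ X) w ≡ Θ′ᵗ c (φᵗ (g ∘∷ X)) w
φᵗ-θ̃ᵗ c g w = begin
  φᵗ (θ̃ᵗ c g ∘∷ X) w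
    ≡⟨ linear-ext F (λ v → trans (cong (_- ½ * (g ∘z) (X ∷ v)) (θᵗ-X c g v))
         (solve 6 (λ c l xx xy yx d → (con ½ :* (xx :+ xy :+ (xx :+ yx)) :+ d :+ c :* (l :* xy)) :- con ½ :* (xx :+ yx)
           := con ½ :* (xx :+ xy) :+ d :+ c :* (l :* xy)) refl
           c (len v) (g (X ∷ X ∷ v)) (g (X ∷ Y ∷ v)) (g (Y ∷ X ∷ v)) (θᵗ c (g ∘∷ X) v))) ⟩
  φᵗ (λ v → ½ * (g ∘∷ X ∘z) v + θᵗ c (g ∘∷ X) v + c * (len v * g (X ∷ Y ∷ v))) w
    ≡⟨ trans (linear-+ F _ _) (cong₂ _+_ (trans (linear-+ F _ _) (cong₂ _+_
         (trans (linear-* F ½ (g ∘∷ X ∘z)) (cong (½ *_) (φᵗ-z (g ∘∷ X) w))) (φᵗ-θᵗ c (g ∘∷ X) w)))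
         (trans (linear-* F c (λ v → len v * g (X ∷ Y ∷ v))) (cong (c *_) (trans (φᵗ-len (g ∘∷ X ∘∷ Y) w) (cong (len w *_) (φᵗ-y (g ∘∷ X) w)))))) ⟩
  ½ * h (X ∷ w) + θ′ᵗ c h w + c * (len w * - h (Y ∷ w))
    ≡⟨ cong (½ * h (X ∷ w) + θ′ᵗ c h w +_) (solve 3 (λ c l t → c :* (l :* :- t) := (:- (c :* l)) :* t) refl c (len w) (h (Y ∷ w))) ⟩
  Θ′ᵗ c h w ∎
  where
  open ≡-Reasoning
  F = fin-φᵗ w
  h = φᵗ (g ∘∷ X)

φᵗ-∂ᵗX : ∀ g w → φᵗ (∂ᵗ g ∘∷ X) w ≡ - φᵗ (g ∘∷ X) (Y ∷ w) + ∂′ᵗ (φᵗ (g ∘∷ X)) w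
φᵗ-∂ᵗX g w = trans (linear-ext (fin-φᵗ w) (∂ᵗ-X g))
  (trans (linear-+ (fin-φᵗ w) _ _) (cong₂ _+_ (φᵗ-y (g ∘∷ X) w) (φᵗ-∂ᵗ (g ∘∷ X) w)))

x^_·_ : ℕ → Word → Word
x^ zero  · w = w
x^ suc k · w = X ∷ x^ k · w

infixr 5 x^_·_

x^-X : ∀ k w → x^ k · X ∷ w ≡ X ∷ x^ k · w
x^-X zero    w = refl
x^-X (suc k) w = cong (X ∷_) (x^-X k w)

-- z_{k₁+1} ⋯ z_{kᵣ+1} x^j.
⟨_⟩x^_ : Index → ℕ → Word
⟨ [] ⟩x^ j     = x^ j · []
⟨ k ∷ v ⟩x^ j  = x^ k · Y ∷ ⟨ v ⟩x^ j

len-x^ : ∀ k w → len (x^ k · w) ≡ ι k + len w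
len-x^ zero    w = trans (sym (ℚₚ.+-identityˡ (len w))) (cong (_+ len w) (sym ι-0))
len-x^ (suc k) w = begin
  len (X ∷ x^ k · w)       ≡⟨ ι-suc (length (x^ k · w)) ⟩
  1ℚ + len (x^ k · w)      ≡⟨ cong (1ℚ +_) (len-x^ k w) ⟩
  1ℚ + (ι k + len w)       ≡⟨ sym (ℚₚ.+-assoc 1ℚ (ι k) (len w)) ⟩
  1ℚ + ι k + len w         ≡⟨ cong (_+ len w) (sym (ι-suc k)) ⟩
  ι (suc k) + len w        ∎
  where open ≡-Reasoning

len-⟨⟩ : ∀ v j → len (⟨ v ⟩x^ j) ≡ wt v + ι j
len-⟨⟩ []      j = trans (len-x^ j []) (trans (cong (ι j +_) ι-0) (ℚₚ.+-comm (ι j) 0ℚ))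
len-⟨⟩ (k ∷ v) j = begin
  len (x^ k · Y ∷ w)             ≡⟨ len-x^ k (Y ∷ w) ⟩
  ι k + len (Y ∷ w)              ≡⟨ cong (ι k +_) (trans (ι-suc (length w)) (cong (1ℚ +_) (len-⟨⟩ v j))) ⟩
  ι k + (1ℚ + (wt v + ι j))      ≡⟨ solve 3 (λ k v j → k :+ (con 1ℚ :+ (v :+ j)) := ((con 1ℚ :+ k) :+ v) :+ j) refl (ι k) (wt v) (ι j) ⟩
  ((1ℚ + ι k) + wt v) + ι j      ≡⟨ cong (λ t → (t + wt v) + ι j) (sym (ι-suc k)) ⟩
  wt (k ∷ v) + ι j               ∎
  where
  open ≡-Reasoning
  w = ⟨ v ⟩x^ j

∂′ᵗ-x^ : ∀ h k w → ∂′ᵗ h (x^ k · w) ≡ ∂′ᵗ (λ v → h (x^ k · v)) w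
∂′ᵗ-x^ h zero    w = refl
∂′ᵗ-x^ h (suc k) w = ∂′ᵗ-x^ (h ∘∷ X) k w

θ′ᵗ-x^ : ∀ c h k w → θ′ᵗ c h (x^ k · w) ≡ ι k * h (x^ suc k · w) + θ′ᵗ c (λ v → h (x^ k · v)) w
θ′ᵗ-x^ c h zero    w = trans (solve 2 (λ a b → a := con 0ℚ :* b :+ a) refl (θ′ᵗ c h w) (h (X ∷ w)))
  (cong (λ t → t * h (X ∷ w) + θ′ᵗ c h w) (sym ι-0))
θ′ᵗ-x^ c h (suc k) w = begin
  t + θ′ᵗ c (h ∘∷ X) (x^ k · w)    ≡⟨ cong (t +_) (θ′ᵗ-x^ c (h ∘∷ X) k w) ⟩
  t + (ι k * t + r)                ≡⟨ solve 3 (λ k t r → t :+ (k :* t :+ r) := (con 1ℚ :+ k) :* t :+ r) refl (ι k) t r ⟩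
  (1ℚ + ι k) * t + r               ≡⟨ cong (λ s → s * t + r) (sym (ι-suc k)) ⟩
  ι (suc k) * t + r                ∎
  where
  open ≡-Reasoning
  t = h (X ∷ X ∷ x^ k · w)
  r = θ′ᵗ c (λ v → h (X ∷ x^ k · v)) w

-- Replacing one y by -(xy + yy) either raises its letter, as a merge with z₁ does, or inserts z₁
-- behind it. The extra -y inserts z₁ in front, so that all terms of z₁ * v occur, each with sign
-- -1.
∂′ᵗ-⟨⟩ : ∀ h v j → - h (Y ∷ ⟨ v ⟩x^ j) + ∂′ᵗ h (⟨ v ⟩x^ j) ≡ - stuffle (λ u → h (⟨ u ⟩x^ j)) [ 0 ] v
∂′ᵗ-⟨⟩ h [] j = trans (cong (- h (Y ∷ x^ j · []) +_) (∂′ᵗ-x^ h j [])) (ℚₚ.+-identityʳ _)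
∂′ᵗ-⟨⟩ h (k ∷ v) j = begin
  - a + ∂′ᵗ h (x^ k · Y ∷ w)                       ≡⟨ cong (- a +_) (∂′ᵗ-x^ h k (Y ∷ w)) ⟩
  - a + (- (b + d) + e)                            ≡⟨ solve 4 (λ a b d e → :- a :+ (:- (b :+ d) :+ e) := :- a :+ :- b :+ (:- d :+ e)) refl a b d e ⟩
  - a + - b + (- d + e)                            ≡⟨ cong₂ (λ s t → - a + - s + t) b≡ (∂′ᵗ-⟨⟩ (λ u → h (x^ k · Y ∷ u)) v j) ⟩
  - a + - b′ + - s                                 ≡⟨ solve 3 (λ a b s → :- a :+ :- b :+ :- s := :- (a :+ s :+ b)) refl a b′ s ⟩
  - (a + s + b′)                                   ∎
  where
  open ≡-Reasoning
  w  = ⟨ v ⟩x^ j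
  a  = h (Y ∷ x^ k · Y ∷ w)
  b  = h (x^ k · X ∷ Y ∷ w)
  b′ = h (x^ suc k · Y ∷ w)
  d  = h (x^ k · Y ∷ Y ∷ w)
  e  = ∂′ᵗ (λ u → h (x^ k · Y ∷ u)) w
  s  = stuffle (λ u → h (x^ k · Y ∷ ⟨ u ⟩x^ j)) [ 0 ] v
  b≡ : b ≡ b′
  b≡ = cong h (x^-X k (Y ∷ w))

-- A half x travels along the word: x^k y receives ½ from its left, k from its own letters x and ½
-- from its y, in total k + 1, and passes the other half of its y to the right. At the end ½ arrives
-- and the tail adds j. The tail also adds j to all degrees, whence the multiple -c j of z₁ * v.
Θ′ᵗ-⟨⟩ : ∀ c h v j → Θ′ᵗ c h (⟨ v ⟩x^ j) ≡
  Δ c (λ u → h (⟨ u ⟩x^ j)) v + (½ + ι j) * h (⟨ v ⟩x^ suc j) + (- (c * ι j)) * stuffle (λ u → h (⟨ u ⟩x^ j)) [ 0 ] v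
Θ′ᵗ-⟨⟩ c h [] j = begin
  ½ * a + θ′ᵗ c h (x^ j · []) + (- (c * len (x^ j · []))) * b
    ≡⟨ cong₂ (λ s t → ½ * a + s + (- (c * t)) * b) (θ′ᵗ-x^ c h j []) (trans (len-⟨⟩ [] j) (ℚₚ.+-identityˡ (ι j))) ⟩
  ½ * a + (ι j * a + 0ℚ) + (- (c * ι j)) * b
    ≡⟨ solve 4 (λ c j a b → con ½ :* a :+ (j :* a :+ con 0ℚ) :+ (:- (c :* j)) :* b
         := con 0ℚ :+ (con ½ :+ j) :* a :+ (:- (c :* j)) :* b) refl c (ι j) a b ⟩
  0ℚ + (½ + ι j) * a + (- (c * ι j)) * b ∎
  where
  open ≡-Reasoning
  a = h (X ∷ x^ j · [])
  b = h (Y ∷ x^ j · [])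
Θ′ᵗ-⟨⟩ c h (k ∷ v) j = begin
  ½ * a + θ′ᵗ c h (x^ k · Y ∷ w) + (- (c * len (x^ k · Y ∷ w))) * b
    ≡⟨ cong₂ (λ s t → ½ * a + s + (- (c * t)) * b) (θ′ᵗ-x^ c h k (Y ∷ w)) (len-⟨⟩ (k ∷ v) j) ⟩
  ½ * a + (ι k * a + (½ * (h′ (X ∷ w) + h (x^ k · X ∷ Y ∷ w)) + θ′ᵗ c h′ w
    + (- (c * len w)) * (h (x^ k · X ∷ Y ∷ w) + h′ (Y ∷ w)))) + (- (c * (wt (k ∷ v) + ι j))) * b
    ≡⟨ cong₂ (λ s t → ½ * a + (ι k * a + (½ * (h′ (X ∷ w) + t) + θ′ᵗ c h′ w
         + (- (c * s)) * (t + h′ (Y ∷ w)))) + (- (c * (wt (k ∷ v) + ι j))) * b) (len-⟨⟩ v j) (cong h (x^-X k (Y ∷ w))) ⟩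
  ½ * a + (ι k * a + (½ * (h′ (X ∷ w) + a) + θ′ᵗ c h′ w
    + (- (c * (wt v + ι j))) * (a + h′ (Y ∷ w)))) + (- (c * (wt (k ∷ v) + ι j))) * b
    ≡⟨ solve 10 (λ c k v j a b p q r kv →
         con ½ :* a :+ (k :* a :+ (con ½ :* (p :+ a) :+ r :+ (:- (c :* (v :+ j))) :* (a :+ q))) :+ (:- (c :* (kv :+ j))) :* b
         := (con ½ :* p :+ r :+ (:- (c :* (v :+ j))) :* q) :+ ((con 1ℚ :+ k) :- c :* (v :+ j)) :* a :+ (:- (c :* (kv :+ j))) :* b)
         refl c (ι k) (wt v) (ι j) a b (h′ (X ∷ w)) (h′ (Y ∷ w)) (θ′ᵗ c h′ w) (wt (k ∷ v)) ⟩
  (½ * h′ (X ∷ w) + θ′ᵗ c h′ w + (- (c * (wt v + ι j))) * h′ (Y ∷ w)) + ((1ℚ + ι k) - c * (wt v + ι j)) * a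
    + (- (c * (wt (k ∷ v) + ι j))) * b
    ≡⟨ cong₂ (λ s t → s + (t - c * (wt v + ι j)) * a + (- (c * (wt (k ∷ v) + ι j))) * b)
         (trans (cong (λ t → ½ * h′ (X ∷ w) + θ′ᵗ c h′ w + (- (c * t)) * h′ (Y ∷ w)) (sym (len-⟨⟩ v j))) (Θ′ᵗ-⟨⟩ c h′ v j))
         (sym (ι-suc k)) ⟩
  (D + (½ + ι j) * h′ (⟨ v ⟩x^ suc j) + (- (c * ι j)) * S) + (ι (suc k) - c * (wt v + ι j)) * a + (- (c * (wt (k ∷ v) + ι j))) * b
    ≡⟨ solve 10 (λ c k v j a b kv D S t →
         (D :+ (con ½ :+ j) :* t :+ (:- (c :* j)) :* S) :+ (k :- c :* (v :+ j)) :* a :+ (:- (c :* (kv :+ j))) :* b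
         := (D :+ (k :- c :* v) :* a :+ (:- (c :* kv)) :* b) :+ (con ½ :+ j) :* t :+ (:- (c :* j)) :* (b :+ S :+ a))
         refl c (ι (suc k)) (wt v) (ι j) a b (wt (k ∷ v)) D S (h′ (⟨ v ⟩x^ suc j)) ⟩
  (D + (ι (suc k) - c * wt v) * a + (- (c * wt (k ∷ v))) * b) + (½ + ι j) * h′ (⟨ v ⟩x^ suc j) + (- (c * ι j)) * (b + S + a) ∎
  where
  open ≡-Reasoning
  w  = ⟨ v ⟩x^ j
  h′ = λ u → h (x^ k · Y ∷ u)
  a  = h (x^ suc k · Y ∷ w)
  b  = h (Y ∷ x^ k · Y ∷ w)
  D  = Δ c (λ u → h′ (⟨ u ⟩x^ j)) v
  S  = stuffle (λ u → h′ (⟨ u ⟩x^ j)) [ 0 ] v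

Δ^ : ℚ → ℕ → (Index → ℚ) → Index → ℚ
Δ^ c zero    g = g
Δ^ c (suc n) g = Δ^ c n (Δ c g)

fin-Δ^ : ∀ c n v → Finite (λ g → Δ^ c n g v)
fin-Δ^ c zero    v = fin-at v
fin-Δ^ c (suc n) v = fin-bind (fin-Δ^ c n v) (fin-Δ c)

-- The tail is a parameter because `Θ′ᵗ` lengthens it: the induction on n at j appeals to j + 1. The
-- conclusion is drawn at j = 0.
φx : (Word → ℚ) → ℕ → Index → ℚ
φx g j v = φᵗ (g ∘∷ X) (⟨ v ⟩x^ j)

-- ad(θ^(c))^n(∂₁)(x φ(v x^j)) = - x φ((Δ^n(z₁) * v) x^j).
adᵗ-stuffle : ∀ c n g v j → φx (adᵗ c n g) j v ≡ - Δ^ c n (λ u → stuffle (φx g j) u v) [ 0 ]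
adᵗ-stuffle c zero    g v j = trans (φᵗ-∂ᵗX g (⟨ v ⟩x^ j)) (∂′ᵗ-⟨⟩ (φᵗ (g ∘∷ X)) v j)
adᵗ-stuffle c (suc n) g v j = begin
  φx (adᵗ c (suc n) g) j v
    ≡⟨ linear-ext F (λ w → adᵗ-θ̃ c n g (X ∷ w)) ⟩
  φᵗ (λ w → adᵗ c n (θ̃ᵗ c g) (X ∷ w) - θ̃ᵗ c (adᵗ c n g) (X ∷ w)) (⟨ v ⟩x^ j)
    ≡⟨ linear-sub F (adᵗ c n (θ̃ᵗ c g) ∘∷ X) (θ̃ᵗ c (adᵗ c n g) ∘∷ X) ⟩
  φx (adᵗ c n (θ̃ᵗ c g)) j v - φx (θ̃ᵗ c (adᵗ c n g)) j v
    ≡⟨ cong₂ _-_ (trans (adᵗ-stuffle c n (θ̃ᵗ c g) v j) (cong -_ first)) second ⟩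
  -- `E` is the part where `Δ` hits v, `A` comes from lengthening the tail, and `B` from multiplying
  -- by z₁. All three occur in both orders of composition, which leaves `Δ` applied to Δ^n(z₁).
  - (U (Δ c s) + E + (½ + ι j) * A + (- (c * ι j)) * B) - (- E + (½ + ι j) * - A + (- (c * ι j)) * - B)
    ≡⟨ solve 6 (λ c j d e a b → :- (d :+ e :+ (con ½ :+ j) :* a :+ (:- (c :* j)) :* b) :- (:- e :+ (con ½ :+ j) :* :- a :+ (:- (c :* j)) :* :- b)
         := :- d) refl c (ι j) (U (Δ c s)) E A B ⟩
  - U (Δ c s) ∎
  where
  open ≡-Reasoning
  F = fin-φᵗ (⟨ v ⟩x^ j)
  U : (Index → ℚ) → ℚ
  U t = Δ^ c n t [ 0 ]
  fU = fin-Δ^ c n [ 0 ]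
  s : Index → ℚ
  s u = stuffle (φx g j) u v
  E = U (λ u → Δ c (λ w → stuffle (φx g j) u w) v)
  A = U (λ u → stuffle (φx g (suc j)) u v)
  B = U (λ u → stuffle (λ w → stuffle (φx g j) u w) [ 0 ] v)

  φx-θ̃ : ∀ g v j → φx (θ̃ᵗ c g) j v ≡ Δ c (φx g j) v + (½ + ι j) * φx g (suc j) v + (- (c * ι j)) * stuffle (φx g j) [ 0 ] v
  φx-θ̃ g v j = trans (φᵗ-θ̃ᵗ c g (⟨ v ⟩x^ j)) (Θ′ᵗ-⟨⟩ c (φᵗ (g ∘∷ X)) v j)

  first : U (λ u → stuffle (φx (θ̃ᵗ c g) j) u v) ≡ U (Δ c s) + E + (½ + ι j) * A + (- (c * ι j)) * B
  first = begin
    U (λ u → stuffle (φx (θ̃ᵗ c g) j) u v)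
      ≡⟨ linear-ext fU (λ u → let S = fin-stuffle u v in begin
           stuffle (φx (θ̃ᵗ c g) j) u v
             ≡⟨ linear-ext S (λ w → φx-θ̃ g w j) ⟩
           stuffle (λ w → Δ c (φx g j) w + (½ + ι j) * φx g (suc j) w + (- (c * ι j)) * stuffle (φx g j) [ 0 ] w) u v
             ≡⟨ trans (linear-+ S _ _) (cong₂ _+_ (trans (linear-+ S _ _) (cong₂ _+_ (Δ-stuffle c (φx g j) u v) (linear-* S (½ + ι j) (φx g (suc j)))))
                  (trans (linear-* S (- (c * ι j)) (stuffle (φx g j) [ 0 ])) (cong ((- (c * ι j)) *_) (z₁-stuffle (φx g j) u v)))) ⟩
           Δ c s u + Δ c (λ w → stuffle (φx g j) u w) v + (½ + ι j) * stuffle (φx g (suc j)) u v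
             + (- (c * ι j)) * stuffle (λ w → stuffle (φx g j) u w) [ 0 ] v ∎) ⟩
    U (λ u → Δ c s u + Δ c (λ w → stuffle (φx g j) u w) v + (½ + ι j) * stuffle (φx g (suc j)) u v
             + (- (c * ι j)) * stuffle (λ w → stuffle (φx g j) u w) [ 0 ] v)
      ≡⟨ trans (linear-+ fU _ _) (cong₂ _+_ (trans (linear-+ fU _ _) (cong₂ _+_ (linear-+ fU (Δ c s) _) (linear-* fU (½ + ι j) (λ u → stuffle (φx g (suc j)) u v))))
           (linear-* fU (- (c * ι j)) (λ u → stuffle (λ w → stuffle (φx g j) u w) [ 0 ] v))) ⟩
    U (Δ c s) + E + (½ + ι j) * A + (- (c * ι j)) * B ∎

  second : φx (θ̃ᵗ c (adᵗ c n g)) j v ≡ - E + (½ + ι j) * - A + (- (c * ι j)) * - B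
  second = begin
    φx (θ̃ᵗ c (adᵗ c n g)) j v
      ≡⟨ φx-θ̃ (adᵗ c n g) v j ⟩
    Δ c (φx (adᵗ c n g) j) v + (½ + ι j) * φx (adᵗ c n g) (suc j) v + (- (c * ι j)) * stuffle (φx (adᵗ c n g) j) [ 0 ] v
      ≡⟨ cong₂ _+_ (cong₂ _+_ (through (fin-Δ c v)) (cong ((½ + ι j) *_) (adᵗ-stuffle c n g v (suc j))))
           (cong ((- (c * ι j)) *_) (through (fin-stuffle [ 0 ] v))) ⟩
    - E + (½ + ι j) * - A + (- (c * ι j)) * - B ∎
    where
    -- `G` acts on the right factor and `U` on the left one, so they can be exchanged.
    through : ∀ {G} → Finite G → G (φx (adᵗ c n g) j) ≡ - U (λ u → G (λ w → stuffle (φx g j) u w))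
    through {G} fG = trans (linear-ext fG (λ w → adᵗ-stuffle c n g w j))
      (trans (linear-neg fG (λ w → U (λ u → stuffle (φx g j) u w))) (cong -_ (linear-swap fG fU (λ w u → stuffle (φx g j) u w))))

-- Normalised differences

∑ : ℕ → (ℕ → ℚ) → ℚ
∑ zero    f = 0ℚ
∑ (suc n) f = ∑ n f + f n

fin-∑ : ∀ n → Finite (∑ n)
fin-∑ zero    = fin-0
fin-∑ (suc n) = fin-+ (fin-∑ n) (fin-at n)

∑-head : ∀ n f → ∑ (suc n) f ≡ f 0 + ∑ n (λ i → f (suc i))
∑-head zero    f = ℚₚ.+-comm 0ℚ (f 0)
∑-head (suc n) f = trans (cong (_+ f (suc n)) (∑-head n f)) (ℚₚ.+-assoc (f 0) (∑ n (λ i → f (suc i))) (f (suc n)))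

∑-cong< : ∀ n {f g} → (∀ i → i ℕ.< n → f i ≡ g i) → ∑ n f ≡ ∑ n g
∑-cong< zero    f≡g = refl
∑-cong< (suc n) f≡g = cong₂ _+_ (∑-cong< n (λ i i<n → f≡g i (ℕₚ.m<n⇒m<1+n i<n))) (f≡g n ℕₚ.≤-refl)

rec*ι : ∀ m a → rec m * (ι (suc m) * a) ≡ a
rec*ι m a = begin
  rec m * (ι (suc m) * a)    ≡⟨ solve 3 (λ r i a → r :* (i :* a) := (i :* r) :* a) refl (rec m) (ι (suc m)) a ⟩
  (ι (suc m) * rec m) * a    ≡⟨ cong (_* a) (ι*rec m) ⟩
  1ℚ * a                     ≡⟨ ℚₚ.*-identityˡ a ⟩
  a                          ∎
  where open ≡-Reasoning

ι*rec* : ∀ m a → ι (suc m) * (rec m * a) ≡ a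
ι*rec* m a = trans (solve 3 (λ r i a → i :* (r :* a) := r :* (i :* a)) refl (rec m) (ι (suc m)) a) (rec*ι m a)

ι-cancel : ∀ m {a b} → ι (suc m) * a ≡ ι (suc m) * b → a ≡ b
ι-cancel m {a} {b} eq = trans (sym (rec*ι m a)) (trans (cong (rec m *_) eq) (rec*ι m b))

-- binom(i+m, m) (-1)^m (Δᵐ f)(i); with this normalisation no binomial
-- coefficient occurs in any of the identities below.
diff : (ℕ → ℚ) → ℕ → ℕ → ℚ
diff f i zero    = f i
diff f i (suc m) = rec m * (ι (suc (i ℕ.+ m)) * diff f i m - ι (suc i) * diff f (suc i) m)

fin-diff : ∀ i m → Finite (λ f → diff f i m)
fin-diff i zero    = fin-at i
fin-diff i (suc m) = fin-* (rec m) (fin-+ (fin-* (ι (suc (i ℕ.+ m))) (fin-diff i m))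
  (fin-neg (fin-* (ι (suc i)) (fin-diff (suc i) m))))

diff-suc : ∀ f i m → ι (suc m) * diff f i (suc m) ≡ ι (suc (i ℕ.+ m)) * diff f i m - ι (suc i) * diff f (suc i) m
diff-suc f i m = ι*rec* m _

ι-suc-+ : ∀ i m → ι (suc (i ℕ.+ m)) ≡ 1ℚ + (ι i + ι m)
ι-suc-+ i m = trans (ι-suc (i ℕ.+ m)) (cong (1ℚ +_) (ι-+ i m))

-- Telescoping: by `diff-suc`, (i + 1) times the difference of the l-th terms for i and i + 1 is (l
-- + 1) d_{l+1} - l d_l, where d_l is the normalised difference of order l at i.
∑-diff : ∀ f i s → ι (suc i) * ∑ s (diff f (suc i)) ≡ ι (suc i) * ∑ s (diff f i) - ι s * diff f i s
∑-diff f i zero = trans (solve 2 (λ i d → i :* con 0ℚ := i :* con 0ℚ :- con 0ℚ :* d) refl (ι (suc i)) (f i))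
  (cong (λ t → ι (suc i) * 0ℚ - t * f i) (sym ι-0))
∑-diff f i (suc s) = begin
  i′ * (S′ + d′)                             ≡⟨ ℚₚ.*-distribˡ-+ i′ S′ d′ ⟩
  i′ * S′ + i′ * d′                          ≡⟨ cong₂ _+_ (∑-diff f i s) (solve 2 (λ a b → b := a :- (a :- b)) refl (ι (suc (i ℕ.+ s)) * d) (i′ * d′)) ⟩
  (i′ * S - ι s * d) + (ι (suc (i ℕ.+ s)) * d - (ι (suc (i ℕ.+ s)) * d - i′ * d′))
    ≡⟨ cong₂ (λ u v → (i′ * S - ι s * d) + (u * d - v)) (ι-+ (suc i) s) (sym (diff-suc f i s)) ⟩
  (i′ * S - ι s * d) + ((i′ + ι s) * d - ι (suc s) * e)
    ≡⟨ solve 5 (λ i s S d e → (i :* S :- s :* d) :+ ((i :+ s) :* d :- e) := i :* (S :+ d) :- e) refl i′ (ι s) S d (ι (suc s) * e) ⟩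
  i′ * (S + d) - ι (suc s) * e               ∎
  where
  open ≡-Reasoning
  i′ = ι (suc i)
  S  = ∑ s (diff f i)
  S′ = ∑ s (diff f (suc i))
  d  = diff f i s
  d′ = diff f (suc i) s
  e  = diff f i (suc s)

-- If f(i+1) - f(i) = g(i) / (i+1), then the normalised differences of f are
-- averages of those of g.
diff-average : ∀ f g → (∀ i → ι (suc i) * (f (suc i) - f i) ≡ g i) →
               ∀ m i → ι (suc m) * diff f i (suc m) ≡ - ∑ (suc m) (diff g i)
diff-average f g step zero i = begin
  ι 1 * diff f i 1                               ≡⟨ diff-suc f i 0 ⟩
  ι (suc (i ℕ.+ 0)) * f i - ι (suc i) * f (suc i)
    ≡⟨ cong (λ t → ι (suc t) * f i - ι (suc i) * f (suc i)) (ℕₚ.+-identityʳ i) ⟩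
  ι (suc i) * f i - ι (suc i) * f (suc i)        ≡⟨ solve 3 (λ i a b → i :* a :- i :* b := :- (con 0ℚ :+ i :* (b :- a))) refl (ι (suc i)) (f i) (f (suc i)) ⟩
  - (0ℚ + ι (suc i) * (f (suc i) - f i))         ≡⟨ cong (λ t → - (0ℚ + t)) (step i) ⟩
  - (0ℚ + g i)                                   ∎
  where open ≡-Reasoning
diff-average f g step (suc m) i = ι-cancel m (begin
  s * (ι (suc (suc m)) * diff f i (suc (suc m)))
    ≡⟨ cong (s *_) (diff-suc f i (suc m)) ⟩
  s * (ι (suc (i ℕ.+ suc m)) * d - i′ * d′)
    ≡⟨ solve 5 (λ s k d i e → s :* (k :* d :- i :* e) := k :* (s :* d) :- i :* (s :* e)) refl s (ι (suc (i ℕ.+ suc m))) d i′ d′ ⟩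
  ι (suc (i ℕ.+ suc m)) * (s * d) - i′ * (s * d′)
    ≡⟨ cong₂ (λ u v → ι (suc (i ℕ.+ suc m)) * u - i′ * v) (diff-average f g step m i) (diff-average f g step m (suc i)) ⟩
  ι (suc (i ℕ.+ suc m)) * - S - i′ * - S′
    ≡⟨ solve 4 (λ k S i T → k :* :- S :- i :* :- T := i :* T :- k :* S) refl (ι (suc (i ℕ.+ suc m))) S i′ S′ ⟩
  i′ * S′ - ι (suc (i ℕ.+ suc m)) * S
    ≡⟨ cong₂ (λ u v → u - v * S) (∑-diff g i (suc m)) (ι-+ (suc i) (suc m)) ⟩
  (i′ * S - s * e) - (i′ + s) * S
    ≡⟨ solve 4 (λ i S s e → (i :* S :- s :* e) :- (i :+ s) :* S := s :* :- (S :+ e)) refl i′ S s e ⟩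
  s * - (S + e) ∎)
  where
  open ≡-Reasoning
  s  = ι (suc m)
  i′ = ι (suc i)
  d  = diff f i (suc m)
  d′ = diff f (suc i) (suc m)
  S  = ∑ (suc m) (diff g i)
  S′ = ∑ (suc m) (diff g (suc i))
  e  = diff g i (suc m)

-- Both sides are multiples of the (m + 1)-st difference of f at i; the outer factors reconcile the
-- two binomial coefficients.
diff-Δ : ∀ f m i → ι (suc (i ℕ.+ m)) * diff (λ n → f (suc n) - f n) i m ≡ - (ι (suc m) * diff f i (suc m))
diff-Δ f zero i = begin
  ι (suc (i ℕ.+ 0)) * (f (suc i) - f i)             ≡⟨ cong (λ t → ι (suc t) * (f (suc i) - f i)) (ℕₚ.+-identityʳ i) ⟩
  ι (suc i) * (f (suc i) - f i)                     ≡⟨ solve 3 (λ i a b → i :* (b :- a) := :- (i :* a :- i :* b)) refl (ι (suc i)) (f i) (f (suc i)) ⟩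
  - (ι (suc i) * f i - ι (suc i) * f (suc i))       ≡⟨ cong (λ t → - (ι (suc t) * f i - ι (suc i) * f (suc i))) (sym (ℕₚ.+-identityʳ i)) ⟩
  - (ι (suc (i ℕ.+ 0)) * f i - ι (suc i) * f (suc i)) ≡⟨ cong -_ (sym (diff-suc f i 0)) ⟩
  - (ι 1 * diff f i 1)                              ∎
  where open ≡-Reasoning
diff-Δ f (suc m) i = ι-cancel m (begin
  s * (k * diff g i (suc m))
    ≡⟨ solve 3 (λ s k d → s :* (k :* d) := k :* (s :* d)) refl s k (diff g i (suc m)) ⟩
  k * (s * diff g i (suc m))
    ≡⟨ cong (k *_) (diff-suc g i m) ⟩
  k * (ι (suc (i ℕ.+ m)) * diff g i m - i′ * diff g (suc i) m)
    ≡⟨ solve 4 (λ k a i d → k :* (a :- i :* d) := k :* a :- i :* (k :* d)) refl k (ι (suc (i ℕ.+ m)) * diff g i m) i′ (diff g (suc i) m) ⟩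
  k * (ι (suc (i ℕ.+ m)) * diff g i m) - i′ * (k * diff g (suc i) m)
    ≡⟨ cong₂ (λ u v → k * u - i′ * v) (diff-Δ f m i)
         (trans (cong (λ t → ι (suc t) * diff g (suc i) m) (ℕₚ.+-suc i m)) (diff-Δ f m (suc i))) ⟩
  k * - (s * diff f i (suc m)) - i′ * - (s * diff f (suc i) (suc m))
    ≡⟨ solve 5 (λ k s a i b → k :* :- (s :* a) :- i :* :- (s :* b) := s :* :- (k :* a :- i :* b)) refl k s (diff f i (suc m)) i′ (diff f (suc i) (suc m)) ⟩
  s * - (k * diff f i (suc m) - i′ * diff f (suc i) (suc m))
    ≡⟨ cong (λ t → s * - t) (sym (diff-suc f i (suc m))) ⟩
  s * - (ι (suc (suc m)) * diff f i (suc (suc m))) ∎)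
  where
  open ≡-Reasoning
  g  = λ n → f (suc n) - f n
  s  = ι (suc m)
  k  = ι (suc (i ℕ.+ suc m))
  i′ = ι (suc i)

-- Σ_{j+l=m} F j l.
∑split : ℕ → (ℕ → ℕ → ℚ) → ℚ
∑split zero    F = F 0 0
∑split (suc m) F = F 0 (suc m) + ∑split m (λ j → F (suc j))

∑split-ext : ∀ m {F G} → (∀ j l → F j l ≡ G j l) → ∑split m F ≡ ∑split m G
∑split-ext zero    F≡G = F≡G 0 0
∑split-ext (suc m) F≡G = cong₂ _+_ (F≡G 0 (suc m)) (∑split-ext m (λ j → F≡G (suc j)))

∑split-+ : ∀ m F G → ∑split m (λ j l → F j l + G j l) ≡ ∑split m F + ∑split m G
∑split-+ zero    F G = refl
∑split-+ (suc m) F G = trans (cong (F 0 (suc m) + G 0 (suc m) +_) (∑split-+ m (λ j → F (suc j)) (λ j → G (suc j))))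
  (solve 4 (λ a b c d → (a :+ b) :+ (c :+ d) := (a :+ c) :+ (b :+ d)) refl (F 0 (suc m)) (G 0 (suc m)) _ _)

∑split-* : ∀ m q F → ∑split m (λ j l → q * F j l) ≡ q * ∑split m F
∑split-* zero    q F = refl
∑split-* (suc m) q F = trans (cong (q * F 0 (suc m) +_) (∑split-* m q (λ j → F (suc j)))) (sym (ℚₚ.*-distribˡ-+ q _ _))

∑split-last : ∀ m F → ∑split (suc m) F ≡ ∑split m (λ j l → F j (suc l)) + F (suc m) 0
∑split-last zero    F = refl
∑split-last (suc m) F = trans (cong (F 0 (suc (suc m)) +_) (∑split-last m (λ j → F (suc j)))) (sym (ℚₚ.+-assoc (F 0 (suc (suc m))) (∑split m (λ j l → F (suc j) (suc l))) (F (suc (suc m)) 0)))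

∑split-weight : ∀ m F → ∑split m (λ j l → (ι j + ι l) * F j l) ≡ ι m * ∑split m F
∑split-weight zero    F = cong (_* F 0 0) (trans (cong (_+ ι 0) ι-0) (ℚₚ.+-identityˡ (ι 0)))
∑split-weight (suc m) F = begin
  (ι 0 + ι (suc m)) * a + ∑split m (λ j l → (ι (suc j) + ι l) * F (suc j) l)
    ≡⟨ cong₂ _+_ (cong (λ t → (t + ι (suc m)) * a) ι-0)
         (∑split-ext m (λ j l → trans (cong (λ t → (t + ι l) * F (suc j) l) (ι-suc j))
           (solve 3 (λ j l f → (con 1ℚ :+ j :+ l) :* f := f :+ (j :+ l) :* f) refl (ι j) (ι l) (F (suc j) l)))) ⟩
  (0ℚ + ι (suc m)) * a + ∑split m (λ j l → F (suc j) l + (ι j + ι l) * F (suc j) l)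
    ≡⟨ cong ((0ℚ + ι (suc m)) * a +_) (trans (∑split-+ m _ _) (cong (S +_) (∑split-weight m (λ j → F (suc j))))) ⟩
  (0ℚ + ι (suc m)) * a + (S + ι m * S)
    ≡⟨ cong ((0ℚ + ι (suc m)) * a +_) (trans (solve 2 (λ m s → s :+ m :* s := (con 1ℚ :+ m) :* s) refl (ι m) S) (cong (_* S) (sym (ι-suc m)))) ⟩
  (0ℚ + ι (suc m)) * a + ι (suc m) * S
    ≡⟨ solve 3 (λ m a s → (con 0ℚ :+ m) :* a :+ m :* s := m :* (a :+ s)) refl (ι (suc m)) a S ⟩
  ι (suc m) * (a + S) ∎
  where
  open ≡-Reasoning
  a = F 0 (suc m)
  S = ∑split m (λ j → F (suc j))

∑split≡∑ : ∀ m F → ∑split m F ≡ ∑ (suc m) (λ j → F j (m ℕ.∸ j))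
∑split≡∑ zero    F = sym (ℚₚ.+-identityˡ (F 0 0))
∑split≡∑ (suc m) F = trans (cong (F 0 (suc m) +_) (∑split≡∑ m (λ j → F (suc j))))
  (sym (∑-head (suc m) (λ j → F j (suc m ℕ.∸ j))))

-- The Leibniz rule for differences. Its binomial is absorbed since, for j + l = m, binom(i+m, m)
-- binom(m, j) = binom(i+j+l, l) binom(i+j, j).
diff-product : ∀ f g m i → diff (λ n → f n * g n) i m ≡ ∑split m (λ j l → diff f (j ℕ.+ i) l * diff g i j)
diff-product f g zero    i = refl
diff-product f g (suc m) i = ι-cancel m (begin
  ι (suc m) * diff h i (suc m)
    ≡⟨ diff-suc h i m ⟩
  ι (suc (i ℕ.+ m)) * diff h i m - i′ * diff h (suc i) m
    ≡⟨ cong₂ (λ u v → ι (suc (i ℕ.+ m)) * u - i′ * v) (diff-product f g m i) (diff-product f g m (suc i)) ⟩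
  ι (suc (i ℕ.+ m)) * ∑split m (λ j l → A j l) - i′ * ∑split m (λ j l → diff f (j ℕ.+ suc i) l * diff g (suc i) j)
    ≡⟨ cong₂ _-_ weigh (trans (sym (∑split-* m i′ _)) (∑split-ext m lower)) ⟩
  ∑split m (λ j l → (ι (suc i) + (ι j + ι l)) * A j l) - ∑split m B
    ≡⟨ solve 2 (λ a b → a :- b := a :+ con (- 1ℚ) :* b) refl (∑split m (λ j l → (ι (suc i) + (ι j + ι l)) * A j l)) (∑split m B) ⟩
  ∑split m (λ j l → (ι (suc i) + (ι j + ι l)) * A j l) + (- 1ℚ) * ∑split m B
    ≡⟨ trans (cong (∑split m (λ j l → (ι (suc i) + (ι j + ι l)) * A j l) +_) (sym (∑split-* m (- 1ℚ) B))) (sym (∑split-+ m _ _)) ⟩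
  ∑split m (λ j l → (ι (suc i) + (ι j + ι l)) * A j l + (- 1ℚ) * B j l)
    ≡⟨ ∑split-ext m term ⟩
  ∑split m (λ j l → ι (suc l) * A j (suc l) + ι (suc j) * A (suc j) l)
    ≡⟨ ∑split-+ m _ _ ⟩
  ∑split m (λ j l → ι (suc l) * A j (suc l)) + ∑split m (λ j l → ι (suc j) * A (suc j) l)
    -- The added terms have weight `ι 0`; they complete both sums to the range j + l = m + 1.
    ≡⟨ cong₂ _+_ (addlast (∑split m (λ j l → ι (suc l) * A j (suc l))) (A (suc m) 0))
                 (addfirst (∑split m (λ j l → ι (suc j) * A (suc j) l)) (A 0 (suc m))) ⟩
  (∑split m (λ j l → ι (suc l) * A j (suc l)) + ι 0 * A (suc m) 0) + (ι 0 * A 0 (suc m) + ∑split m (λ j l → ι (suc j) * A (suc j) l))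
    ≡⟨ cong (_+ (ι 0 * A 0 (suc m) + ∑split m (λ j l → ι (suc j) * A (suc j) l))) (sym (∑split-last m (λ j l → ι l * A j l))) ⟩
  ∑split (suc m) (λ j l → ι l * A j l) + ∑split (suc m) (λ j l → ι j * A j l)
    ≡⟨ sym (∑split-+ (suc m) (λ j l → ι l * A j l) (λ j l → ι j * A j l)) ⟩
  ∑split (suc m) (λ j l → ι l * A j l + ι j * A j l)
    ≡⟨ ∑split-ext (suc m) (λ j l → solve 3 (λ l j a → l :* a :+ j :* a := (j :+ l) :* a) refl (ι l) (ι j) (A j l)) ⟩
  ∑split (suc m) (λ j l → (ι j + ι l) * A j l)
    ≡⟨ ∑split-weight (suc m) A ⟩
  ι (suc m) * ∑split (suc m) A ∎)
  where
  open ≡-Reasoning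
  h  = λ n → f n * g n
  i′ = ι (suc i)
  A : ℕ → ℕ → ℚ
  A j l = diff f (j ℕ.+ i) l * diff g i j
  B : ℕ → ℕ → ℚ
  B j l = diff f (suc (j ℕ.+ i)) l * (ι (suc (i ℕ.+ j)) * diff g i j - ι (suc j) * diff g i (suc j))
  addlast : ∀ s a → s ≡ s + ι 0 * a
  addlast s a = trans (solve 2 (λ s a → s := s :+ con 0ℚ :* a) refl s a) (cong (λ t → s + t * a) (sym ι-0))
  addfirst : ∀ s a → s ≡ ι 0 * a + s
  addfirst s a = trans (addlast s a) (ℚₚ.+-comm s (ι 0 * a))
  weigh : ι (suc (i ℕ.+ m)) * ∑split m A ≡ ∑split m (λ j l → (ι (suc i) + (ι j + ι l)) * A j l)
  weigh = begin
    ι (suc (i ℕ.+ m)) * ∑split m A             ≡⟨ cong (_* ∑split m A) (ι-+ (suc i) m) ⟩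
    (i′ + ι m) * ∑split m A                    ≡⟨ ℚₚ.*-distribʳ-+ (∑split m A) i′ (ι m) ⟩
    i′ * ∑split m A + ι m * ∑split m A         ≡⟨ cong₂ _+_ (sym (∑split-* m i′ A)) (sym (∑split-weight m A)) ⟩
    ∑split m (λ j l → i′ * A j l) + ∑split m (λ j l → (ι j + ι l) * A j l) ≡⟨ sym (∑split-+ m _ _) ⟩
    ∑split m (λ j l → i′ * A j l + (ι j + ι l) * A j l)
      ≡⟨ ∑split-ext m (λ j l → sym (ℚₚ.*-distribʳ-+ (A j l) i′ (ι j + ι l))) ⟩
    ∑split m (λ j l → (i′ + (ι j + ι l)) * A j l) ∎
  lower : ∀ j l → i′ * (diff f (j ℕ.+ suc i) l * diff g (suc i) j) ≡ B j l
  lower j l = begin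
    i′ * (diff f (j ℕ.+ suc i) l * d′)    ≡⟨ cong (λ t → i′ * (diff f t l * d′)) (ℕₚ.+-suc j i) ⟩
    i′ * (F * d′)                         ≡⟨ solve 4 (λ i f d k → i :* (f :* d) := f :* (k :- (k :- i :* d))) refl i′ F d′ (ι (suc (i ℕ.+ j)) * diff g i j) ⟩
    F * (ι (suc (i ℕ.+ j)) * diff g i j - (ι (suc (i ℕ.+ j)) * diff g i j - i′ * d′))
      ≡⟨ cong (λ t → F * (ι (suc (i ℕ.+ j)) * diff g i j - t)) (sym (diff-suc g i j)) ⟩
    B j l ∎
    where
    F  = diff f (suc (j ℕ.+ i)) l
    d′ = diff g (suc i) j
  term : ∀ j l → (i′ + (ι j + ι l)) * A j l + (- 1ℚ) * B j l ≡ ι (suc l) * A j (suc l) + ι (suc j) * A (suc j) l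
  term j l = begin
    (i′ + (ι j + ι l)) * (F * G) + (- 1ℚ) * (F′ * (ι (suc (i ℕ.+ j)) * G - ι (suc j) * G′))
      ≡⟨ cong (λ t → (i′ + (ι j + ι l)) * (F * G) + (- 1ℚ) * (F′ * (t * G - ι (suc j) * G′))) (cong ι (cong suc (ℕₚ.+-comm i j))) ⟩
    (i′ + (ι j + ι l)) * (F * G) + (- 1ℚ) * (F′ * (ι (suc (j ℕ.+ i)) * G - ι (suc j) * G′))
      ≡⟨ solve 9 (λ i j l F G H k J K →
           (i :+ (j :+ l)) :* (F :* G) :+ con (- 1ℚ) :* (H :* (k :* G :- J :* K))
           := ((i :+ (j :+ l)) :* F :- k :* H) :* G :+ J :* (H :* K)) refl i′ (ι j) (ι l) F G F′ (ι (suc (j ℕ.+ i))) (ι (suc j)) G′ ⟩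
    ((i′ + (ι j + ι l)) * F - ι (suc (j ℕ.+ i)) * F′) * G + ι (suc j) * (F′ * G′)
      ≡⟨ cong (λ t → (t * F - ι (suc (j ℕ.+ i)) * F′) * G + ι (suc j) * (F′ * G′)) (sym idx) ⟩
    (ι (suc (j ℕ.+ i ℕ.+ l)) * F - ι (suc (j ℕ.+ i)) * F′) * G + ι (suc j) * (F′ * G′)
      ≡⟨ cong (λ t → t * G + ι (suc j) * (F′ * G′)) (sym (diff-suc f (j ℕ.+ i) l)) ⟩
    (ι (suc l) * diff f (j ℕ.+ i) (suc l)) * G + ι (suc j) * (F′ * G′)
      ≡⟨ cong (_+ ι (suc j) * (F′ * G′)) (ℚₚ.*-assoc (ι (suc l)) (diff f (j ℕ.+ i) (suc l)) G) ⟩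
    ι (suc l) * (diff f (j ℕ.+ i) (suc l) * G) + ι (suc j) * (F′ * G′) ∎
    where
    F  = diff f (j ℕ.+ i) l
    F′ = diff f (suc (j ℕ.+ i)) l
    G  = diff g i j
    G′ = diff g i (suc j)
    idx : ι (suc (j ℕ.+ i ℕ.+ l)) ≡ i′ + (ι j + ι l)
    idx = begin
      ι (suc (j ℕ.+ i ℕ.+ l))     ≡⟨ ι-suc-+ (j ℕ.+ i) l ⟩
      1ℚ + (ι (j ℕ.+ i) + ι l)    ≡⟨ cong (λ t → 1ℚ + (t + ι l)) (ι-+ j i) ⟩
      1ℚ + (ι j + ι i + ι l)      ≡⟨ solve 3 (λ j i l → con 1ℚ :+ (j :+ i :+ l) := (con 1ℚ :+ i) :+ (j :+ l)) refl (ι j) (ι i) (ι l) ⟩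
      (1ℚ + ι i) + (ι j + ι l)    ≡⟨ cong (_+ (ι j + ι l)) (sym (ι-suc i)) ⟩
      i′ + (ι j + ι l)            ∎

-- The derivative at 0, up to sign, of the polynomial of degree ≤ N
-- interpolating f at 0, …, N.
deriv : ℕ → (ℕ → ℚ) → ℚ
deriv N f = ∑ N (λ n → rec n * diff f 0 (suc n))

fin-deriv : ∀ N → Finite (deriv N)
fin-deriv N = fin-bind (fin-∑ N) (λ n → fin-* (rec n) (fin-diff 0 (suc n)))

-- For f(n) = t^n this is the Bernstein polynomial binom(N, i) t^i (1 - t)^(N - i), so linear
-- identities between Bernstein polynomials carry over to arbitrary f.
antidiag : (ℕ → ℚ) → ℕ → ℕ → ℚ
antidiag f N i = diff f i (N ℕ.∸ i)

-- Degree elevation of Bernstein polynomials.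
antidiag-elevate : ∀ f N i → i ℕ.≤ N → ι (suc N) * antidiag f N i ≡
  (ι (suc N) - ι i) * antidiag f (suc N) i + ι (suc i) * antidiag f (suc N) (suc i)
antidiag-elevate f N i i≤N = begin
  ι (suc N) * d                                   ≡⟨ solve 3 (λ n d e → n :* d := (n :* d :- e) :+ e) refl (ι (suc N)) d (ι (suc i) * d′) ⟩
  (ι (suc N) * d - ι (suc i) * d′) + ι (suc i) * d′
    ≡⟨ cong (λ t → (ι (suc t) * d - ι (suc i) * d′) + ι (suc i) * d′) (sym (ℕₚ.m+[n∸m]≡n i≤N)) ⟩
  (ι (suc (i ℕ.+ l)) * d - ι (suc i) * d′) + ι (suc i) * d′
    ≡⟨ cong (_+ ι (suc i) * d′) (sym (diff-suc f i l)) ⟩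
  ι (suc l) * diff f i (suc l) + ι (suc i) * d′
    ≡⟨ cong₂ (λ u v → u * diff f i v + ι (suc i) * d′) idx (sym (ℕₚ.+-∸-assoc 1 i≤N)) ⟩
  (ι (suc N) - ι i) * antidiag f (suc N) i + ι (suc i) * d′ ∎
  where
  open ≡-Reasoning
  l  = N ℕ.∸ i
  d  = diff f i l
  d′ = diff f (suc i) l
  idx : ι (suc l) ≡ ι (suc N) - ι i
  idx = begin
    ι (suc l)                  ≡⟨ solve 2 (λ l i → l := (l :+ i) :- i) refl (ι (suc l)) (ι i) ⟩
    (ι (suc l) + ι i) - ι i    ≡⟨ cong (_- ι i) (sym (ι-+ (suc l) i)) ⟩
    ι (suc (l ℕ.+ i)) - ι i    ≡⟨ cong (λ t → ι (suc t) - ι i) (ℕₚ.m∸n+n≡m i≤N) ⟩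
    ι (suc N) - ι i            ∎

-- Summed over the first j entries, degree elevation telescopes up to one boundary term.
∑-antidiag : ∀ f N j → j ℕ.≤ suc N →
  ι (suc N) * ∑ j (antidiag f N) ≡ ι (suc N) * ∑ j (antidiag f (suc N)) + ι j * antidiag f (suc N) j
∑-antidiag f N zero    _         = trans (solve 2 (λ n a → n :* con 0ℚ := n :* con 0ℚ :+ con 0ℚ :* a) refl (ι (suc N)) (antidiag f (suc N) 0))
  (cong (λ t → ι (suc N) * 0ℚ + t * antidiag f (suc N) 0) (sym ι-0))
∑-antidiag f N (suc j) (s≤s j≤N) = begin
  n * (S + antidiag f N j)              ≡⟨ ℚₚ.*-distribˡ-+ n S (antidiag f N j) ⟩
  n * S + n * antidiag f N j            ≡⟨ cong₂ _+_ (∑-antidiag f N j (ℕₚ.m≤n⇒m≤1+n j≤N)) (antidiag-elevate f N j j≤N) ⟩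
  (n * S′ + ι j * a) + ((n - ι j) * a + b)
    ≡⟨ solve 5 (λ n S j a b → (n :* S :+ j :* a) :+ ((n :- j) :* a :+ b) := n :* (S :+ a) :+ b) refl n S′ (ι j) a b ⟩
  n * (S′ + a) + b                      ∎
  where
  open ≡-Reasoning
  n  = ι (suc N)
  S  = ∑ j (antidiag f N)
  S′ = ∑ j (antidiag f (suc N))
  a  = antidiag f (suc N) j
  b  = ι (suc j) * antidiag f (suc N) (suc j)

-- For f(n) = t^n this is the partition of unity; the total is preserved by degree elevation, hence
-- equal to its value for N = 0.
∑-antidiag-total : ∀ f N → ∑ (suc N) (antidiag f N) ≡ f 0
∑-antidiag-total f zero    = ℚₚ.+-identityˡ (f 0)
∑-antidiag-total f (suc N) = trans (ι-cancel N (begin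
  ι (suc N) * (S + a)                ≡⟨ ℚₚ.*-distribˡ-+ (ι (suc N)) S a ⟩
  ι (suc N) * S + ι (suc N) * a      ≡⟨ sym (∑-antidiag f N (suc N) ℕₚ.≤-refl) ⟩
  ι (suc N) * ∑ (suc N) (antidiag f N) ∎)) (∑-antidiag-total f N)
  where
  open ≡-Reasoning
  S = ∑ (suc N) (antidiag f (suc N))
  a = antidiag f (suc N) (suc N)

-- Pairs of differences of g and f whose orders j + 1 and N - i, with i ≤ j, sum to more than N: the
-- products beyond the degree of the interpolation.
productDefect : (ℕ → ℚ) → (ℕ → ℚ) → ℕ → ℕ → ℚ
productDefect f g N j = rec j * diff g 0 (suc j) * ∑ (suc j) (antidiag f N)

-- Passing from N to N + 1 lowers the partial sum in the j-th term by (j + 1)/(N + 1) times the next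
-- antidiagonal entry. The factor j + 1 cancels `rec j`, and what remains is 1/(N + 1) times a term
-- of the Leibniz rule for the new difference of f g.
deriv-product : ∀ f g → f 0 ≡ 0ℚ → g 0 ≡ 0ℚ → ∀ N →
                deriv N (λ n → f n * g n) ≡ - ∑ N (productDefect f g N)
deriv-product f g f0≡0 g0≡0 zero    = refl
deriv-product f g f0≡0 g0≡0 (suc N) = begin
  deriv N h + rec N * diff h 0 (suc N)
    ≡⟨ cong₂ (λ u v → u + rec N * v) (deriv-product f g f0≡0 g0≡0 N) product ⟩
  - ∑ N (productDefect f g N) + rec N * T
    ≡⟨ solve 2 (λ a b → :- a :+ b := :- (a :- b)) refl (∑ N (productDefect f g N)) (rec N * T) ⟩
  - (∑ N (productDefect f g N) - rec N * T)
    ≡⟨ cong -_ (sym defect) ⟩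
  - ∑ (suc N) (productDefect f g (suc N)) ∎
  where
  open ≡-Reasoning
  h = λ n → f n * g n
  G : ℕ → ℚ
  G j = diff g 0 (suc j) * antidiag f (suc N) (suc j)
  T = ∑ (suc N) G
  product : diff h 0 (suc N) ≡ T
  product = begin
    diff h 0 (suc N)
      ≡⟨ diff-product f g (suc N) 0 ⟩
    ∑split (suc N) (λ j l → diff f (j ℕ.+ 0) l * diff g 0 j)
      ≡⟨ ∑split-ext (suc N) (λ j l → trans (cong (λ t → diff f t l * diff g 0 j) (ℕₚ.+-identityʳ j)) (ℚₚ.*-comm (diff f j l) (diff g 0 j))) ⟩
    ∑split (suc N) (λ j l → diff g 0 j * diff f j l)
      ≡⟨ ∑split≡∑ (suc N) (λ j l → diff g 0 j * diff f j l) ⟩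
    ∑ (suc (suc N)) (λ j → diff g 0 j * antidiag f (suc N) j)
      ≡⟨ ∑-head (suc N) (λ j → diff g 0 j * antidiag f (suc N) j) ⟩
    g 0 * antidiag f (suc N) 0 + T
      ≡⟨ cong (λ t → t * antidiag f (suc N) 0 + T) g0≡0 ⟩
    0ℚ * antidiag f (suc N) 0 + T
      ≡⟨ solve 2 (λ a t → con 0ℚ :* a :+ t := t) refl (antidiag f (suc N) 0) T ⟩
    T ∎
  step : ∀ j → j ℕ.< suc N → productDefect f g (suc N) j ≡ productDefect f g N j + - rec N * G j
  step j j<N = begin
    r * d * S′
      ≡⟨ cong (λ t → r * d * t) (solve 2 (λ s e → s := (s :+ e) :- e) refl S′ (rec N * (ι (suc j) * a))) ⟩
    r * d * ((S′ + rec N * (ι (suc j) * a)) - rec N * (ι (suc j) * a))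
      ≡⟨ cong (λ t → r * d * (t - rec N * (ι (suc j) * a))) (ι-cancel N (begin
           ι (suc N) * (S′ + rec N * (ι (suc j) * a))                ≡⟨ ℚₚ.*-distribˡ-+ (ι (suc N)) S′ _ ⟩
           ι (suc N) * S′ + ι (suc N) * (rec N * (ι (suc j) * a))    ≡⟨ cong (ι (suc N) * S′ +_) (ι*rec* N (ι (suc j) * a)) ⟩
           ι (suc N) * S′ + ι (suc j) * a                            ≡⟨ sym (∑-antidiag f N (suc j) j<N) ⟩
           ι (suc N) * S                                             ∎)) ⟩
    r * d * (S - rec N * (ι (suc j) * a))
      ≡⟨ solve 6 (λ r d S n i a → r :* d :* (S :- n :* (i :* a)) := r :* d :* S :- n :* (r :* (i :* (d :* a)))) refl r d S (rec N) (ι (suc j)) a ⟩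
    r * d * S - rec N * (r * (ι (suc j) * (d * a)))
      ≡⟨ cong (λ t → r * d * S - rec N * t) (rec*ι j (d * a)) ⟩
    r * d * S - rec N * (d * a)
      ≡⟨ solve 3 (λ s n t → s :- n :* t := s :+ :- n :* t) refl (r * d * S) (rec N) (d * a) ⟩
    r * d * S + - rec N * (d * a) ∎
    where
    r  = rec j
    d  = diff g 0 (suc j)
    S  = ∑ (suc j) (antidiag f N)
    S′ = ∑ (suc j) (antidiag f (suc N))
    a  = antidiag f (suc N) (suc j)
  defect : ∑ (suc N) (productDefect f g (suc N)) ≡ ∑ N (productDefect f g N) - rec N * T
  defect = begin
    ∑ (suc N) (productDefect f g (suc N))
      ≡⟨ ∑-cong< (suc N) step ⟩
    ∑ (suc N) (λ j → productDefect f g N j + - rec N * G j)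
      ≡⟨ trans (linear-+ (fin-∑ (suc N)) (productDefect f g N) (λ j → - rec N * G j)) (cong (∑ (suc N) (productDefect f g N) +_) (linear-* (fin-∑ (suc N)) (- rec N) G)) ⟩
    (∑ N (productDefect f g N) + rec N * diff g 0 (suc N) * ∑ (suc N) (antidiag f N)) + - rec N * T
      -- The new row j = N contains the full antidiagonal sum, which is f(0) = 0.
      ≡⟨ cong (λ t → (∑ N (productDefect f g N) + rec N * diff g 0 (suc N) * t) + - rec N * T) (trans (∑-antidiag-total f N) f0≡0) ⟩
    (∑ N (productDefect f g N) + rec N * diff g 0 (suc N) * 0ℚ) + - rec N * T
      ≡⟨ solve 4 (λ s q n t → (s :+ q :* con 0ℚ) :+ :- n :* t := s :- n :* t) refl (∑ N (productDefect f g N)) (rec N * diff g 0 (suc N)) (rec N) T ⟩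
    ∑ N (productDefect f g N) - rec N * T ∎

-- Truncated multiple zeta sums

-- `index` drops trailing letters x, so the values at words not ending in y are defaults.
trunc : ℕ → Word → ℚ
trunc N w = ζ≤ N (index w)

recip-* : ∀ m n .{{_ : ℕ.NonZero m}} .{{_ : ℕ.NonZero n}} .{{_ : ℕ.NonZero (m ℕ.* n)}} →
          pos 1 / (m ℕ.* n) ≡ (pos 1 / m) * (pos 1 / n)
recip-* m@(suc m-1) n@(suc n-1) = ℚₚ.toℚᵘ-injective (begin
  toℚᵘ (pos 1 / (m ℕ.* n))                         ≈⟨ ℚₚ.toℚᵘ-fromℚᵘ (ℚᵘ.mkℚᵘ (pos 1) _) ⟩
  ℚᵘ.mkℚᵘ (pos 1) m-1 ℚᵘ.* ℚᵘ.mkℚᵘ (pos 1) n-1     ≈⟨ ℚᵘₚ.*-cong (ℚᵘₚ.≃-sym (ℚₚ.toℚᵘ-fromℚᵘ (ℚᵘ.mkℚᵘ (pos 1) m-1))) (ℚᵘₚ.≃-sym (ℚₚ.toℚᵘ-fromℚᵘ (ℚᵘ.mkℚᵘ (pos 1) n-1))) ⟩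
  toℚᵘ (pos 1 / m) ℚᵘ.* toℚᵘ (pos 1 / n)           ≈⟨ ℚᵘₚ.≃-sym (ℚₚ.toℚᵘ-homo-* (pos 1 / m) (pos 1 / n)) ⟩
  toℚᵘ ((pos 1 / m) * (pos 1 / n))                 ∎)
  where open import Relation.Binary.Reasoning.Setoid ℚᵘₚ.≃-setoid

private
  pw : ℕ → ℕ → ℚ
  pw m k = (pos 1 / (suc m ℕ.^ k)) {{ℕₚ.m^n≢0 (suc m) k}}

  pw-suc : ∀ m k → pw m (suc k) ≡ rec m * pw m k
  pw-suc m k = trans (recip-* (suc m) (suc m ℕ.^ k) {{_}} {{ℕₚ.m^n≢0 (suc m) k}} {{ℕₚ.m^n≢0 (suc m) (suc k)}})
    (cong (_* pw m k) (sym (rec-def m)))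

-- With `trunc-X`, the discrete form of the differential equations of polylogarithms, y standing for
-- dt/(1 - t) and x for dt/t.
trunc-Y : ∀ N w → trunc (suc N) (Y ∷ w) - trunc N (Y ∷ w) ≡ rec N * trunc N w
trunc-Y N w = begin
  (trunc N (Y ∷ w) + pw N 1 * trunc N w) - trunc N (Y ∷ w)
    ≡⟨ solve 2 (λ a b → (a :+ b) :- a := b) refl (trunc N (Y ∷ w)) (pw N 1 * trunc N w) ⟩
  pw N 1 * trunc N w
    ≡⟨ cong (_* trunc N w) (trans (pw-suc N 0) (ℚₚ.*-identityʳ (rec N))) ⟩
  rec N * trunc N w ∎
  where open ≡-Reasoning

trunc-X : ∀ N w → trunc (suc N) (X ∷ w) - trunc N (X ∷ w) ≡ rec N * (trunc (suc N) w - trunc N w)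
trunc-X N = go 0
  where
  open ≡-Reasoning
  go : ∀ i w → ζ≤ (suc N) (indexFrom (suc i) w) - ζ≤ N (indexFrom (suc i) w)
               ≡ rec N * (ζ≤ (suc N) (indexFrom i w) - ζ≤ N (indexFrom i w))
  go i []      = solve 1 (λ r → con 0ℚ := r :* con 0ℚ) refl (rec N)
  go i (X ∷ w) = go (suc i) w
  go i (Y ∷ w) = begin
    (a + pw N (suc (suc i)) * t) - a   ≡⟨ cong (λ p → (a + p * t) - a) (pw-suc N (suc i)) ⟩
    (a + (rec N * p) * t) - a          ≡⟨ solve 5 (λ a b r p t → (a :+ (r :* p) :* t) :- a := r :* ((b :+ p :* t) :- b)) refl a b (rec N) p t ⟩
    rec N * ((b + p * t) - b)          ∎
    where
    a = ζ≤ N (suc (suc i) ∷ index w)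
    b = ζ≤ N (suc i ∷ index w)
    p = pw N (suc i)
    t = trunc N w

trunc-0X : ∀ w → trunc 0 (X ∷ w) ≡ trunc 0 w
trunc-0X = go 0
  where
  go : ∀ i w → ζ≤ 0 (indexFrom (suc i) w) ≡ ζ≤ 0 (indexFrom i w)
  go i []      = refl
  go i (X ∷ w) = go (suc i) w
  go i (Y ∷ w) = refl

data EndsInY : Word → Set where
  here  : EndsInY [ Y ]
  there : ∀ a {w} → EndsInY w → EndsInY (a ∷ w)

trunc-0 : ∀ {w} → EndsInY w → trunc 0 w ≡ 0ℚ
trunc-0 here              = refl
trunc-0 (there X {w} w∈y) = trans (trunc-0X w) (trunc-0 w∈y)
trunc-0 (there Y w∈y)     = refl

++Y-EndsInY : ∀ w → EndsInY (w ++ [ Y ])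
++Y-EndsInY []      = here
++Y-EndsInY (a ∷ w) = there a (++Y-EndsInY w)

EndsInY-⟨⟩ : ∀ k v → EndsInY (⟨ k ∷ v ⟩x^ 0)
EndsInY-⟨⟩ (suc k) v       = there X (EndsInY-⟨⟩ k v)
EndsInY-⟨⟩ zero    []      = here
EndsInY-⟨⟩ zero    (k ∷ v) = there Y (EndsInY-⟨⟩ k v)

⟨⟩-EndsInY : ∀ {w} → EndsInY w → ∃₂ λ k v → ⟨ k ∷ v ⟩x^ 0 ≡ w
⟨⟩-EndsInY here = 0 , [] , refl
⟨⟩-EndsInY (there X w∈y) with ⟨⟩-EndsInY w∈y
... | k , v , refl = suc k , v , refl
⟨⟩-EndsInY (there Y w∈y) with ⟨⟩-EndsInY w∈y
... | k , v , refl = 0 , k ∷ v , refl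

-- Landen's connection formula for partial sums

diff-const : ∀ q i m → diff (λ _ → q) i (suc m) ≡ 0ℚ
diff-const q i m = ι-cancel m (begin
  ι (suc m) * diff (λ _ → q) i (suc m)
    ≡⟨ diff-average (λ _ → q) (λ _ → 0ℚ) (λ n → solve 2 (λ n q → n :* (q :- q) := con 0ℚ) refl (ι (suc n)) q) m i ⟩
  - ∑ (suc m) (diff (λ _ → 0ℚ) i)
    ≡⟨ cong -_ (trans (linear-ext (fin-∑ (suc m)) (λ n → linear-0 (fin-diff i n))) (linear-0 (fin-∑ (suc m)))) ⟩
  0ℚ
    ≡⟨ sym (ℚₚ.*-zeroʳ (ι (suc m))) ⟩
  ι (suc m) * 0ℚ ∎)
  where open ≡-Reasoning

truncs : Word → ℕ → ℚ
truncs w n = trunc n w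

diff-truncs-Y : ∀ w m i → ι (suc m) * diff (truncs (Y ∷ w)) i (suc m) ≡ - ∑ (suc m) (diff (truncs w) i)
diff-truncs-Y w m i = diff-average _ _ (λ n → trans (cong (ι (suc n) *_) (trunc-Y n w)) (ι*rec* n (trunc n w))) m i

diff-truncs-X : ∀ w m i → ι (suc m) * diff (truncs (X ∷ w)) i (suc m) ≡ - ∑ (suc m) (diff (λ n → trunc (suc n) w - trunc n w) i)
diff-truncs-X w m i = diff-average _ _ (λ n → trans (cong (ι (suc n) *_) (trunc-X n w)) (ι*rec* n _)) m i

-- Landen's connection formula Li_w(t/(t-1)) = Li_{φ(w)}(t), on partial sums
-- of coefficients.
Landen : Word → Set
Landen w = ∀ N → φᵗ (trunc N) w ≡ ∑ (suc N) (diff (truncs w) 0)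

private
  φᵗ-increment : ∀ N w → φᵗ (trunc (suc N)) w ≡ φᵗ (trunc N) w + φᵗ (λ v → trunc (suc N) v - trunc N v) w
  φᵗ-increment N w = trans (linear-ext (fin-φᵗ w) (λ v → solve 2 (λ a b → a := b :+ (a :- b)) refl (trunc (suc N) v) (trunc N v)))
    (linear-+ (fin-φᵗ w) (trunc N) _)

landen-[] : Landen []
landen-[] N = sym (begin
  ∑ (suc N) (diff (λ _ → 1ℚ) 0)                      ≡⟨ ∑-head N (diff (λ _ → 1ℚ) 0) ⟩
  1ℚ + ∑ N (λ m → diff (λ _ → 1ℚ) 0 (suc m))         ≡⟨ cong (1ℚ +_) (trans (linear-ext (fin-∑ N) (diff-const 1ℚ 0)) (linear-0 (fin-∑ N))) ⟩
  1ℚ                                                 ∎)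
  where open ≡-Reasoning

-- Induction on N. Both increments are -1/(N + 1) times the two sides of the formula for w, on the
-- right because the differences for yw average those for w.
landen-Y : ∀ w → Landen w → Landen (Y ∷ w)
landen-Y w landen zero    = trans (cong -_ (linear-0 (fin-φᵗ w))) refl
landen-Y w landen (suc N) = begin
  φᵗ (trunc (suc N)) (Y ∷ w)
    ≡⟨ φᵗ-increment N (Y ∷ w) ⟩
  φᵗ (trunc N) (Y ∷ w) + - φᵗ (λ v → trunc (suc N) (Y ∷ v) - trunc N (Y ∷ v)) w
    ≡⟨ cong₂ _+_ (landen-Y w landen N) (cong -_ (trans (linear-ext (fin-φᵗ w) (trunc-Y N)) (linear-* (fin-φᵗ w) (rec N) (trunc N)))) ⟩
  S + - (rec N * φᵗ (trunc N) w)
    ≡⟨ cong (S +_) (ι-cancel N (begin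
         ι (suc N) * - (rec N * φᵗ (trunc N) w)    ≡⟨ solve 2 (λ a b → a :* :- b := :- (a :* b)) refl (ι (suc N)) (rec N * φᵗ (trunc N) w) ⟩
         - (ι (suc N) * (rec N * φᵗ (trunc N) w))  ≡⟨ cong -_ (trans (ι*rec* N _) (landen N)) ⟩
         - ∑ (suc N) (diff (truncs w) 0)           ≡⟨ sym (diff-truncs-Y w N 0) ⟩
         ι (suc N) * diff (truncs (Y ∷ w)) 0 (suc N) ∎)) ⟩
  S + diff (truncs (Y ∷ w)) 0 (suc N) ∎
  where
  open ≡-Reasoning
  S = ∑ (suc N) (diff (truncs (Y ∷ w)) 0)

-- φ(xw) = zφ(w), and the increments for x and y add up to 1/(N + 1) times the full value of φ(w) at
-- N + 1. On the right, averaging the differences of increments gives the same sum without its term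
-- of order 0, which is `trunc 0 w`; hence the hypothesis that it vanishes.
landen-X : ∀ w → trunc 0 w ≡ 0ℚ → Landen w → Landen (X ∷ w)
landen-X w w0 landen zero = begin
  φᵗ (trunc 0 ∘∷ X) w + φᵗ (λ _ → 0ℚ) w  ≡⟨ cong₂ _+_ (linear-ext (fin-φᵗ w) trunc-0X) (linear-0 (fin-φᵗ w)) ⟩
  φᵗ (trunc 0) w + 0ℚ                    ≡⟨ trans (ℚₚ.+-identityʳ _) (landen 0) ⟩
  0ℚ + trunc 0 w                         ≡⟨ cong (0ℚ +_) (sym (trunc-0X w)) ⟩
  0ℚ + trunc 0 (X ∷ w)                   ∎
  where open ≡-Reasoning
landen-X w w0 landen (suc N) = begin
  φᵗ (trunc (suc N)) (X ∷ w)
    ≡⟨ φᵗ-increment N (X ∷ w) ⟩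
  φᵗ (trunc N) (X ∷ w) + (φᵗ (λ v → trunc (suc N) (X ∷ v) - trunc N (X ∷ v)) w + φᵗ (λ v → trunc (suc N) (Y ∷ v) - trunc N (Y ∷ v)) w)
    ≡⟨ cong₂ _+_ (landen-X w w0 landen N) (cong₂ _+_
         (trans (linear-ext (fin-φᵗ w) (trunc-X N)) (linear-* (fin-φᵗ w) (rec N) (λ v → trunc (suc N) v - trunc N v)))
         (trans (linear-ext (fin-φᵗ w) (trunc-Y N)) (linear-* (fin-φᵗ w) (rec N) (trunc N)))) ⟩
  S + (rec N * φᵗ (λ v → trunc (suc N) v - trunc N v) w + rec N * φᵗ (trunc N) w)
    ≡⟨ cong (S +_) (trans (solve 3 (λ r a b → r :* a :+ r :* b := r :* (b :+ a)) refl (rec N) _ _) (cong (rec N *_) (sym (φᵗ-increment N w)))) ⟩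
  S + rec N * φᵗ (trunc (suc N)) w
    ≡⟨ cong (S +_) (ι-cancel N (begin
         ι (suc N) * (rec N * φᵗ (trunc (suc N)) w)       ≡⟨ ι*rec* N _ ⟩
         φᵗ (trunc (suc N)) w                             ≡⟨ landen (suc N) ⟩
         ∑ (suc (suc N)) (diff (truncs w) 0)              ≡⟨ ∑-head (suc N) (diff (truncs w) 0) ⟩
         trunc 0 w + ∑ (suc N) (λ m → diff (truncs w) 0 (suc m))
           ≡⟨ trans (cong (_+ ∑ (suc N) (λ m → diff (truncs w) 0 (suc m))) w0) (ℚₚ.+-identityˡ _) ⟩
         ∑ (suc N) (λ m → diff (truncs w) 0 (suc m))
           ≡⟨ solve 1 (λ a → a := :- (:- a)) refl (∑ (suc N) (λ m → diff (truncs w) 0 (suc m))) ⟩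
         - - ∑ (suc N) (λ m → diff (truncs w) 0 (suc m))
           ≡⟨ cong -_ (sym (trans (linear-ext (fin-∑ (suc N)) (λ m → ι-cancel m (trans (diff-Δ (truncs w) m 0)
                (solve 2 (λ a b → :- (a :* b) := a :* :- b) refl (ι (suc m)) (diff (truncs w) 0 (suc m)))))) (linear-neg (fin-∑ (suc N)) _))) ⟩
         - ∑ (suc N) (diff (λ n → trunc (suc n) w - trunc n w) 0)
           ≡⟨ sym (diff-truncs-X w N 0) ⟩
         ι (suc N) * diff (truncs (X ∷ w)) 0 (suc N) ∎)) ⟩
  S + diff (truncs (X ∷ w)) 0 (suc N) ∎
  where
  open ≡-Reasoning
  S = ∑ (suc N) (diff (truncs (X ∷ w)) 0)

landen : ∀ {w} → EndsInY w → Landen w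
landen here              = landen-Y [] landen-[]
landen (there X {w} w∈y) = landen-X w (trunc-0 w∈y) (landen w∈y)
landen (there Y {w} w∈y) = landen-Y w (landen w∈y)

-- From N to N + 1 the value at xφ(w) grows by 1/(N + 1) times the growth at φ(w), which by Landen's
-- formula is a single normalised difference.
φᵗ-trunc-X : ∀ {w} → EndsInY w → ∀ N → φᵗ (trunc N ∘∷ X) w ≡ deriv N (truncs w)
φᵗ-trunc-X {w} w∈y zero    = begin
  φᵗ (trunc 0 ∘∷ X) w    ≡⟨ linear-ext (fin-φᵗ w) trunc-0X ⟩
  φᵗ (trunc 0) w         ≡⟨ landen w∈y 0 ⟩
  0ℚ + trunc 0 w         ≡⟨ cong (0ℚ +_) (trunc-0 w∈y) ⟩
  0ℚ                     ∎
  where open ≡-Reasoning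
φᵗ-trunc-X {w} w∈y (suc N) = begin
  φᵗ (trunc (suc N) ∘∷ X) w
    ≡⟨ trans (linear-ext F (λ v → solve 2 (λ a b → a := b :+ (a :- b)) refl (trunc (suc N) (X ∷ v)) (trunc N (X ∷ v)))) (linear-+ F (trunc N ∘∷ X) _) ⟩
  φᵗ (trunc N ∘∷ X) w + φᵗ (λ v → trunc (suc N) (X ∷ v) - trunc N (X ∷ v)) w
    ≡⟨ cong₂ _+_ (φᵗ-trunc-X w∈y N) (trans (linear-ext F (trunc-X N)) (trans (linear-* F (rec N) (λ v → trunc (suc N) v - trunc N v)) (cong (rec N *_) (linear-sub F (trunc (suc N)) (trunc N))))) ⟩
  deriv N (truncs w) + rec N * (φᵗ (trunc (suc N)) w - φᵗ (trunc N) w)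
    ≡⟨ cong₂ (λ a b → deriv N (truncs w) + rec N * (a - b)) (landen w∈y (suc N)) (landen w∈y N) ⟩
  deriv N (truncs w) + rec N * ((S + d) - S)
    ≡⟨ cong (λ t → deriv N (truncs w) + rec N * t) (solve 2 (λ s d → (s :+ d) :- s := d) refl S d) ⟩
  deriv N (truncs w) + rec N * d ∎
  where
  open ≡-Reasoning
  F = fin-φᵗ w
  S = ∑ (suc N) (diff (truncs w) 0)
  d = diff (truncs w) 0 (suc N)

-- Multiplicativity of truncated sums

truncᴵ : ℕ → Index → ℚ
truncᴵ N v = trunc N (⟨ v ⟩x^ 0)

private
  -- The power (N + 1)^-(k + 1), with the exponent shifted as for letters so that merging letters
  -- multiplies powers.
  recpow : ℕ → ℕ → ℚ
  recpow N zero    = rec N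
  recpow N (suc k) = rec N * recpow N k

  recpow-+ : ∀ N k l → recpow N (suc (k ℕ.+ l)) ≡ recpow N k * recpow N l
  recpow-+ N zero    l = refl
  recpow-+ N (suc k) l = trans (cong (rec N *_) (recpow-+ N k l)) (sym (ℚₚ.*-assoc (rec N) (recpow N k) (recpow N l)))

truncᴵ-suc : ∀ N k v → truncᴵ (suc N) (k ∷ v) ≡ truncᴵ N (k ∷ v) + recpow N k * truncᴵ N v
truncᴵ-suc N k v = trans (solve 2 (λ a b → a := b :+ (a :- b)) refl (truncᴵ (suc N) (k ∷ v)) (truncᴵ N (k ∷ v)))
  (cong (truncᴵ N (k ∷ v) +_) (go k))
  where
  w = ⟨ v ⟩x^ 0
  go : ∀ k → trunc (suc N) (x^ k · Y ∷ w) - trunc N (x^ k · Y ∷ w) ≡ recpow N k * trunc N w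
  go zero    = trunc-Y N w
  go (suc k) = trans (trunc-X N (x^ k · Y ∷ w)) (trans (cong (rec N *_) (go k)) (sym (ℚₚ.*-assoc (rec N) (recpow N k) (trunc N w))))

-- The three terms of the harmonic product record whether the largest summation index N + 1 is
-- attained in the first factor only, in the second only, or in both.
truncᴵ-stuffle : ∀ N u v → stuffle (truncᴵ N) u v ≡ truncᴵ N u * truncᴵ N v
truncᴵ-stuffle N       []        v         = sym (ℚₚ.*-identityˡ (truncᴵ N v))
truncᴵ-stuffle N       u@(_ ∷ _) []        = sym (ℚₚ.*-identityʳ (truncᴵ N u))
truncᴵ-stuffle zero    (k ∷ u)   (l ∷ v)   = begin
  stuffle (truncᴵ 0 ∘∷ k) u (l ∷ v) + stuffle (truncᴵ 0 ∘∷ l) (k ∷ u) v + stuffle (truncᴵ 0 ∘∷ suc (k ℕ.+ l)) u v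
    ≡⟨ cong₂ _+_ (cong₂ _+_ (vanish k u (l ∷ v)) (vanish l (k ∷ u) v)) (vanish (suc (k ℕ.+ l)) u v) ⟩
  0ℚ
    ≡⟨ sym (ℚₚ.*-zeroˡ (truncᴵ 0 (l ∷ v))) ⟩
  0ℚ * truncᴵ 0 (l ∷ v)
    ≡⟨ cong (_* truncᴵ 0 (l ∷ v)) (sym (trunc-0 (EndsInY-⟨⟩ k u))) ⟩
  truncᴵ 0 (k ∷ u) * truncᴵ 0 (l ∷ v) ∎
  where
  open ≡-Reasoning
  vanish : ∀ k u v → stuffle (truncᴵ 0 ∘∷ k) u v ≡ 0ℚ
  vanish k u v = trans (linear-ext (fin-stuffle u v) (λ w → trunc-0 (EndsInY-⟨⟩ k w))) (linear-0 (fin-stuffle u v))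
truncᴵ-stuffle (suc N) u₀@(k ∷ u) v₀@(l ∷ v) = begin
  stuffle (truncᴵ (suc N) ∘∷ k) u v₀ + stuffle (truncᴵ (suc N) ∘∷ l) u₀ v + stuffle (truncᴵ (suc N) ∘∷ m) u v
    ≡⟨ cong₂ _+_ (cong₂ _+_ (split k u v₀) (split l u₀ v)) (split m u v) ⟩
  (stuffle (T ∘∷ k) u v₀ + p k * stuffle T u v₀) + (stuffle (T ∘∷ l) u₀ v + p l * stuffle T u₀ v) + (stuffle (T ∘∷ m) u v + p m * stuffle T u v)
    ≡⟨ solve 6 (λ a b c d e f → (a :+ b) :+ (c :+ d) :+ (e :+ f) := (a :+ c :+ e) :+ (b :+ d :+ f)) refl
         (stuffle (T ∘∷ k) u v₀) (p k * stuffle T u v₀) (stuffle (T ∘∷ l) u₀ v) (p l * stuffle T u₀ v) (stuffle (T ∘∷ m) u v) (p m * stuffle T u v) ⟩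
  stuffle T u₀ v₀ + (p k * stuffle T u v₀ + p l * stuffle T u₀ v + p m * stuffle T u v)
    ≡⟨ cong₂ _+_ (truncᴵ-stuffle N u₀ v₀) (cong₂ _+_ (cong₂ (λ s t → p k * s + p l * t) (truncᴵ-stuffle N u v₀) (truncᴵ-stuffle N u₀ v))
         (cong₂ _*_ (recpow-+ N k l) (truncᴵ-stuffle N u v))) ⟩
  T u₀ * T v₀ + (p k * (T u * T v₀) + p l * (T u₀ * T v) + (p k * p l) * (T u * T v))
    ≡⟨ solve 6 (λ a b c d p q → a :* b :+ (p :* (c :* b) :+ q :* (a :* d) :+ (p :* q) :* (c :* d)) := (a :+ p :* c) :* (b :+ q :* d)) refl
         (T u₀) (T v₀) (T u) (T v) (p k) (p l) ⟩
  (T u₀ + p k * T u) * (T v₀ + p l * T v)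
    ≡⟨ sym (cong₂ _*_ (truncᴵ-suc N k u) (truncᴵ-suc N l v)) ⟩
  truncᴵ (suc N) u₀ * truncᴵ (suc N) v₀ ∎
  where
  open ≡-Reasoning
  m = suc (k ℕ.+ l)
  T = truncᴵ N
  p = recpow N
  split : ∀ k u v → stuffle (truncᴵ (suc N) ∘∷ k) u v ≡ stuffle (T ∘∷ k) u v + p k * stuffle T u v
  split k u v = trans (linear-ext (fin-stuffle u v) (truncᴵ-suc N k))
    (trans (linear-+ (fin-stuffle u v) (T ∘∷ k) (λ w → p k * T w)) (cong (stuffle (T ∘∷ k) u v +_) (linear-* (fin-stuffle u v) (p k) T)))

-- φx (trunc N) 0 u is the N-th partial sum of Z(x φ(u)).
φx-trunc : ∀ k u N → φx (trunc N) 0 (k ∷ u) ≡ deriv N (truncs (⟨ k ∷ u ⟩x^ 0))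
φx-trunc k u N = φᵗ-trunc-X (EndsInY-⟨⟩ k u) N

-- A product with a nonempty factor contains nonempty indices only. `φx-trunc` is available just for
-- these.
stuffle-ext-∷ : ∀ {g h} → (∀ k w → g (k ∷ w) ≡ h (k ∷ w)) → ∀ k u v → stuffle g (k ∷ u) v ≡ stuffle h (k ∷ u) v
stuffle-ext-∷ g≡h k u []      = g≡h k u
stuffle-ext-∷ g≡h k u (l ∷ v) = cong₂ _+_ (cong₂ _+_
  (linear-ext (fin-stuffle u (l ∷ v)) (g≡h k)) (linear-ext (fin-stuffle (k ∷ u) v) (g≡h l))) (linear-ext (fin-stuffle u v) (g≡h (suc (k ℕ.+ l))))

stuffle-φx-trunc : ∀ N k u l v → stuffle (φx (trunc N) 0) (k ∷ u) (l ∷ v) ≡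
  deriv N (λ n → truncᴵ n (k ∷ u) * truncᴵ n (l ∷ v))
stuffle-φx-trunc N k u l v = begin
  stuffle (φx (trunc N) 0) (k ∷ u) (l ∷ v)
    ≡⟨ stuffle-ext-∷ {φx (trunc N) 0} {λ w → deriv N (λ n → truncᴵ n w)} (λ k w → φx-trunc k w N) k u (l ∷ v) ⟩
  stuffle (λ w → deriv N (λ n → truncᴵ n w)) (k ∷ u) (l ∷ v)
    ≡⟨ linear-swap (fin-stuffle (k ∷ u) (l ∷ v)) (fin-deriv N) (λ w n → truncᴵ n w) ⟩
  deriv N (λ n → stuffle (truncᴵ n) (k ∷ u) (l ∷ v))
    ≡⟨ linear-ext (fin-deriv N) (λ n → truncᴵ-stuffle n (k ∷ u) (l ∷ v)) ⟩
  deriv N (λ n → truncᴵ n (k ∷ u) * truncᴵ n (l ∷ v)) ∎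
  where open ≡-Reasoning

-- Estimates

module _ where
  open ℚₚ.≤-Reasoning

  *-monoʳ : ∀ {a b} c → 0ℚ ≤ c → a ≤ b → c * a ≤ c * b
  *-monoʳ c 0≤c = ℚₚ.*-monoˡ-≤-nonNeg c {{nonNegative 0≤c}}

  *-monoˡ : ∀ {a b} c → 0ℚ ≤ c → a ≤ b → a * c ≤ b * c
  *-monoˡ c 0≤c = ℚₚ.*-monoʳ-≤-nonNeg c {{nonNegative 0≤c}}

  0≤* : ∀ {a b} → 0ℚ ≤ a → 0ℚ ≤ b → 0ℚ ≤ a * b
  0≤* {a} {b} 0≤a 0≤b = subst (_≤ a * b) (ℚₚ.*-zeroʳ a) (*-monoʳ a 0≤a 0≤b)

  0≤+ : ∀ {a b} → 0ℚ ≤ a → 0ℚ ≤ b → 0ℚ ≤ a + b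
  0≤+ = ℚₚ.+-mono-≤

  *-mono : ∀ {a b c d} → 0ℚ ≤ c → 0ℚ ≤ b → a ≤ b → c ≤ d → a * c ≤ b * d
  *-mono {a} {b} {c} {d} 0≤c 0≤b a≤b c≤d = ℚₚ.≤-trans (*-monoˡ c 0≤c a≤b) (*-monoʳ b 0≤b c≤d)

  ≤-by : ∀ {a b} c → 0ℚ ≤ c → b ≡ a + c → a ≤ b
  ≤-by {a} {b} c 0≤c eq = begin
    a        ≡⟨ sym (ℚₚ.+-identityʳ a) ⟩
    a + 0ℚ   ≤⟨ ℚₚ.+-monoʳ-≤ a 0≤c ⟩
    a + c    ≡⟨ sym eq ⟩
    b        ∎

  0≤1 : 0ℚ ≤ 1ℚ
  0≤1 = ℚₚ.nonNegative⁻¹ 1ℚ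

  0≤ι : ∀ n → 0ℚ ≤ ι n
  0≤ι n = subst (0ℚ ≤_) (sym (ι-def n)) (ℚₚ.nonNegative⁻¹ _ {{ℚₚ.normalize-nonNeg n 1}})

  0≤rec : ∀ n → 0ℚ ≤ rec n
  0≤rec n = subst (0ℚ ≤_) (sym (rec-def n)) (ℚₚ.nonNegative⁻¹ _ {{ℚₚ.normalize-nonNeg 1 (suc n)}})

  rec-step : ∀ m → rec m ≡ rec (suc m) + rec m * rec (suc m)
  rec-step m = begin-equality
    rec m                                       ≡⟨ sym (ι*rec* (suc m) (rec m)) ⟩
    ι (suc (suc m)) * (rec (suc m) * rec m)     ≡⟨ cong (_* (rec (suc m) * rec m)) (ι-suc (suc m)) ⟩
    (1ℚ + ι (suc m)) * (rec (suc m) * rec m)    ≡⟨ solve 3 (λ i s r → (con 1ℚ :+ i) :* (s :* r) := i :* (r :* s) :+ r :* s) refl (ι (suc m)) (rec (suc m)) (rec m) ⟩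
    ι (suc m) * (rec m * rec (suc m)) + rec m * rec (suc m) ≡⟨ cong (_+ rec m * rec (suc m)) (ι*rec* m (rec (suc m))) ⟩
    rec (suc m) + rec m * rec (suc m)           ∎

  rec-+ : ∀ i m → rec (i ℕ.+ m) ≤ rec m
  rec-+ zero    m = ℚₚ.≤-refl
  rec-+ (suc i) m = ℚₚ.≤-trans (≤-by (rec (i ℕ.+ m) * rec (suc (i ℕ.+ m))) (0≤* (0≤rec (i ℕ.+ m)) (0≤rec (suc (i ℕ.+ m)))) (rec-step (i ℕ.+ m))) (rec-+ i m)

  rec≤1 : ∀ m → rec m ≤ 1ℚ
  rec≤1 m = subst (λ n → rec n ≤ 1ℚ) (ℕₚ.+-identityʳ m) (ℚₚ.≤-trans (rec-+ m 0) (ℚₚ.≤-reflexive (rec-def 0)))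

  ∑-mono : ∀ n {f g} → (∀ i → i ℕ.< n → f i ≤ g i) → ∑ n f ≤ ∑ n g
  ∑-mono zero    f≤g = ℚₚ.≤-refl
  ∑-mono (suc n) f≤g = ℚₚ.+-mono-≤ (∑-mono n (λ i i<n → f≤g i (ℕₚ.m<n⇒m<1+n i<n))) (f≤g n ℕₚ.≤-refl)

  ∣∑∣≤ : ∀ n f → ∣ ∑ n f ∣ ≤ ∑ n (λ i → ∣ f i ∣)
  ∣∑∣≤ zero    f = ℚₚ.≤-refl
  ∣∑∣≤ (suc n) f = ℚₚ.≤-trans (ℚₚ.∣p+q∣≤∣p∣+∣q∣ (∑ n f) (f n)) (ℚₚ.+-monoˡ-≤ ∣ f n ∣ (∣∑∣≤ n f))

  ∑-*ʳ : ∀ n f q → ∑ n (λ i → f i * q) ≡ q * ∑ n f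
  ∑-*ʳ n f q = trans (linear-ext (fin-∑ n) (λ i → ℚₚ.*-comm (f i) q)) (linear-* (fin-∑ n) q f)

  harmonic : ℕ → ℚ
  harmonic n = ∑ n rec

  0≤harmonic : ∀ n → 0ℚ ≤ harmonic n
  0≤harmonic zero    = ℚₚ.≤-refl
  0≤harmonic (suc n) = 0≤+ (0≤harmonic n) (0≤rec n)

  harmonic-+ : ∀ d n → harmonic n ≤ harmonic (d ℕ.+ n)
  harmonic-+ zero    n = ℚₚ.≤-refl
  harmonic-+ (suc d) n = ℚₚ.≤-trans (harmonic-+ d n) (≤-by (rec (d ℕ.+ n)) (0≤rec (d ℕ.+ n)) refl)

  harmonic-mono : ∀ {m n} → m ℕ.≤ n → harmonic m ≤ harmonic n
  harmonic-mono {m} {n} m≤n = subst (λ t → harmonic m ≤ harmonic t) (ℕₚ.m∸n+n≡m m≤n) (harmonic-+ (n ℕ.∸ m) m)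

  -- The decay 1/(m + 1) makes a sum of differences cost only a harmonic number. The triangle i + m
  -- < N is the range read by the product defect for N.
  record Bounded (N : ℕ) (B : ℚ) (f : ℕ → ℚ) : Set where
    field
      value : ∀ i → i ℕ.≤ N → ∣ f i ∣ ≤ B
      diffs : ∀ i m → suc (i ℕ.+ m) ℕ.≤ N → ∣ diff f i (suc m) ∣ ≤ rec m * B

  ∣ι*∣≤ : ∀ m {a B} → ∣ ι (suc m) * a ∣ ≤ B → ∣ a ∣ ≤ rec m * B
  ∣ι*∣≤ m {a} {B} h = begin
    ∣ a ∣                                ≡⟨ sym (rec*ι m ∣ a ∣) ⟩
    rec m * (ι (suc m) * ∣ a ∣)          ≡⟨ cong (λ t → rec m * (t * ∣ a ∣)) (sym (ℚₚ.0≤p⇒∣p∣≡p (0≤ι (suc m)))) ⟩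
    rec m * (∣ ι (suc m) ∣ * ∣ a ∣)      ≡⟨ cong (rec m *_) (sym (ℚₚ.∣p*q∣≡∣p∣*∣q∣ (ι (suc m)) a)) ⟩
    rec m * ∣ ι (suc m) * a ∣            ≤⟨ *-monoʳ (rec m) (0≤rec m) h ⟩
    rec m * B                            ∎

  -- Summing the steps g(i)/(i + 1) bounds the values, and `diff-average` bounds the differences by
  -- partial sums of those of g. Either way one letter costs one factor V ≥ 1 + H_N.
  bounded-average : ∀ N B V f g → 0ℚ ≤ B → 1ℚ + harmonic N ≤ V →
    ∣ f 0 ∣ ≤ B → (∀ i → ι (suc i) * (f (suc i) - f i) ≡ g i) →
    (∀ i → i ℕ.< N → ∣ g i ∣ ≤ B) →
    (∀ i m → suc (i ℕ.+ m) ℕ.≤ N → ∑ (suc m) (λ l → ∣ diff g i l ∣) ≤ B * V) →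
    Bounded N (B * V) f
  bounded-average N B V f g 0≤B H≤V f0≤B step g≤B ∑≤ = record
    { value = λ i i≤N → begin
        ∣ f i ∣                     ≤⟨ grow i i≤N ⟩
        B + B * harmonic i          ≡⟨ solve 2 (λ b h → b :+ b :* h := b :* (con 1ℚ :+ h)) refl B (harmonic i) ⟩
        B * (1ℚ + harmonic i)       ≤⟨ *-monoʳ B 0≤B (ℚₚ.≤-trans (ℚₚ.+-monoʳ-≤ 1ℚ (harmonic-mono i≤N)) H≤V) ⟩
        B * V                       ∎
    ; diffs = λ i m i+m<N → ∣ι*∣≤ m (begin
        ∣ ι (suc m) * diff f i (suc m) ∣     ≡⟨ cong ∣_∣ (diff-average f g step m i) ⟩
        ∣ - ∑ (suc m) (diff g i) ∣           ≡⟨ ℚₚ.∣-p∣≡∣p∣ (∑ (suc m) (diff g i)) ⟩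
        ∣ ∑ (suc m) (diff g i) ∣             ≤⟨ ∣∑∣≤ (suc m) (diff g i) ⟩
        ∑ (suc m) (λ l → ∣ diff g i l ∣)     ≤⟨ ∑≤ i m i+m<N ⟩
        B * V                                ∎)
    }
    where
    grow : ∀ i → i ℕ.≤ N → ∣ f i ∣ ≤ B + B * harmonic i
    grow zero    _   = ℚₚ.≤-trans f0≤B (≤-by (B * 0ℚ) (0≤* 0≤B ℚₚ.≤-refl) refl)
    grow (suc i) i<N = begin
      ∣ f (suc i) ∣                          ≡⟨ cong ∣_∣ (solve 2 (λ a b → b := a :+ (b :- a)) refl (f i) (f (suc i))) ⟩
      ∣ f i + (f (suc i) - f i) ∣            ≤⟨ ℚₚ.∣p+q∣≤∣p∣+∣q∣ (f i) (f (suc i) - f i) ⟩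
      ∣ f i ∣ + ∣ f (suc i) - f i ∣          ≤⟨ ℚₚ.+-mono-≤ (grow i (ℕₚ.<⇒≤ i<N)) (∣ι*∣≤ i (subst (λ t → ∣ t ∣ ≤ B) (sym (step i)) (g≤B i i<N))) ⟩
      (B + B * harmonic i) + rec i * B       ≡⟨ solve 3 (λ b h r → (b :+ b :* h) :+ r :* b := b :+ b :* (h :+ r)) refl B (harmonic i) (rec i) ⟩
      B + B * harmonic (suc i)               ∎

  bounded-truncs-Y : ∀ N B V w → 0ℚ ≤ B → 1ℚ + harmonic N ≤ V → Bounded N B (truncs w) → Bounded N (B * V) (truncs (Y ∷ w))
  bounded-truncs-Y N B V w 0≤B H≤V bdd = bounded-average N B V _ (truncs w) 0≤B H≤V 0≤B
    (λ n → trans (cong (ι (suc n) *_) (trunc-Y n w)) (ι*rec* n (trunc n w)))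
    (λ i i<N → value i (ℕₚ.<⇒≤ i<N))
    (λ i m i+m<N → begin
      ∑ (suc m) (λ l → ∣ diff (truncs w) i l ∣)
        ≡⟨ ∑-head m (λ l → ∣ diff (truncs w) i l ∣) ⟩
      ∣ truncs w i ∣ + ∑ m (λ l → ∣ diff (truncs w) i (suc l) ∣)
        ≤⟨ ℚₚ.+-mono-≤ (value i (ℕₚ.≤-trans (ℕₚ.m≤m+n i m) (ℕₚ.<⇒≤ i+m<N)))
             (∑-mono m (λ l l<m → diffs i l (ℕₚ.≤-trans (s≤s (ℕₚ.+-monoʳ-≤ i (ℕₚ.<⇒≤ l<m))) i+m<N))) ⟩
      B + ∑ m (λ l → rec l * B)
        ≡⟨ trans (cong (B +_) (∑-*ʳ m rec B)) (solve 2 (λ b h → b :+ b :* h := b :* (con 1ℚ :+ h)) refl B (harmonic m)) ⟩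
      B * (1ℚ + harmonic m)
        ≤⟨ *-monoʳ B 0≤B (ℚₚ.≤-trans (ℚₚ.+-monoʳ-≤ 1ℚ (harmonic-mono (ℕₚ.≤-trans (ℕₚ.m≤n+m m i) (ℕₚ.<⇒≤ i+m<N)))) H≤V) ⟩
      B * V ∎)
    where open Bounded bdd

  bounded-truncs-X : ∀ N B V w → 0ℚ ≤ B → ∣ trunc 0 w ∣ ≤ B → 1ℚ + harmonic N ≤ V → Bounded N B (truncs w) → Bounded N (B * V) (truncs (X ∷ w))
  bounded-truncs-X N B V w 0≤B w0≤B H≤V bdd = bounded-average N B V _ g 0≤B H≤V
    (subst (λ t → ∣ t ∣ ≤ B) (sym (trunc-0X w)) w0≤B)
    (λ n → trans (cong (ι (suc n) *_) (trunc-X n w)) (ι*rec* n _))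
    (λ i i<N → ℚₚ.≤-trans (diff-g i 0 (subst (ℕ._≤ N) (cong suc (sym (ℕₚ.+-identityʳ i))) i<N))
      (ℚₚ.≤-trans (*-monoˡ B 0≤B (rec≤1 0)) (ℚₚ.≤-reflexive (ℚₚ.*-identityˡ B))))
    (λ i m i+m<N → begin
      ∑ (suc m) (λ l → ∣ diff g i l ∣)
        ≤⟨ ∑-mono (suc m) (λ l l≤m → diff-g i l (ℕₚ.≤-trans (s≤s (ℕₚ.+-monoʳ-≤ i (ℕₚ.≤-pred l≤m))) i+m<N)) ⟩
      ∑ (suc m) (λ l → rec l * B)
        ≡⟨ ∑-*ʳ (suc m) rec B ⟩
      B * harmonic (suc m)
        ≤⟨ *-monoʳ B 0≤B (ℚₚ.≤-trans (harmonic-mono (ℕₚ.≤-trans (s≤s (ℕₚ.m≤n+m m i)) i+m<N))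
             (ℚₚ.≤-trans (≤-by 1ℚ 0≤1 (ℚₚ.+-comm 1ℚ (harmonic N))) H≤V)) ⟩
      B * V ∎)
    where
    open Bounded bdd
    g = λ n → trunc (suc n) w - trunc n w
    diff-g : ∀ i l → suc (i ℕ.+ l) ℕ.≤ N → ∣ diff g i l ∣ ≤ rec l * B
    diff-g i l i+l<N = ℚₚ.≤-trans (∣ι*∣≤ (i ℕ.+ l) (begin
      ∣ ι (suc (i ℕ.+ l)) * diff g i l ∣                 ≡⟨ cong ∣_∣ (diff-Δ (truncs w) l i) ⟩
      ∣ - (ι (suc l) * diff (truncs w) i (suc l)) ∣      ≡⟨ ℚₚ.∣-p∣≡∣p∣ _ ⟩
      ∣ ι (suc l) * diff (truncs w) i (suc l) ∣          ≡⟨ ℚₚ.∣p*q∣≡∣p∣*∣q∣ (ι (suc l)) _ ⟩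
      ∣ ι (suc l) ∣ * ∣ diff (truncs w) i (suc l) ∣      ≡⟨ cong (_* ∣ diff (truncs w) i (suc l) ∣) (ℚₚ.0≤p⇒∣p∣≡p (0≤ι (suc l))) ⟩
      ι (suc l) * ∣ diff (truncs w) i (suc l) ∣          ≤⟨ *-monoʳ (ι (suc l)) (0≤ι (suc l)) (diffs i l i+l<N) ⟩
      ι (suc l) * (rec l * B)                            ≡⟨ ι*rec* l B ⟩
      B                                                  ∎)) (*-monoˡ B 0≤B (rec-+ i l))

  pow : ℚ → ℕ → ℚ
  pow V zero    = 1ℚ
  pow V (suc n) = pow V n * V

  pow-+ : ∀ V m n → pow V (m ℕ.+ n) ≡ pow V m * pow V n
  pow-+ V zero    n = sym (ℚₚ.*-identityˡ (pow V n))
  pow-+ V (suc m) n = trans (cong (_* V) (pow-+ V m n))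
    (solve 3 (λ a b v → a :* b :* v := a :* v :* b) refl (pow V m) (pow V n) V)

  0≤pow : ∀ {V} → 0ℚ ≤ V → ∀ n → 0ℚ ≤ pow V n
  0≤pow 0≤V zero    = 0≤1
  0≤pow 0≤V (suc n) = 0≤* (0≤pow 0≤V n) 0≤V

  1≤pow : ∀ {V} → 1ℚ ≤ V → ∀ n → 1ℚ ≤ pow V n
  1≤pow 1≤V zero    = ℚₚ.≤-refl
  1≤pow {V} 1≤V (suc n) = begin
    1ℚ           ≤⟨ 1≤V ⟩
    V            ≡⟨ sym (ℚₚ.*-identityˡ V) ⟩
    1ℚ * V       ≤⟨ *-monoˡ V (ℚₚ.≤-trans 0≤1 1≤V) (1≤pow 1≤V n) ⟩
    pow V n * V  ∎

  bounded-truncs : ∀ N V → 1ℚ + harmonic N ≤ V → ∀ w → Bounded N (pow V (length w)) (truncs w)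
  bounded-truncs N V H≤V [] = record
    { value = λ _ _ → ℚₚ.≤-refl
    ; diffs = λ i m _ → subst (λ t → ∣ t ∣ ≤ rec m * 1ℚ) (sym (diff-const 1ℚ i m)) (0≤* (0≤rec m) 0≤1)
    }
  bounded-truncs N V H≤V (Y ∷ w) = bounded-truncs-Y N _ V w
    (ℚₚ.≤-trans 0≤1 (1≤pow (ℚₚ.≤-trans (≤-by (harmonic N) (0≤harmonic N) refl) H≤V) (length w))) H≤V (bounded-truncs N V H≤V w)
  bounded-truncs N V H≤V (X ∷ w) = bounded-truncs-X N _ V w
    (ℚₚ.≤-trans 0≤1 (1≤pow (ℚₚ.≤-trans (≤-by (harmonic N) (0≤harmonic N) refl) H≤V) (length w)))
    (Bounded.value (bounded-truncs N V H≤V w) 0 z≤n) H≤V (bounded-truncs N V H≤V w)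

  ∑-rec-reversed : ∀ M j → j ℕ.≤ suc M → ∑ j (λ i → rec (M ℕ.∸ i)) + harmonic (suc M ℕ.∸ j) ≡ harmonic (suc M)
  ∑-rec-reversed M zero    _         = ℚₚ.+-identityˡ (harmonic (suc M))
  ∑-rec-reversed M (suc j) (s≤s j≤M) = begin-equality
    (S + rec (M ℕ.∸ j)) + harmonic (M ℕ.∸ j)   ≡⟨ solve 3 (λ s r h → (s :+ r) :+ h := s :+ (h :+ r)) refl S (rec (M ℕ.∸ j)) (harmonic (M ℕ.∸ j)) ⟩
    S + harmonic (suc (M ℕ.∸ j))               ≡⟨ cong (λ t → S + harmonic t) (sym (ℕₚ.+-∸-assoc 1 j≤M)) ⟩
    S + harmonic (suc M ℕ.∸ j)                 ≡⟨ ∑-rec-reversed M j (ℕₚ.m≤n⇒m≤1+n j≤M) ⟩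
    harmonic (suc M)                           ∎
    where S = ∑ j (λ i → rec (M ℕ.∸ i))

  -- (M+1)/(M-i+1) = 1 + i/(M-i+1) ≤ 1 + j/(M-i+1) for i < j.
  ∑-rec-reversed-≤ : ∀ M V → 1ℚ + harmonic (suc M) ≤ V → ∀ j → j ℕ.≤ suc M → ∑ j (λ i → rec (M ℕ.∸ i)) ≤ rec M * (ι j * V)
  ∑-rec-reversed-≤ M V H≤V j j≤ = begin
    S                              ≡⟨ sym (rec*ι M S) ⟩
    rec M * (ι (suc M) * S)        ≤⟨ *-monoʳ (rec M) (0≤rec M) (begin
      ι (suc M) * S                    ≤⟨ partial j j≤ ⟩
      ι j + ι j * S                    ≡⟨ solve 2 (λ i s → i :+ i :* s := i :* (con 1ℚ :+ s)) refl (ι j) S ⟩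
      ι j * (1ℚ + S)                   ≤⟨ *-monoʳ (ι j) (0≤ι j) (ℚₚ.≤-trans (ℚₚ.+-monoʳ-≤ 1ℚ
                                            (≤-by {S} (harmonic (suc M ℕ.∸ j)) (0≤harmonic (suc M ℕ.∸ j)) (sym (∑-rec-reversed M j j≤)))) H≤V) ⟩
      ι j * V                          ∎) ⟩
    rec M * (ι j * V)              ∎
    where
    S = ∑ j (λ i → rec (M ℕ.∸ i))
    0≤∑ : ∀ j → 0ℚ ≤ ∑ j (λ i → rec (M ℕ.∸ i))
    0≤∑ zero    = ℚₚ.≤-refl
    0≤∑ (suc j) = 0≤+ (0≤∑ j) (0≤rec (M ℕ.∸ j))
    partial : ∀ j → j ℕ.≤ suc M → ι (suc M) * ∑ j (λ i → rec (M ℕ.∸ i)) ≤ ι j + ι j * ∑ j (λ i → rec (M ℕ.∸ i))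
    partial zero    _         = ℚₚ.≤-trans (ℚₚ.≤-reflexive (ℚₚ.*-zeroʳ (ι (suc M)))) (0≤+ (0≤ι 0) (0≤* (0≤ι 0) ℚₚ.≤-refl))
    partial (suc j) (s≤s j≤M) = begin
      ι (suc M) * (T + r)                      ≡⟨ ℚₚ.*-distribˡ-+ (ι (suc M)) T r ⟩
      ι (suc M) * T + ι (suc M) * r            ≤⟨ ℚₚ.+-mono-≤ (partial j (ℕₚ.m≤n⇒m≤1+n j≤M)) (ℚₚ.≤-reflexive head) ⟩
      (ι j + ι j * T) + (1ℚ + ι j * r)         ≤⟨ ≤-by (T + r) (0≤+ (0≤∑ j) (0≤rec (M ℕ.∸ j)))
                                                   (solve 3 (λ j t r → (con 1ℚ :+ j) :+ (con 1ℚ :+ j) :* (t :+ r) := (j :+ j :* t) :+ (con 1ℚ :+ j :* r) :+ (t :+ r)) refl (ι j) T r) ⟩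
      (1ℚ + ι j) + (1ℚ + ι j) * (T + r)        ≡⟨ cong (λ t → t + t * (T + r)) (sym (ι-suc j)) ⟩
      ι (suc j) + ι (suc j) * (T + r)          ∎
      where
      T = ∑ j (λ i → rec (M ℕ.∸ i))
      r = rec (M ℕ.∸ j)
      head : ι (suc M) * r ≡ 1ℚ + ι j * r
      head = begin-equality
        ι (suc M) * r                          ≡⟨ cong (λ t → ι (suc t) * r) (sym (ℕₚ.m∸n+n≡m j≤M)) ⟩
        ι (suc (M ℕ.∸ j) ℕ.+ j) * r            ≡⟨ cong (_* r) (ι-+ (suc (M ℕ.∸ j)) j) ⟩
        (ι (suc (M ℕ.∸ j)) + ι j) * r          ≡⟨ ℚₚ.*-distribʳ-+ r (ι (suc (M ℕ.∸ j))) (ι j) ⟩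
        ι (suc (M ℕ.∸ j)) * r + ι j * r        ≡⟨ cong (_+ ι j * r) (ι*rec (M ℕ.∸ j)) ⟩
        1ℚ + ι j * r                           ∎

  -- The partial antidiagonal sum contributes j + 1, which cancels one of the two factors 1/(j + 1)
  -- in the j-th term. The sum over j is then harmonic, and 1/(M + 1) survives.
  deriv-product-bound : ∀ M V B C f g → 1ℚ + harmonic (suc M) ≤ V → 0ℚ ≤ B → 0ℚ ≤ C → f 0 ≡ 0ℚ → g 0 ≡ 0ℚ →
    Bounded (suc M) B f → Bounded (suc M) C g →
    ∣ deriv (suc M) (λ n → f n * g n) ∣ ≤ (B * C) * (V * V) * rec M
  deriv-product-bound M V B C f g H≤V 0≤B 0≤C f0≡0 g0≡0 bf bg = begin
    ∣ deriv (suc M) (λ n → f n * g n) ∣                  ≡⟨ cong ∣_∣ (deriv-product f g f0≡0 g0≡0 (suc M)) ⟩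
    ∣ - ∑ (suc M) (productDefect f g (suc M)) ∣          ≡⟨ ℚₚ.∣-p∣≡∣p∣ (∑ (suc M) (productDefect f g (suc M))) ⟩
    ∣ ∑ (suc M) (productDefect f g (suc M)) ∣            ≤⟨ ∣∑∣≤ (suc M) (productDefect f g (suc M)) ⟩
    ∑ (suc M) (λ j → ∣ productDefect f g (suc M) j ∣)    ≤⟨ ∑-mono (suc M) term ⟩
    ∑ (suc M) (λ j → rec j * K)                          ≡⟨ ∑-*ʳ (suc M) rec K ⟩
    K * harmonic (suc M)                                 ≤⟨ *-monoʳ K 0≤K (ℚₚ.≤-trans (≤-by 1ℚ 0≤1 (ℚₚ.+-comm 1ℚ (harmonic (suc M)))) H≤V) ⟩
    K * V                                                ≡⟨ solve 4 (λ b c v r → (b :* c) :* v :* r :* v := (b :* c) :* (v :* v) :* r) refl B C V (rec M) ⟩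
    (B * C) * (V * V) * rec M                            ∎
    where
    K = (B * C) * V * rec M
    0≤V : 0ℚ ≤ V
    0≤V = ℚₚ.≤-trans (0≤+ 0≤1 (0≤harmonic (suc M))) H≤V
    0≤K : 0ℚ ≤ K
    0≤K = 0≤* (0≤* (0≤* 0≤B 0≤C) 0≤V) (0≤rec M)
    term : ∀ j → j ℕ.< suc M → ∣ productDefect f g (suc M) j ∣ ≤ rec j * K
    term j j<N@(s≤s j≤M) = begin
      ∣ rec j * d * S ∣                        ≡⟨ trans (ℚₚ.∣p*q∣≡∣p∣*∣q∣ (rec j * d) S) (cong (_* ∣ S ∣) (trans (ℚₚ.∣p*q∣≡∣p∣*∣q∣ (rec j) d) (cong (_* ∣ d ∣) (ℚₚ.0≤p⇒∣p∣≡p (0≤rec j))))) ⟩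
      rec j * ∣ d ∣ * ∣ S ∣                    ≤⟨ *-mono (ℚₚ.0≤∣p∣ S) (0≤* (0≤rec j) (0≤* (0≤rec j) 0≤C))
                                                   (*-monoʳ (rec j) (0≤rec j) (Bounded.diffs bg 0 j j<N)) S≤ ⟩
      rec j * (rec j * C) * (B * (rec M * (ι (suc j) * V)))
        ≡⟨ solve 6 (λ r c b m i v → r :* (r :* c) :* (b :* (m :* (i :* v))) := r :* (i :* (r :* ((b :* c) :* v :* m)))) refl (rec j) C B (rec M) (ι (suc j)) V ⟩
      rec j * (ι (suc j) * (rec j * K))        ≡⟨ cong (rec j *_) (ι*rec* j K) ⟩
      rec j * K                                ∎
      where
      d = diff g 0 (suc j)
      S = ∑ (suc j) (antidiag f (suc M))
      S≤ : ∣ S ∣ ≤ B * (rec M * (ι (suc j) * V))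
      S≤ = begin
        ∣ S ∣                                          ≤⟨ ∣∑∣≤ (suc j) (antidiag f (suc M)) ⟩
        ∑ (suc j) (λ i → ∣ antidiag f (suc M) i ∣)     ≤⟨ ∑-mono (suc j) (λ i i≤j → entry i (ℕₚ.≤-trans (ℕₚ.≤-pred i≤j) j≤M)) ⟩
        ∑ (suc j) (λ i → rec (M ℕ.∸ i) * B)            ≡⟨ ∑-*ʳ (suc j) (λ i → rec (M ℕ.∸ i)) B ⟩
        B * ∑ (suc j) (λ i → rec (M ℕ.∸ i))            ≤⟨ *-monoʳ B 0≤B (∑-rec-reversed-≤ M V H≤V (suc j) j<N) ⟩
        B * (rec M * (ι (suc j) * V))                  ∎
        where
        entry : ∀ i → i ℕ.≤ M → ∣ antidiag f (suc M) i ∣ ≤ rec (M ℕ.∸ i) * B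
        entry i i≤M = subst (λ t → ∣ diff f i t ∣ ≤ rec (M ℕ.∸ i) * B) (sym (ℕₚ.+-∸-assoc 1 i≤M))
          (Bounded.diffs bf i (M ℕ.∸ i) (s≤s (ℕₚ.≤-reflexive (ℕₚ.m+[n∸m]≡n i≤M))))

  -- Bernoulli's inequality (1 + r/V)^a (1 - a r/V) ≤ 1 with denominators cleared.
  pow-bernoulli : ∀ V r → 0ℚ ≤ V → 0ℚ ≤ r → ∀ a → pow (V + r) a * (V - ι a * r) ≤ pow V a * V
  pow-bernoulli V r 0≤V 0≤r zero    = ℚₚ.≤-reflexive (trans (cong (λ t → 1ℚ * (V - t * r)) ι-0) (solve 2 (λ v r → con 1ℚ :* (v :- con 0ℚ :* r) := con 1ℚ :* v) refl V r))
  pow-bernoulli V r 0≤V 0≤r (suc a) = begin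
    P * (V + r) * (V - ι (suc a) * r)          ≡⟨ cong (λ t → P * (V + r) * (V - t * r)) (ι-suc a) ⟩
    P * (V + r) * (V - (1ℚ + ι a) * r)         ≤⟨ ≤-by (P * ((1ℚ + ι a) * (r * r))) (0≤* (0≤pow (0≤+ 0≤V 0≤r) a) (0≤* (0≤+ 0≤1 (0≤ι a)) (0≤* 0≤r 0≤r)))
                                                   (solve 4 (λ p v r a → (p :* (v :- a :* r)) :* v := p :* (v :+ r) :* (v :- (con 1ℚ :+ a) :* r) :+ p :* ((con 1ℚ :+ a) :* (r :* r))) refl P V r (ι a)) ⟩
    (P * (V - ι a * r)) * V                    ≤⟨ *-monoˡ V 0≤V (pow-bernoulli V r 0≤V 0≤r a) ⟩
    pow V a * V * V                            ∎
    where P = pow (V + r) a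

  module _ (Q : ℕ) (1≤Q : 1 ℕ.≤ Q) where

    V : ℕ → ℚ
    V n = ι Q + harmonic n

    1≤ιQ : 1ℚ ≤ ι Q
    1≤ιQ = ≤-by (ι (Q ℕ.∸ 1)) (0≤ι (Q ℕ.∸ 1)) (trans (cong ι (sym (ℕₚ.m+[n∸m]≡n 1≤Q))) (ι-suc (Q ℕ.∸ 1)))

    1≤V : ∀ n → 1ℚ ≤ V n
    1≤V n = ℚₚ.≤-trans 1≤ιQ (≤-by (harmonic n) (0≤harmonic n) refl)

    -- V n ^ Q / n is nonincreasing in n ≥ 1, because V n ≥ Q.
    pow-V-bound : ∀ M → pow (V (suc M)) Q * rec M ≤ pow (V 1) Q
    pow-V-bound zero    = ℚₚ.≤-reflexive (trans (cong (pow (V 1) Q *_) (rec-def 0)) (ℚₚ.*-identityʳ (pow (V 1) Q)))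
    pow-V-bound (suc M) = ℚₚ.≤-trans (begin
      pow (V (suc (suc M))) Q * r               ≡⟨ cong₂ (λ a b → pow a Q * b) (sym (ℚₚ.+-assoc (ι Q) (harmonic (suc M)) r)) r≡ ⟩
      pow (v + r) Q * ((1ℚ - r) * rec M)        ≡⟨ sym (ℚₚ.*-assoc (pow (v + r) Q) (1ℚ - r) (rec M)) ⟩
      pow (v + r) Q * (1ℚ - r) * rec M          ≤⟨ *-monoˡ {pow (v + r) Q * (1ℚ - r)} {pow v Q} (rec M) (0≤rec M) (ℚₚ.*-cancelʳ-≤-pos {pow (v + r) Q * (1ℚ - r)} {pow v Q} v key) ⟩
      pow v Q * rec M                           ∎) (pow-V-bound M)
      where
      v = V (suc M)
      r = rec (suc M)
      0≤v : 0ℚ ≤ v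
      0≤v = ℚₚ.≤-trans 0≤1 (1≤V (suc M))
      instance
        v-pos : Positive v
        v-pos = positive (ℚₚ.<-≤-trans (ℚₚ.positive⁻¹ 1ℚ) (1≤V (suc M)))
      r≡ : r ≡ (1ℚ - r) * rec M
      r≡ = begin-equality
        r                                   ≡⟨ solve 2 (λ r m → r := (r :+ m :* r) :- m :* r) refl r (rec M) ⟩
        (r + rec M * r) - rec M * r         ≡⟨ cong (_- rec M * r) (sym (rec-step M)) ⟩
        rec M - rec M * r                   ≡⟨ solve 2 (λ r m → m :- m :* r := (con 1ℚ :- r) :* m) refl r (rec M) ⟩
        (1ℚ - r) * rec M                    ∎
      key : pow (v + r) Q * (1ℚ - r) * v ≤ pow v Q * v
      key = begin
        -- Since v ≥ Q, the factor v(1 - r) is at most v - Qr, to which Bernoulli's inequality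
        -- applies.
        pow (v + r) Q * (1ℚ - r) * v        ≤⟨ ≤-by (pow (v + r) Q * (harmonic (suc M) * r))
                                                 (0≤* (0≤pow (0≤+ 0≤v (0≤rec (suc M))) Q) (0≤* (0≤harmonic (suc M)) (0≤rec (suc M))))
                                                 (solve 4 (λ p q h r → p :* ((q :+ h) :- q :* r) := p :* (con 1ℚ :- r) :* (q :+ h) :+ p :* (h :* r)) refl (pow (v + r) Q) (ι Q) (harmonic (suc M)) r) ⟩
        pow (v + r) Q * (v - ι Q * r)       ≤⟨ pow-bernoulli v r 0≤v (0≤rec (suc M)) Q ⟩
        pow v Q * v                         ∎

-- Null sequences and the linear part of Kawashima's relation

Null : (ℕ → ℚ) → Set
Null a = ∀ ε → 0ℚ < ε → ∃[ M ] (∀ n → M ℕ.≤ n → ∣ a n ∣ < ε)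

module _ where
  open ℚₚ.≤-Reasoning

  archimedean : ∀ ε → 0ℚ < ε → ∃[ j ] (rec j < ε)
  archimedean ε 0<ε with positive 0<ε
  -- The denominator of ε is d + 1, so 1/(d + 2) < 1/(d + 1) ≤ ε.
  archimedean ε@(mkℚ (+[1+ n ]) d _) _ | _ = suc d , subst (_< ε) (sym (rec-def (suc d))) (ℚₚ.toℚᵘ-cancel-<
    (ℚᵘₚ.<-respˡ-≃ (ℚᵘₚ.≃-sym (ℚₚ.toℚᵘ-fromℚᵘ (ℚᵘ.mkℚᵘ (pos 1) (suc d))))
      (ℚᵘ.*<* (ℤ.+<+ (s≤s (ℕₚ.≤-trans (ℕₚ.≤-reflexive (cong suc (ℕₚ.+-identityʳ d))) (ℕₚ.m≤m+n (suc d) _)))))))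

  shrink : ∀ C → 0ℚ ≤ C → ∀ ε → 0ℚ < ε → ∃[ δ′ ] (0ℚ < δ′ × (∀ t → 0ℚ ≤ t → t < δ′ → C * t < ε))
  -- Dividing by 1 + C instead of C covers C = 0.
  shrink C 0≤C ε 0<ε = 1/ k * ε , 0<δ , λ t 0≤t t<δ → begin-strict
      C * t              ≤⟨ *-monoˡ {C} t 0≤t (≤-by 1ℚ 0≤1 (ℚₚ.+-comm 1ℚ C)) ⟩
      k * t              <⟨ ℚₚ.*-monoʳ-<-pos k t<δ ⟩
      k * (1/ k * ε)     ≡⟨ trans (sym (ℚₚ.*-assoc k (1/ k) ε)) (trans (cong (_* ε) (ℚₚ.*-inverseʳ k)) (ℚₚ.*-identityˡ ε)) ⟩
      ε                  ∎
    where
    k = 1ℚ + C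
    instance
      k-pos : Positive k
      k-pos = positive (ℚₚ.<-≤-trans (ℚₚ.positive⁻¹ 1ℚ) (≤-by C 0≤C refl))
      k≢0 = ℚₚ.pos⇒nonZero k
      1/k-pos : Positive (1/ k)
      1/k-pos = ℚₚ.1/pos⇒pos k
    0<δ : 0ℚ < 1/ k * ε
    0<δ = subst (_< 1/ k * ε) (ℚₚ.*-zeroʳ (1/ k)) (ℚₚ.*-monoʳ-<-pos (1/ k) 0<ε)

  -- Squaring avoids roots: if V^(2p) ≤ C n, then the square of V^p / n is at most C / n.
  null-by-squares : ∀ a C → 0ℚ ≤ C → (∀ M → ∣ a (suc M) ∣ * ∣ a (suc M) ∣ ≤ C * rec M) → Null a
  null-by-squares a C 0≤C bound ε 0<ε =
    let (δ′ , 0<δ′ , C*<εε) = shrink C 0≤C (ε * ε) 0<εε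
        (j , rec<δ′)        = archimedean δ′ 0<δ′
    in suc j , tail j (C*<εε (rec j) (0≤rec j) rec<δ′)
    where
    instance
      ε-pos : Positive ε
      ε-pos = positive 0<ε
    0<εε : 0ℚ < ε * ε
    0<εε = ℚₚ.positive⁻¹ (ε * ε) {{ℚₚ.pos*pos⇒pos ε ε}}
    tail : ∀ j → C * rec j < ε * ε → ∀ n → suc j ℕ.≤ n → ∣ a n ∣ < ε
    tail j small (suc M) (s≤s j≤M) with ∣ a (suc M) ∣ ℚₚ.<? ε
    ... | yes a<ε = a<ε
    ... | no  a≮ε = contradiction (begin-strict
      ε * ε                              ≤⟨ *-mono (ℚₚ.<⇒≤ 0<ε) (ℚₚ.0≤∣p∣ (a (suc M))) (ℚₚ.≮⇒≥ a≮ε) (ℚₚ.≮⇒≥ a≮ε) ⟩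
      ∣ a (suc M) ∣ * ∣ a (suc M) ∣      ≤⟨ bound M ⟩
      C * rec M                          ≤⟨ *-monoʳ C 0≤C (subst (λ t → rec t ≤ rec j) (ℕₚ.m∸n+n≡m j≤M) (rec-+ (M ℕ.∸ j) j)) ⟩
      C * rec j                          <⟨ small ⟩
      ε * ε                              ∎) (ℚₚ.<-irrefl refl)

  kawashima : ∀ k u l v → Null (λ N → stuffle (φx (trunc N) 0) (k ∷ u) (l ∷ v))
  kawashima k u l v = null-by-squares _ C 0≤C λ M → square M (begin
      ∣ stuffle (φx (trunc (suc M)) 0) (k ∷ u) (l ∷ v) ∣
        ≡⟨ cong ∣_∣ (stuffle-φx-trunc (suc M) k u l v) ⟩
      ∣ deriv (suc M) (λ n → truncs w₁ n * truncs w₂ n) ∣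
        ≤⟨ deriv-product-bound M (W (suc M)) _ _ (truncs w₁) (truncs w₂) (H≤W (suc M)) (0≤pow (0≤W (suc M)) a) (0≤pow (0≤W (suc M)) b)
             (trunc-0 (EndsInY-⟨⟩ k u)) (trunc-0 (EndsInY-⟨⟩ l v)) (bounded-truncs (suc M) _ (H≤W (suc M)) w₁) (bounded-truncs (suc M) _ (H≤W (suc M)) w₂) ⟩
      (pow (W (suc M)) a * pow (W (suc M)) b) * (W (suc M) * W (suc M)) * rec M
        ≡⟨ cong (_* rec M) (trans (cong (_* (W (suc M) * W (suc M))) (sym (pow-+ (W (suc M)) a b))) (sym (ℚₚ.*-assoc (pow (W (suc M)) (a ℕ.+ b)) (W (suc M)) (W (suc M))))) ⟩
      pow (W (suc M)) p * rec M ∎)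
    where
    w₁ = ⟨ k ∷ u ⟩x^ 0
    w₂ = ⟨ l ∷ v ⟩x^ 0
    a = length w₁
    b = length w₂
    -- The two factors contribute V^(a + b) and the product defect V². Then Q = 2p, because the
    -- estimate is squared before `pow-V-bound` is applied.
    p = suc (suc (a ℕ.+ b))
    Q = p ℕ.+ p
    W = V Q (s≤s z≤n)
    0≤W : ∀ n → 0ℚ ≤ W n
    0≤W n = ℚₚ.≤-trans 0≤1 (1≤V Q (s≤s z≤n) n)
    H≤W : ∀ n → 1ℚ + harmonic n ≤ W n
    H≤W n = ℚₚ.+-monoˡ-≤ (harmonic n) (1≤ιQ Q (s≤s z≤n))
    C = pow (W 1) Q
    0≤C : 0ℚ ≤ C
    0≤C = 0≤pow (0≤W 1) Q
    square : ∀ M {t} → ∣ t ∣ ≤ pow (W (suc M)) p * rec M → ∣ t ∣ * ∣ t ∣ ≤ C * rec M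
    square M {t} t≤ = begin
      ∣ t ∣ * ∣ t ∣                    ≤⟨ *-mono (ℚₚ.0≤∣p∣ t) (0≤* (0≤pow (0≤W (suc M)) p) (0≤rec M)) t≤ t≤ ⟩
      (P * rec M) * (P * rec M)        ≡⟨ solve 2 (λ p r → (p :* r) :* (p :* r) := (p :* p) :* r :* r) refl P (rec M) ⟩
      (P * P) * rec M * rec M          ≡⟨ cong (λ q → q * rec M * rec M) (sym (pow-+ (W (suc M)) p p)) ⟩
      pow (W (suc M)) Q * rec M * rec M ≤⟨ *-monoˡ (rec M) (0≤rec M) (pow-V-bound Q (s≤s z≤n) M) ⟩
      C * rec M                        ∎
      where P = pow (W (suc M)) p

-- The quasi-derivation relation

module _ {J : (ℕ → ℚ) → Set} (idealJ : Ideal J) where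
  open Ideal idealJ

  J-neg : ∀ {a} → J a → J (λ n → - a n)
  J-neg {a} Ja = J-ext (λ n → solve 1 (λ a → con (- 1ℚ) :* a := :- a) refl (a n)) (J-* (- 1ℚ) Ja)

  -- `Δ` never shortens an index, so control on nonempty indices is enough.
  Δ-ideal : ∀ c {g : ℕ → Index → ℚ} → (∀ k v → J (λ N → g N (k ∷ v))) → ∀ k v → J (λ N → Δ c (g N) (k ∷ v))
  Δ-ideal c Jg k v = J-+ (J-+ (linear-ideal (fin-Δ c v) idealJ (Jg k)) (J-* (ι (suc k) - c * wt v) (Jg (suc k) v)))
    (J-* (- (c * wt (k ∷ v))) (Jg 0 (k ∷ v)))

  Δ^-ideal : ∀ c n {g : ℕ → Index → ℚ} → (∀ k v → J (λ N → g N (k ∷ v))) → ∀ k v → J (λ N → Δ^ c n (g N) (k ∷ v))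
  Δ^-ideal c zero    Jg = Jg
  Δ^-ideal c (suc n) {g} Jg = Δ^-ideal c n (Δ-ideal c {g} Jg)

  -- φ maps a word ending in y to a combination of such words, its last y only changing sign.
  φᵗ-ideal : ∀ {g : ℕ → Word → ℚ} → (∀ {w} → EndsInY w → J (λ N → g N w)) → ∀ {w} → EndsInY w → J (λ N → φᵗ (g N) w)
  φᵗ-ideal Jg here          = J-neg (Jg here)
  φᵗ-ideal Jg (there X w∈y) = J-+ (φᵗ-ideal (λ v∈y → Jg (there X v∈y)) w∈y) (φᵗ-ideal (λ v∈y → Jg (there Y v∈y)) w∈y)
  φᵗ-ideal Jg (there Y w∈y) = J-neg (φᵗ-ideal (λ v∈y → Jg (there Y v∈y)) w∈y)

  -- φ being an involution, xw is x φ(φ(w)), and φ(w) is a combination of nonempty indices without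
  -- tail. There the operator is multiplication by Δ^n(z₁), a combination of nonempty indices as
  -- well.
  adᵗ-ideal : ∀ c n {g : ℕ → Word → ℚ} → (∀ k u l v → J (λ N → stuffle (φx (g N) 0) (k ∷ u) (l ∷ v))) →
              ∀ {w} → EndsInY w → J (λ N → adᵗ c n (g N) (X ∷ w))
  adᵗ-ideal c n {g} Jg {w} w∈y = J-ext (λ N → φᵗ-involutive (adᵗ c n (g N) ∘∷ X) w) (φᵗ-ideal conjugate w∈y)
    where
    conjugate : ∀ {v} → EndsInY v → J (λ N → φᵗ (adᵗ c n (g N) ∘∷ X) v)
    conjugate v∈y with ⟨⟩-EndsInY v∈y
    ... | l , v , refl = J-ext (λ N → sym (adᵗ-stuffle c n (g N) (l ∷ v) 0)) (J-neg (Δ^-ideal c n (λ k u → Jg k u l v) 0 []))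

  ∂-ideal : ∀ c n {g : ℕ → Word → ℚ} → (∀ k u l v → J (λ N → stuffle (φx (g N) 0) (k ∷ u) (l ∷ v))) →
            ∀ w → w ∈𝓗⁰ → J (λ N → eval (g N) (∂ (suc n) c w))
  ∂-ideal c n {g} Jg w w∈ = J-ext (λ N → sym (expansion (g N)))
    (J-* q (linear-ideal (fin-eval inner) idealJ (λ v → adᵗ-ideal c n Jg (++Y-EndsInY v))))
    where
    open _∈𝓗⁰ w∈
    open ≡-Reasoning
    q = (pos 1 / (n !)) {{n ℕₚ.!≢0}}
    expansion : ∀ g → eval g (∂ (suc n) c w) ≡ q * eval (λ v → adᵗ c n g (X ∷ v ++ [ Y ])) inner
    expansion g = begin
      eval g (∂ (suc n) c w)                              ≡⟨ eval-• g q (ad^ n (θ c) ∂₁ w) ⟩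
      q * eval g (ad^ n (θ c) ∂₁ w)                       ≡⟨ cong (q *_) (trans (eval-adᵗ c n g w) (eval-cong h decomposition)) ⟩
      q * eval h (const • 1ᴴ ⊕ x ⊙ inner ⊙ y)             ≡⟨ cong (q *_) (eval-⊕ h (const • 1ᴴ) (x ⊙ inner ⊙ y)) ⟩
      q * (eval h (const • 1ᴴ) + eval h (x ⊙ inner ⊙ y))
        ≡⟨ cong₂ (λ s t → q * (s + t))
             (trans (eval-• h const 1ᴴ) (trans (cong (const *_) (trans (eval-mono h []) (adᵗ-[] c n g))) (ℚₚ.*-zeroʳ const)))
             (trans (eval-⊙mono h (x ⊙ inner) [ Y ]) (eval-mono⊙ (λ a → h (a ++ [ Y ])) [ X ] inner)) ⟩
      q * (0ℚ + eval (λ v → h (X ∷ v ++ [ Y ])) inner)    ≡⟨ cong (q *_) (ℚₚ.+-identityˡ _) ⟩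
      q * eval (λ v → h (X ∷ v ++ [ Y ])) inner           ∎
      where h = adᵗ c n g

-- The two ideals and the conclusion

Zero : (ℕ → ℚ) → Set
Zero a = ∀ n → a n ≡ 0ℚ

zero-ideal : Ideal Zero
zero-ideal = record
  { J-ext = λ a≗b a≡0 n → trans (sym (a≗b n)) (a≡0 n)
  ; J-0   = λ _ → refl
  ; J-+   = λ a≡0 b≡0 n → cong₂ _+_ (a≡0 n) (b≡0 n)
  ; J-*   = λ q a≡0 n → trans (cong (q *_) (a≡0 n)) (ℚₚ.*-zeroʳ q)
  }

null-ideal : Ideal Null
null-ideal = record
  { J-ext = λ a≗b null ε 0<ε → let (M , small) = null ε 0<ε in M , λ n n≥ → subst (λ t → ∣ t ∣ < ε) (a≗b n) (small n n≥)
  ; J-0   = λ ε 0<ε → 0 , λ _ _ → 0<ε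
  ; J-+   = λ {a} {b} nulla nullb ε 0<ε → let
        0<½ε        = subst (_< ½ * ε) (ℚₚ.*-zeroʳ ½) (ℚₚ.*-monoʳ-<-pos ½ 0<ε)
        (M , smalla) = nulla (½ * ε) 0<½ε
        (N , smallb) = nullb (½ * ε) 0<½ε
      in M ℕ.⊔ N , λ n n≥ → begin-strict
        ∣ a n + b n ∣          ≤⟨ ℚₚ.∣p+q∣≤∣p∣+∣q∣ (a n) (b n) ⟩
        ∣ a n ∣ + ∣ b n ∣      <⟨ ℚₚ.+-mono-< (smalla n (ℕₚ.m⊔n≤o⇒m≤o M N n≥)) (smallb n (ℕₚ.m⊔n≤o⇒n≤o M N n≥)) ⟩
        ½ * ε + ½ * ε          ≡⟨ solve 1 (λ e → con ½ :* e :+ con ½ :* e := e) refl ε ⟩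
        ε                      ∎
  ; J-*   = scaled
  }
  where
  open ℚₚ.≤-Reasoning
  scaled : ∀ q {a} → Null a → Null (λ n → q * a n)
  scaled q {a} null ε 0<ε =
    let (δ′ , 0<δ′ , small*) = shrink ∣ q ∣ (ℚₚ.0≤∣p∣ q) ε 0<ε
        (M , small)          = null δ′ 0<δ′
    in M , λ n n≥ → subst (_< ε) (sym (ℚₚ.∣p*q∣≡∣p∣*∣q∣ q (a n))) (small* ∣ a n ∣ (ℚₚ.0≤∣p∣ (a n)) (small n n≥))

init : Word → Word
init []          = []
init (a ∷ [])    = []
init (a ∷ b ∷ w) = a ∷ init (b ∷ w)

init-++ : ∀ w a → init (w ++ [ a ]) ≡ w
init-++ []          a = refl
init-++ (b ∷ [])    a = refl
init-++ (b ∷ d ∷ w) a = cong (b ∷_) (init-++ (d ∷ w) a)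

-- The dual description of the subspace 𝓗⁰, which makes membership accessible to transposed
-- operators.
∈𝓗⁰-by-eval : ∀ u → (∀ g → g [] ≡ 0ℚ → (∀ w → g (X ∷ w ++ [ Y ]) ≡ 0ℚ) → eval g u ≡ 0ℚ) → u ∈𝓗⁰
∈𝓗⁰-by-eval u vanish = record { const = k ; inner = lin strip u ; decomposition = eval⇒≈ decomp }
  where
  open ≡-Reasoning
  k = coeff u []
  -- Arbitrary outside 1 and x𝓗y.
  strip : Word → 𝓗
  strip []      = 0ᴴ
  strip (a ∷ w) = mono (init w)
  decomp : ∀ f → eval f u ≡ eval f (k • 1ᴴ ⊕ x ⊙ lin strip u ⊙ y)
  decomp f = begin
    eval f u
      ≡⟨ solve 2 (λ a b → a := (a :- b) :+ b) refl (eval f u) (eval f♯ u) ⟩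
    (eval f u - eval f♯ u) + eval f♯ u
      -- `f♯` is f composed with the candidate decomposition, so f and `f♯` agree on 1 and on x𝓗y.
      ≡⟨ cong (_+ eval f♯ u) (trans (sym (linear-sub (fin-eval u) f f♯)) (vanish (λ w → f w - f♯ w) at-[] at-xy)) ⟩
    0ℚ + eval f♯ u
      ≡⟨ trans (ℚₚ.+-identityˡ _) (eval-+ (λ w → f [] * δ w []) (λ w → eval f′ (strip w)) u) ⟩
    eval (λ w → f [] * δ w []) u + eval (λ w → eval f′ (strip w)) u
      ≡⟨ cong₂ _+_ (trans (eval-* (f []) (λ w → δ w []) u) (ℚₚ.*-comm (f []) k)) (sym (eval-lin f′ strip u)) ⟩
    k * f [] + eval f′ (lin strip u)
      ≡⟨ cong₂ _+_ (sym (trans (eval-• f k 1ᴴ) (cong (k *_) (eval-mono f []))))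
           (sym (trans (eval-⊙mono f (x ⊙ lin strip u) [ Y ]) (eval-mono⊙ (λ a → f (a ++ [ Y ])) [ X ] (lin strip u)))) ⟩
    eval f (k • 1ᴴ) + eval f (x ⊙ lin strip u ⊙ y)
      ≡⟨ sym (eval-⊕ f (k • 1ᴴ) (x ⊙ lin strip u ⊙ y)) ⟩
    eval f (k • 1ᴴ ⊕ x ⊙ lin strip u ⊙ y) ∎
    where
    f′ : Word → ℚ
    f′ v = f (X ∷ v ++ [ Y ])
    f♯ : Word → ℚ
    f♯ w = f [] * δ w [] + eval f′ (strip w)
    at-[] : f [] - f♯ [] ≡ 0ℚ
    at-[] = solve 1 (λ a → a :- (a :* con 1ℚ :+ con 0ℚ) := con 0ℚ) refl (f [])
    at-xy : ∀ w → f′ w - f♯ (X ∷ w ++ [ Y ]) ≡ 0ℚ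
    at-xy w = trans (cong (λ t → f′ w - (f [] * 0ℚ + t)) (trans (eval-mono f′ (init (w ++ [ Y ]))) (cong f′ (init-++ w Y))))
      (solve 2 (λ a b → a :- (b :* con 0ℚ :+ a) := con 0ℚ) refl (f′ w) (f []))

-- φ preserves 𝓗y, so a functional that vanishes on x𝓗y also vanishes on x φ of every nonempty
-- index.
stuffle-φx-vanish : ∀ g → (∀ w → g (X ∷ w ++ [ Y ]) ≡ 0ℚ) → ∀ k u v → stuffle (φx g 0) (k ∷ u) v ≡ 0ℚ
stuffle-φx-vanish g vanish k u v = trans
  (stuffle-ext-∷ {φx g 0} {λ _ → 0ℚ} (λ l w → φᵗ-ideal zero-ideal {λ _ → g ∘∷ X} (λ w∈y _ → onY w∈y) (EndsInY-⟨⟩ l w) 0) k u v)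
  (linear-0 (fin-stuffle (k ∷ u) v))
  where
  EndsInY-++Y : ∀ {w} → EndsInY w → ∃[ v ] w ≡ v ++ [ Y ]
  EndsInY-++Y here = [] , refl
  EndsInY-++Y (there a w∈y) with EndsInY-++Y w∈y
  ... | v , refl = a ∷ v , refl
  onY : ∀ {w} → EndsInY w → g (X ∷ w) ≡ 0ℚ
  onY w∈y with EndsInY-++Y w∈y
  ... | v , refl = vanish v

mainTheorem1 : ∀ (n : ℕ) → 1 ℕ.≤ n → ∀ (c : ℚ) →
    (∀ (w : 𝓗) → w ∈𝓗⁰ → ∂ n c w ∈𝓗⁰) ×
    (∀ (w : 𝓗) → w ∈𝓗⁰ → (∂w∈𝓗⁰ : ∂ n c w ∈𝓗⁰) → Z (∂ n c w) ∂w∈𝓗⁰ ≃ 0ℝ)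
mainTheorem1 (suc n) _ c = preserves , kernel
  where
  preserves : ∀ w → w ∈𝓗⁰ → ∂ (suc n) c w ∈𝓗⁰
  preserves w w∈ = ∈𝓗⁰-by-eval (∂ (suc n) c w) λ g _ g≡0 →
    -- A single functional is viewed as a constant sequence and read off at 0.
    ∂-ideal zero-ideal c n {λ _ → g} (λ k u l v _ → stuffle-φx-vanish g g≡0 k u (l ∷ v)) w w∈ 0
  kernel : ∀ w → w ∈𝓗⁰ → (∂w∈ : ∂ (suc n) c w ∈𝓗⁰) → Z (∂ (suc n) c w) ∂w∈ ≃ 0ℝ
  kernel w w∈ ∂w∈ = mk≃ λ ε 0<ε →
    -- `Zᵂ≤` and `trunc` differ at the empty word only. `φx` evaluates at words beginning with x,
    -- where they agree by computation, so `kawashima` applies.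
    let (M , small) = ∂-ideal null-ideal c n {Zᵂ≤} kawashima w w∈ ε 0<ε
    in M , λ N N≥ → subst (λ t → ∣ t ∣ < ε)
         (sym (trans (ℚₚ.+-identityʳ _) (seq-Z N (∂ (suc n) c w) ∂w∈))) (small N N≥)
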